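{- For every skew partition $\lambda/\mu$, $\mathrm{zrank}(\lambda/\mu)=\mathrm{rank}(\lambda/\mu)$.
   Context: Partitions are identified with Young diagrams (English convention); the square $(i,j)$ lies in row $i$ and column $j$ and has content $j-i$. For partitions $\mu\subseteq\lambda$, the skew diagram $\lambda/\mu$ consists of the squares of $\lambda$ not in $\mu$. A square $(i,j)$ is an inner corner of $\lambda/\mu$ if $(i,j),(i,j-1),(i-1,j)\in\lambda/\mu$ but $(i-1,j-1)\notin\lambda/\mu$; it is an outer corner if $(i,j)\in\lambda/\mu$ but $(i-1,j-1),(i,j-1),(i-1,j)\notin\lambda/\mu$. The inner (resp. outer) diagonal of an inner (resp. outer) corner $(i,j)$ consists of all squares $(i+p,j+p)\in\lambda/\mu$, $p\ge 0$. Let $d^+$ be the total number of squares on all outer diagonals and $d^-$ the total number on all inner diagonals; $\mathrm{rank}(\lambda/\mu)=d^+-d^-$. Let $s_{\lambda/\mu}$ be the skew Schur function and $s_{\lambda/\mu}(1^t)$ its specialization $x_1=\cdots=x_t=1$, $x_i=0$ for $i>t$ (a polynomial in $t$). Then $\mathrm{zrank}(\lambda/\mu)$ is the exponent of the largest power of $t$ dividing $s_{\lambda/\mu}(1^t)$. -}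

module Defs where

open import Data.Nat using (ℕ; zero; suc; _+_; _∸_; _^_; _≤_; _<ᵇ_; _≤ᵇ_; _≡ᵇ_)
open import Data.Bool using (Bool; true; false; _∧_; not; if_then_else_)
open import Data.List using (List; []; _∷_; [_]; map; upTo; concatMap; zip; length; filterᵇ; foldr)
open import Data.Nat.ListAction using (sum)
open import Data.List.Relation.Unary.Linked using (Linked)
open import Data.Product using (_×_; _,_; Σ)
open import Data.Integer as ℤ using (ℤ)
open import Data.Rational as ℚ using (ℚ)
open import Relation.Binary.PropositionalEquality using (_≡_)

-- A partition: a weakly decreasing list of natural numbers (trailing zeros allowed).
record Partition : Set where
  field
    parts : List ℕ
    decreasing : Linked (λ a b → b ≤ a) parts
open Partition public

-- Length of row i, rows 1-indexed; "row 0" has length 0 (lies outside every diagram).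
rowLen : List ℕ → ℕ → ℕ
rowLen xs zero = 0
rowLen [] (suc i) = 0
rowLen (x ∷ xs) (suc zero) = x
rowLen (x ∷ xs) (suc (suc i)) = rowLen xs (suc i)

_⊆ₚ_ : Partition → Partition → Set
mu ⊆ₚ la = ∀ i → rowLen (parts mu) i ≤ rowLen (parts la) i

-- Square (i , j) (1-indexed row i, column j) lies in la / mu
inSkew : Partition → Partition → ℕ → ℕ → Bool
inSkew la mu i j = (rowLen (parts mu) i <ᵇ j) ∧ (j ≤ᵇ rowLen (parts la) i)

-- A bound on row and column indices of all squares of la
bound : Partition → ℕ
bound la = length (parts la) + sum (parts la)

range1 : ℕ → List ℕ
range1 n = map suc (upTo n)

cells : Partition → Partition → List (ℕ × ℕ)
cells la mu =
  filterᵇ (λ c → inSkew la mu (Data.Product.proj₁ c) (Data.Product.proj₂ c))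
    (concatMap (λ i → map (λ j → (i , j)) (range1 (bound la))) (range1 (bound la)))

isInnerCorner : Partition → Partition → ℕ × ℕ → Bool
isInnerCorner la mu (i , j) =
  inSkew la mu i j ∧ inSkew la mu i (j ∸ 1) ∧ inSkew la mu (i ∸ 1) j
    ∧ not (inSkew la mu (i ∸ 1) (j ∸ 1))

isOuterCorner : Partition → Partition → ℕ × ℕ → Bool
isOuterCorner la mu (i , j) =
  inSkew la mu i j ∧ not (inSkew la mu (i ∸ 1) (j ∸ 1))
    ∧ not (inSkew la mu i (j ∸ 1)) ∧ not (inSkew la mu (i ∸ 1) j)

diagLen : Partition → Partition → ℕ × ℕ → ℕ
diagLen la mu (i , j) =
  length (filterᵇ (λ p → inSkew la mu (i + p) (j + p)) (upTo (suc (bound la))))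

dPlus : Partition → Partition → ℕ
dPlus la mu = sum (map (diagLen la mu) (filterᵇ (isOuterCorner la mu) (cells la mu)))

dMinus : Partition → Partition → ℕ
dMinus la mu = sum (map (diagLen la mu) (filterᵇ (isInnerCorner la mu) (cells la mu)))

rank : Partition → Partition → ℤ
rank la mu = ℤ.+ dPlus la mu ℤ.- ℤ.+ dMinus la mu

fillings : ℕ → ℕ → List (List ℕ)
fillings zero t = [ [] ]
fillings (suc n) t = concatMap (λ v → map (v ∷_) (fillings n t)) (range1 t)

compatible : (ℕ × ℕ) × ℕ → (ℕ × ℕ) × ℕ → Bool
compatible ((i , j) , a) ((i' , j') , b) =
  (if (i ≡ᵇ i') ∧ (j <ᵇ j') then a ≤ᵇ b else true)
  ∧ (if (j ≡ᵇ j') ∧ (i <ᵇ i') then a <ᵇ b else true)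

allᵇ : {A : Set} → (A → Bool) → List A → Bool
allᵇ p = foldr (λ x b → p x ∧ b) true

isSSYT : List ((ℕ × ℕ) × ℕ) → Bool
isSSYT T = allᵇ (λ x → allᵇ (compatible x) T) T

-- s_{la/mu}(1^t) = number of semistandard tableaux of shape la/mu with entries in [1..t]
schurOnes : Partition → Partition → ℕ → ℕ
schurOnes la mu t =
  length (filterᵇ isSSYT (map (zip (cells la mu)) (fillings (length (cells la mu)) t)))

evalPoly : List ℚ → ℚ → ℚ
evalPoly [] x = ℚ.0ℚ
evalPoly (c ∷ cs) x = c ℚ.+ x ℚ.* evalPoly cs x

toℚ : ℕ → ℚ
toℚ n = ℤ.+ n ℚ./ 1

-- t^k divides the polynomial s_{la/mu}(1^t) in ℚ[t]
-- (a polynomial is determined by its values at all t ∈ ℕ)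
TPowDivides : Partition → Partition → ℕ → Set
TPowDivides la mu k =
  Σ (List ℚ) λ Q → ∀ (t : ℕ) → toℚ (schurOnes la mu t) ≡ toℚ (t ^ k) ℚ.* evalPoly Q (toℚ t)

IsZRank : Partition → Partition → ℕ → Set
IsZRank la mu k = TPowDivides la mu k × (TPowDivides la mu (suc k) → Data.Empty.⊥)
  where import Data.Empty

-- By the Jacobi–Trudi identity, s_{λ/μ}(1^t) = det (h_{a_i - b_j}(1^t)) with a_i = λ_i - i and
-- b_j = μ_j - j, where h₀ = 1 and h_n(1^t) = t / n + O(t²) for n > 0. Hence the determinant starts in
-- degree r, the number of a_i that are not among the b_j, which equals the rank; and after deleting
-- the common values its coefficient of t^r is, up to sign, the determinant of the restricted Cauchy
-- matrix with entries 1 / (a_i - b_j) for b_j < a_i and 0 otherwise. With the rows increasing in a and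
-- the columns decreasing in b, (-1)^(number of zero entries) times this determinant is positive: a full
-- Cauchy matrix is totally positive, and if the corner entry is 0, Dodgson condensation expresses the
-- signed determinant through smaller ones with positive coefficients.
{-# OPTIONS --safe #-}
module Submission where

open import Defs
open import Data.Nat as ℕ using (ℕ; suc; _^_; zero; _∸_; _≤ᵇ_; _<ᵇ_; _≡ᵇ_; z≤n; s≤s)
open import Data.Bool using (Bool; true; false; if_then_else_; not; _∧_)
open import Data.Bool.Properties using (T-≡; T?; ¬-not)
open import Data.Empty using (⊥)
open import Data.Integer as ℤ using (ℤ)
import Data.Integer.Properties as ℤP
open import Data.List using (List; []; _∷_; _++_; map; length; [_]; concatMap; zip; filterᵇ; upTo; applyUpTo; initLast; _∷ʳ′_; reverse)
open import Data.List.Membership.DecPropositional ℕ._≟_ using (_∈?_)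
open import Data.List.Membership.Propositional using (_∈_; _∉_; find; lose)
open import Data.List.Membership.Propositional.Properties using (∈-++⁺ˡ; ∈-++⁺ʳ; ∈-++⁻; ∈-insert; ∈-∃++; ∈-map⁺; ∈-map⁻; ∈-concatMap⁺; ∈-concatMap⁻; ∈-filter⁺; ∈-filter⁻; ∈-upTo⁺; ∈-upTo⁻)
open import Data.List.Properties using (++-assoc; ≡-dec; length-++; length-map; ∷-injective; ∷-injectiveˡ; ∷-injectiveʳ; map-++; ++-identityʳ; unfold-reverse; length-reverse; map-∘; map-cong)
open import Data.List.Relation.Binary.Permutation.Propositional as Perm using (_↭_; prep; swap)
open import Data.List.Relation.Binary.Permutation.Propositional.Properties using (↭-reverse; map⁺; ∈-resp-↭)
open import Data.List.Relation.Unary.All as All using (All; []; _∷_)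
import Data.List.Relation.Unary.All.Properties as AllP
open import Data.List.Relation.Unary.AllPairs as AllPairs using (AllPairs; []; _∷_)
import Data.List.Relation.Unary.AllPairs.Properties as AllPairsP
open import Data.List.Relation.Unary.Any as Any using (here; there)
open import Data.List.Relation.Unary.Linked using (Linked; []; [-]; _∷_)
open import Data.List.Relation.Unary.Unique.Propositional using (Unique)
import Data.List.Relation.Unary.Unique.Propositional.Properties as UniqueP
open import Data.Nat.ListAction using (sum)
open import Data.Nat.ListAction.Properties using (sum-++)
import Data.Nat.Properties as ℕP
open import Data.Product using (Σ; _×_; _,_; proj₁; proj₂)
open import Data.Product.Properties using () renaming (≡-dec to ×-≡-dec)
open import Data.Rational as ℚ using (ℚ; 0ℚ; 1ℚ; toℚᵘ; mkℚ)
import Data.Rational.Properties as ℚP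
import Data.Rational.Unnormalised as ℚᵘ
import Data.Rational.Unnormalised.Properties as ℚᵘP
open import Data.Sum using (_⊎_; inj₁; inj₂)
open import Data.Unit using (⊤; tt)
open import Function using (_∘_; Equivalence)
open import Relation.Binary using (tri<; tri≈; tri>)
open import Relation.Binary.PropositionalEquality using (_≡_; _≢_; refl; sym; trans; cong; cong₂; subst; subst₂; module ≡-Reasoning)
open import Relation.Nullary using (Dec; yes; no; contradiction; ¬_; does)

-- Dodgson's identity determines the large determinant only through its product with the central
-- minor, so that minor must be nonzero, while minors of a restricted Cauchy matrix can vanish. The
-- invariant behind this is `Ballot`: for each v, at least as many b as a are at most v. It is the
-- form that containment of the partitions takes in terms of a and b, and it survives the deletion
-- of a common value. Where it fails, a block of zeros forces the determinant to vanish. The central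
-- minor and three of the four other minors inherit it; the fourth is at worst zero, which still
-- gives strict positivity. Jacobi-Trudi is proved by recursion on t: the squares with the largest
-- entry form a horizontal strip, and the determinant obeys the same recursion because each row
-- telescopes down to the row below it. For the rank, the outer and the inner diagonal belonging to
-- row i both count the k for which μ_i - i lies between μ_k - k and λ_k - k, with the lower end
-- included for the outer and the upper end for the inner one. Only values at natural t are
-- available, so the exactness of the exponent is drawn from divisibility of integers.

-- Determinants over lists: Laplace expansion, Plücker relations, Dodgson condensation.

module Determinants where

  open import Data.Rational using (_+_; _*_; -_; _-_)
  open import Data.Rational.Solver using (module +-*-Solver)
  open +-*-Solver using (solve; _:=_; _:+_; _:*_; :-_; _:-_; con)

  -- The Laplace expansion in the abstract: `f` receives one element and the list of the others, and
  -- the nested subtractions produce the alternating signs. Row operations are thus proved once, for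
  -- an arbitrary `f`.
  alt : {A : Set} → (A → List A → ℚ) → List A → ℚ
  alt f []       = 0ℚ
  alt f (r ∷ rs) = f r rs - alt (λ r′ rest → f r′ (r ∷ rest)) rs

  module _ {A : Set} where

    alt-cong : {f g : A → List A → ℚ} (rs : List A) →
      (∀ ps r qs → rs ≡ ps ++ r ∷ qs → f r (ps ++ qs) ≡ g r (ps ++ qs)) → alt f rs ≡ alt g rs
    alt-cong []       h = refl
    alt-cong (r ∷ rs) h = cong₂ _-_ (h [] r rs refl)
      (alt-cong rs λ ps r′ qs eq → h (r ∷ ps) r′ qs (cong (r ∷_) eq))

    alt-ext : {f g : A → List A → ℚ} (rs : List A) → (∀ r rest → f r rest ≡ g r rest) → alt f rs ≡ alt g rs
    alt-ext rs h = alt-cong rs λ ps r qs _ → h r (ps ++ qs)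

    alt-zero : {f : A → List A → ℚ} (rs : List A) →
      (∀ ps r qs → rs ≡ ps ++ r ∷ qs → f r (ps ++ qs) ≡ 0ℚ) → alt f rs ≡ 0ℚ
    alt-zero []       h = refl
    alt-zero (r ∷ rs) h = cong₂ _-_ (h [] r rs refl)
      (alt-zero rs λ ps r′ qs eq → h (r ∷ ps) r′ qs (cong (r ∷_) eq))

    alt-+* : (k : ℚ) {f g : A → List A → ℚ} (rs : List A) →
      alt (λ r rest → f r rest + k * g r rest) rs ≡ alt f rs + k * alt g rs
    alt-+* k [] = solve 1 (λ k → con 0ℚ := con 0ℚ :+ k :* con 0ℚ) refl k
    alt-+* k {f} {g} (r ∷ rs) = trans
      (cong (λ x → f r rs + k * g r rs - x) (alt-+* k rs))
      (solve 5 (λ k a b c d → a :+ k :* b :- (c :+ k :* d) := a :- c :+ k :* (b :- d)) refl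
        k (f r rs) (g r rs) (alt (λ r′ rest → f r′ (r ∷ rest)) rs) (alt (λ r′ rest → g r′ (r ∷ rest)) rs))

    alt-- : {f g : A → List A → ℚ} (rs : List A) → alt (λ r rest → f r rest - g r rest) rs ≡ alt f rs - alt g rs
    alt-- [] = refl
    alt-- {f} {g} (r ∷ rs) = trans
      (cong (λ x → f r rs - g r rs - x) (alt-- rs))
      (solve 4 (λ a b c d → a :- b :- (c :- d) := a :- c :- (b :- d)) refl
        (f r rs) (g r rs) (alt (λ r′ rest → f r′ (r ∷ rest)) rs) (alt (λ r′ rest → g r′ (r ∷ rest)) rs))

    alt-*ˡ : (k : ℚ) {f : A → List A → ℚ} (rs : List A) → alt (λ r rest → k * f r rest) rs ≡ k * alt f rs
    alt-*ˡ k [] = sym (ℚP.*-zeroʳ k)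
    alt-*ˡ k {f} (r ∷ rs) = trans
      (cong (λ x → k * f r rs - x) (alt-*ˡ k rs))
      (solve 3 (λ k a b → k :* a :- k :* b := k :* (a :- b)) refl k (f r rs) (alt (λ r′ rest → f r′ (r ∷ rest)) rs))

    -- Two elements can be removed in either order with the same remainder, but the position of the
    -- later one drops by one once the earlier one has gone, hence the opposite signs. For `det`
    -- this is the exchange of two columns.
    alt-alt-swap : (g : A → A → List A → ℚ) (rs : List A) →
      alt (λ r rest → alt (λ r′ rest′ → g r r′ rest′) rest) rs ≡
      - alt (λ r rest → alt (λ r′ rest′ → g r′ r rest′) rest) rs
    alt-alt-swap g [] = refl
    alt-alt-swap g (r ∷ rs) = begin
      X - alt (λ r₁ rest → g r₁ r rest - alt (λ r′ rest′ → g r₁ r′ (r ∷ rest′)) rest) rs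
        ≡⟨ cong (λ z → X - z) (alt-- rs) ⟩
      X - (Y - alt (λ r₁ rest → alt (λ r′ rest′ → g r₁ r′ (r ∷ rest′)) rest) rs)
        ≡⟨ cong (λ z → X - (Y - z)) (alt-alt-swap (λ a b l → g a b (r ∷ l)) rs) ⟩
      X - (Y - - Z)
        ≡⟨ solve 3 (λ x y z → x :- (y :- (:- z)) := :- (y :- (x :- z))) refl X Y Z ⟩
      - (Y - (X - Z))
        ≡⟨ cong (λ z → - (Y - z)) (sym (alt-- rs)) ⟩
      - (Y - alt (λ r₁ rest → g r r₁ rest - alt (λ r′ rest′ → g r′ r₁ (r ∷ rest′)) rest) rs) ∎
      where
      open ≡-Reasoning
      X = alt (λ r′ rest′ → g r r′ rest′) rs
      Y = alt (λ r′ rest′ → g r′ r rest′) rs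
      Z = alt (λ r₁ rest → alt (λ r′ rest′ → g r′ r₁ (r ∷ rest′)) rest) rs

    -- The terms that remove `x` or `y` trade places with opposite signs; in all others `x` and `y`
    -- stay adjacent in the remainder, where the hypothesis on `f` applies.
    alt-rowSwap : (f : A → List A → ℚ) (x y : A) →
      (∀ r ps qs → f r (ps ++ x ∷ y ∷ qs) ≡ - f r (ps ++ y ∷ x ∷ qs)) →
      ∀ ps qs → alt f (ps ++ x ∷ y ∷ qs) ≡ - alt f (ps ++ y ∷ x ∷ qs)
    alt-rowSwap f x y h [] qs = trans
      (cong (λ z → f x (y ∷ qs) - (f y (x ∷ qs) - z)) (trans (alt-ext qs λ r rest → trans (h r [] rest) (neg≡-1* (f r (y ∷ x ∷ rest)))) (alt-*ˡ (- 1ℚ) qs)))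
      (solve 3 (λ a b c → a :- (b :- (con (- 1ℚ) :* c)) := :- (b :- (a :- c))) refl
        (f x (y ∷ qs)) (f y (x ∷ qs)) (alt (λ r rest → f r (y ∷ x ∷ rest)) qs))
      where
      neg≡-1* : ∀ a → - a ≡ (- 1ℚ) * a
      neg≡-1* = solve 1 (λ a → :- a := con (- 1ℚ) :* a) refl
    alt-rowSwap f x y h (p ∷ ps) qs = trans
      (cong₂ _-_ (h p ps qs) (alt-rowSwap (λ r rest → f r (p ∷ rest)) x y (λ r ps′ → h r (p ∷ ps′)) ps qs))
      (solve 2 (λ a b → (:- a) :- (:- b) := :- (a :- b)) refl
        (f p (ps ++ y ∷ x ∷ qs)) (alt (λ r rest → f r (p ∷ rest)) (ps ++ y ∷ x ∷ qs)))

    alt-rowLinear : (f : A → List A → ℚ) (k : ℚ) (z x y : A) →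
      (∀ rest → f z rest ≡ f x rest + k * f y rest) →
      (∀ r ps qs → f r (ps ++ z ∷ qs) ≡ f r (ps ++ x ∷ qs) + k * f r (ps ++ y ∷ qs)) →
      ∀ ps qs → alt f (ps ++ z ∷ qs) ≡ alt f (ps ++ x ∷ qs) + k * alt f (ps ++ y ∷ qs)
    alt-rowLinear f k z x y h₁ h₂ [] qs = trans
      (cong₂ _-_ (h₁ qs) (trans (alt-ext qs λ r rest → h₂ r [] rest) (alt-+* k qs)))
      (solve 5 (λ k a b c d → a :+ k :* b :- (c :+ k :* d) := a :- c :+ k :* (b :- d)) refl
        k (f x qs) (f y qs) (alt (λ r rest → f r (x ∷ rest)) qs) (alt (λ r rest → f r (y ∷ rest)) qs))
    alt-rowLinear f k z x y h₁ h₂ (p ∷ ps) qs = trans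
      (cong₂ _-_ (h₂ p ps qs)
        (alt-rowLinear (λ r rest → f r (p ∷ rest)) k z x y (λ rest → h₁ (p ∷ rest)) (λ r ps′ → h₂ r (p ∷ ps′)) ps qs))
      (solve 5 (λ k a b c d → a :+ k :* b :- (c :+ k :* d) := a :- c :+ k :* (b :- d)) refl
        k (f p (ps ++ x ∷ qs)) (f p (ps ++ y ∷ qs))
        (alt (λ r rest → f r (p ∷ rest)) (ps ++ x ∷ qs)) (alt (λ r rest → f r (p ∷ rest)) (ps ++ y ∷ qs)))

  alt-map : {A B : Set} (g : A → B) {f : B → List B → ℚ} (xs : List A) →
    alt f (map g xs) ≡ alt (λ x rest → f (g x) (map g rest)) xs
  alt-map g []       = refl
  alt-map g {f} (x ∷ xs) = cong (λ z → f (g x) (map g xs) - z) (alt-map g xs)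

  Row : Set
  Row = ℕ → ℚ

  -- Laplace expansion along the first column; the rows are functions of the column label.
  det : List ℕ → List Row → ℚ
  det []       []      = 1ℚ
  det []       (_ ∷ _) = 0ℚ
  det (c ∷ cs) rs      = alt (λ r rest → r c * det cs rest) rs

  det-columnSwap : ∀ c d cs rs → det (c ∷ d ∷ cs) rs ≡ - det (d ∷ c ∷ cs) rs
  det-columnSwap c d cs rs = begin
    alt (λ r rest → r c * alt (λ r′ rest′ → r′ d * det cs rest′) rest) rs
      ≡⟨ alt-ext rs (λ r rest → sym (alt-*ˡ (r c) rest)) ⟩
    alt (λ r rest → alt (λ r′ rest′ → r c * (r′ d * det cs rest′)) rest) rs
      ≡⟨ alt-alt-swap (λ r r′ l → r c * (r′ d * det cs l)) rs ⟩
    - alt (λ r rest → alt (λ r′ rest′ → r′ c * (r d * det cs rest′)) rest) rs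
      ≡⟨ cong -_ (alt-ext rs λ r rest → trans
           (alt-ext rest λ r′ rest′ → solve 3 (λ a b c → a :* (b :* c) := b :* (a :* c)) refl (r′ c) (r d) (det cs rest′))
           (alt-*ˡ (r d) rest)) ⟩
    - det (d ∷ c ∷ cs) rs ∎
    where open ≡-Reasoning

  x≡-x⇒x≡0 : ∀ x → x ≡ - x → x ≡ 0ℚ
  x≡-x⇒x≡0 x e = begin
    x               ≡⟨ solve 1 (λ x → x := con ℚ.½ :* (x :+ x)) refl x ⟩
    ℚ.½ * (x + x)   ≡⟨ cong (λ z → ℚ.½ * (x + z)) e ⟩
    ℚ.½ * (x - x)   ≡⟨ solve 1 (λ x → con ℚ.½ :* (x :- x) := con 0ℚ) refl x ⟩
    0ℚ ∎
    where open ≡-Reasoning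

  det-repeatedColumn : ∀ {c cs} → c ∈ cs → ∀ rs → det (c ∷ cs) rs ≡ 0ℚ
  det-repeatedColumn {c} {d ∷ cs} (here refl) rs = x≡-x⇒x≡0 _ (det-columnSwap c c cs rs)
  det-repeatedColumn {c} {d ∷ cs} (there c∈cs) rs = trans (det-columnSwap c d cs rs)
    (cong -_ (alt-zero rs λ ps r qs _ → trans (cong (r d *_) (det-repeatedColumn c∈cs (ps ++ qs))) (ℚP.*-zeroʳ (r d))))

  det-rowSwap : ∀ cs ps x y qs → det cs (ps ++ x ∷ y ∷ qs) ≡ - det cs (ps ++ y ∷ x ∷ qs)
  det-rowSwap [] [] x y qs = refl
  det-rowSwap [] (_ ∷ _) x y qs = refl
  det-rowSwap (c ∷ cs) ps x y qs = alt-rowSwap _ x y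
    (λ r ps′ qs′ → trans (cong (r c *_) (det-rowSwap cs ps′ x y qs′)) (sym (ℚP.neg-distribʳ-* (r c) _))) ps qs

  det-rowLinear : ∀ cs ps (k : ℚ) (z x y : Row) qs → (∀ {c} → c ∈ cs → z c ≡ x c + k * y c) →
    det cs (ps ++ z ∷ qs) ≡ det cs (ps ++ x ∷ qs) + k * det cs (ps ++ y ∷ qs)
  det-rowLinear [] []      k z x y qs h = solve 1 (λ k → con 0ℚ := con 0ℚ :+ k :* con 0ℚ) refl k
  det-rowLinear [] (_ ∷ _) k z x y qs h = solve 1 (λ k → con 0ℚ := con 0ℚ :+ k :* con 0ℚ) refl k
  det-rowLinear (c ∷ cs) ps k z x y qs h = alt-rowLinear _ k z x y
    (λ rest → trans (cong (_* det cs rest) (h (here refl)))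
      (solve 4 (λ a k b d → (a :+ k :* b) :* d := a :* d :+ k :* (b :* d)) refl (x c) k (y c) (det cs rest)))
    (λ r ps′ qs′ → trans (cong (r c *_) (det-rowLinear cs ps′ k z x y qs′ (λ i → h (there i))))
      (solve 4 (λ a k b d → a :* (b :+ k :* d) := a :* b :+ k :* (a :* d)) refl (r c) k
        (det cs (ps′ ++ x ∷ qs′)) (det cs (ps′ ++ y ∷ qs′)))) ps qs

  module _ {A : Set} where

    det-map : ∀ c cs (F : A → Row) as → det (c ∷ cs) (map F as) ≡ alt (λ a rest → F a c * det cs (map F rest)) as
    det-map c cs F as = alt-map F as

    det-map-cong : ∀ cs {F G : A → Row} as → (∀ {a c} → a ∈ as → c ∈ cs → F a c ≡ G a c) →
      det cs (map F as) ≡ det cs (map G as)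
    det-map-cong [] []      h = refl
    det-map-cong [] (_ ∷ _) h = refl
    det-map-cong (c ∷ cs) {F} {G} as h = begin
      det (c ∷ cs) (map F as)                            ≡⟨ det-map c cs F as ⟩
      alt (λ a rest → F a c * det cs (map F rest)) as
        ≡⟨ alt-cong as (λ { ps r qs refl → cong₂ _*_ (h (∈-insert ps) (here refl))
             (det-map-cong cs (ps ++ qs) λ i j → h (weaken ps i) (there j)) }) ⟩
      alt (λ a rest → G a c * det cs (map G rest)) as    ≡⟨ det-map c cs G as ⟨
      det (c ∷ cs) (map G as)                            ∎
      where
      open ≡-Reasoning
      weaken : ∀ {a r : A} ps {qs} → a ∈ ps ++ qs → a ∈ ps ++ r ∷ qs
      weaken ps i with ∈-++⁻ ps i
      ... | inj₁ j = ∈-++⁺ˡ j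
      ... | inj₂ j = ∈-++⁺ʳ ps (there j)

  det-equalAdjacentRows : ∀ cs ps x qs → det cs (ps ++ x ∷ x ∷ qs) ≡ 0ℚ
  det-equalAdjacentRows cs ps x qs = x≡-x⇒x≡0 _ (det-rowSwap cs ps x x qs)

  sgn : ℕ → ℚ
  sgn zero    = 1ℚ
  sgn (suc n) = - sgn n

  sgn² : ∀ n → sgn n * sgn n ≡ 1ℚ
  sgn² zero = refl
  sgn² (suc n) = trans (solve 1 (λ x → (:- x) :* (:- x) := x :* x) refl (sgn n)) (sgn² n)

  det-moveToFront : ∀ cs ps x qs → det cs (ps ++ x ∷ qs) ≡ sgn (length ps) * det cs (x ∷ ps ++ qs)
  det-moveToFront cs ps x qs = go [] ps
    where
    open ≡-Reasoning
    go : ∀ os ps → det cs (os ++ ps ++ x ∷ qs) ≡ sgn (length ps) * det cs (os ++ x ∷ ps ++ qs)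
    go os []       = sym (ℚP.*-identityˡ _)
    go os (p ∷ ps) = begin
      det cs (os ++ p ∷ ps ++ x ∷ qs)                           ≡⟨ cong (det cs) (++-assoc os [ p ] (ps ++ x ∷ qs)) ⟨
      det cs ((os ++ [ p ]) ++ ps ++ x ∷ qs)                    ≡⟨ go (os ++ [ p ]) ps ⟩
      sgn (length ps) * det cs ((os ++ [ p ]) ++ x ∷ ps ++ qs)  ≡⟨ cong (λ l → sgn (length ps) * det cs l) (++-assoc os [ p ] (x ∷ ps ++ qs)) ⟩
      sgn (length ps) * det cs (os ++ p ∷ x ∷ ps ++ qs)         ≡⟨ cong (sgn (length ps) *_) (det-rowSwap cs os p x (ps ++ qs)) ⟩
      sgn (length ps) * - det cs (os ++ x ∷ p ∷ ps ++ qs)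
        ≡⟨ solve 2 (λ s d → s :* (:- d) := (:- s) :* d) refl (sgn (length ps)) _ ⟩
      - sgn (length ps) * det cs (os ++ x ∷ p ∷ ps ++ qs)       ∎

  det-repeatedRow : ∀ cs x ps qs → det cs (x ∷ ps ++ x ∷ qs) ≡ 0ℚ
  det-repeatedRow cs x ps qs = begin
    det cs ((x ∷ ps) ++ x ∷ qs)                        ≡⟨ det-moveToFront cs (x ∷ ps) x qs ⟩
    sgn (suc (length ps)) * det cs (x ∷ x ∷ ps ++ qs)  ≡⟨ cong (sgn (suc (length ps)) *_) (det-equalAdjacentRows cs [] x (ps ++ qs)) ⟩
    sgn (suc (length ps)) * 0ℚ                         ≡⟨ ℚP.*-zeroʳ (sgn (suc (length ps))) ⟩
    0ℚ                                                 ∎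
    where open ≡-Reasoning

  -- Vanishing is insensitive to the sign of the permutation, so only this much is transported along
  -- `↭`.
  det-permuteRows : ∀ {rs rs′} → rs ↭ rs′ → ∀ cs → det cs rs′ ≡ 0ℚ → det cs rs ≡ 0ℚ
  det-permuteRows p cs e = go [] p e
    where
    open ≡-Reasoning
    go : ∀ os {rs rs′} → rs ↭ rs′ → det cs (os ++ rs′) ≡ 0ℚ → det cs (os ++ rs) ≡ 0ℚ
    go os Perm.refl e = e
    go os (prep {xs} {ys} x p) e = trans (cong (det cs) (sym (++-assoc os [ x ] xs)))
      (go (os ++ [ x ]) p (trans (cong (det cs) (++-assoc os [ x ] ys)) e))
    go os (swap {xs} {ys} x y p) e = begin
      det cs (os ++ x ∷ y ∷ xs)            ≡⟨ cong (det cs) (++-assoc os (x ∷ [ y ]) xs) ⟨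
      det cs ((os ++ x ∷ [ y ]) ++ xs)     ≡⟨ go (os ++ x ∷ [ y ]) p (begin
        det cs ((os ++ x ∷ [ y ]) ++ ys)   ≡⟨ cong (det cs) (++-assoc os (x ∷ [ y ]) ys) ⟩
        det cs (os ++ x ∷ y ∷ ys)          ≡⟨ det-rowSwap cs os x y ys ⟩
        - det cs (os ++ y ∷ x ∷ ys)        ≡⟨ cong -_ e ⟩
        0ℚ                                 ∎) ⟩
      0ℚ                                   ∎
    go os (Perm.trans p q) e = go os p (go os q e)

  det-zeroRow : ∀ cs z rs → (∀ {c} → c ∈ cs → z c ≡ 0ℚ) → det cs (z ∷ rs) ≡ 0ℚ
  det-zeroRow cs z rs h = trans
    (det-rowLinear cs [] (- 1ℚ) z z z rs λ {c} i → trans (h i) (solve 1 (λ x → con 0ℚ := x :+ con (- 1ℚ) :* x) refl (z c)))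
    (solve 1 (λ x → x :+ con (- 1ℚ) :* x := con 0ℚ) refl (det cs (z ∷ rs)))

  unit : ℕ → Row
  unit c d with c ℕ.≟ d
  ... | yes _ = 1ℚ
  ... | no _  = 0ℚ

  unit-≡ : ∀ c → unit c c ≡ 1ℚ
  unit-≡ c with c ℕ.≟ c
  ... | yes _  = refl
  ... | no c≢c = contradiction refl c≢c

  unit-≢ : ∀ c d → c ≢ d → unit c d ≡ 0ℚ
  unit-≢ c d c≢d with c ℕ.≟ d
  ... | yes c≡d = contradiction c≡d c≢d
  ... | no _    = refl

  -- `det` expands along columns, so expansion along a unit row takes an induction over the columns
  -- before `c`: in each of them the unit row contributes 0, and its place in front of the other
  -- rows costs one sign.
  det-unitRow : ∀ xs c ys rs → c ∉ xs → c ∉ ys →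
    det (xs ++ c ∷ ys) (unit c ∷ rs) ≡ sgn (length xs) * det (xs ++ ys) rs
  det-unitRow [] c ys rs _ c∉ys = begin
    unit c c * det ys rs - alt (λ r rest → r c * det ys (unit c ∷ rest)) rs
      ≡⟨ cong₂ (λ u v → u * det ys rs - v) (unit-≡ c) (alt-zero rs λ ps r qs _ →
           trans (cong (r c *_) (det-zeroRow ys (unit c) (ps ++ qs) λ {d} i → unit-≢ c d λ { refl → c∉ys i })) (ℚP.*-zeroʳ (r c))) ⟩
    1ℚ * det ys rs - 0ℚ   ≡⟨ ℚP.+-identityʳ _ ⟩
    1ℚ * det ys rs        ∎
    where open ≡-Reasoning
  det-unitRow (x ∷ xs) c ys rs c∉xs c∉ys = begin
    unit c x * det (xs ++ c ∷ ys) rs - alt (λ r rest → r x * det (xs ++ c ∷ ys) (unit c ∷ rest)) rs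
      ≡⟨ cong₂ (λ u v → u * det (xs ++ c ∷ ys) rs - v) (unit-≢ c x λ { refl → c∉xs (here refl) }) (trans
           (alt-ext rs λ r rest → trans (cong (r x *_) (det-unitRow xs c ys rest (c∉xs ∘ there) c∉ys))
             (solve 3 (λ a s d → a :* (s :* d) := s :* (a :* d)) refl (r x) (sgn (length xs)) (det (xs ++ ys) rest)))
           (alt-*ˡ (sgn (length xs)) rs)) ⟩
    0ℚ * det (xs ++ c ∷ ys) rs - sgn (length xs) * det (x ∷ xs ++ ys) rs
      ≡⟨ solve 3 (λ a s d → con 0ℚ :* a :- s :* d := (:- s) :* d) refl (det (xs ++ c ∷ ys) rs) (sgn (length xs)) (det (x ∷ xs ++ ys) rs) ⟩
    - sgn (length xs) * det (x ∷ xs ++ ys) rs ∎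
    where open ≡-Reasoning

  -- Linearity in the first row moves the alternating sum inside, where it becomes a single row. For
  -- `w = det cs` the entry of that row in column `c` is the expansion of `det (c ∷ cs) rs`.
  det-firstRowCombination : ∀ cs Y rs (w : List Row → ℚ) →
    alt (λ r rest → det cs (r ∷ Y) * w rest) rs ≡ det cs ((λ c → alt (λ r rest → r c * w rest) rs) ∷ Y)
  det-firstRowCombination cs Y [] w = sym (det-zeroRow cs _ Y λ _ → refl)
  det-firstRowCombination cs Y (r ∷ rs) w = sym (begin
    det cs (combo ∷ Y)
      ≡⟨ det-rowLinear cs [] (- 1ℚ) combo (λ c → r c * w rs) combo′ Y (λ {c} _ →
           solve 2 (λ a b → a :- b := a :+ con (- 1ℚ) :* b) refl (r c * w rs) (combo′ c)) ⟩
    det cs ((λ c → r c * w rs) ∷ Y) + (- 1ℚ) * det cs (combo′ ∷ Y)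
      ≡⟨ cong₂ (λ u v → u + (- 1ℚ) * v)
           (trans (det-rowLinear cs [] (w rs) (λ c → r c * w rs) (λ _ → 0ℚ) r Y
                    (λ {c} _ → solve 2 (λ a b → a :* b := con 0ℚ :+ b :* a) refl (r c) (w rs)))
                  (cong (_+ w rs * det cs (r ∷ Y)) (det-zeroRow cs _ Y λ _ → refl)))
           (sym (det-firstRowCombination cs Y rs (λ rest → w (r ∷ rest)))) ⟩
    0ℚ + w rs * det cs (r ∷ Y) + (- 1ℚ) * rest
      ≡⟨ solve 3 (λ a b c → con 0ℚ :+ a :* b :+ con (- 1ℚ) :* c := b :* a :- c) refl (w rs) (det cs (r ∷ Y)) rest ⟩
    det cs (r ∷ Y) * w rs - rest ∎)
    where
    open ≡-Reasoning
    combo combo′ : Row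
    combo c  = alt (λ r rest → r c * w rest) (r ∷ rs)
    combo′ c = alt (λ r′ rest → r′ c * w (r ∷ rest)) rs
    rest = alt (λ r′ rest → det cs (r′ ∷ Y) * w (r ∷ rest)) rs

  -- On the columns cs, the combination Σ ± det(rest) r of the rows r is a determinant with a repeated
  -- column, hence zero; substitute it for the first row of det cs (r ∷ Y).
  plücker : ∀ cs Y rs → alt (λ r rest → det cs (r ∷ Y) * det cs rest) rs ≡ 0ℚ
  plücker cs Y rs = trans (det-firstRowCombination cs Y rs (det cs))
    (det-zeroRow cs _ Y λ c∈cs → det-repeatedColumn c∈cs rs)

  -- This is `plücker` with `Y = v ∷ X` and the rows `u ∷ w ∷ z ∷ X`: a term that pulls a row out of
  -- the second copy of `X` meets it again in the first, so only the terms for `u`, `w` and `z`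
  -- survive.
  three-term-plücker : ∀ cs X u v w z →
    det cs (u ∷ v ∷ X) * det cs (w ∷ z ∷ X) ≡
    det cs (u ∷ w ∷ X) * det cs (v ∷ z ∷ X) - det cs (u ∷ z ∷ X) * det cs (v ∷ w ∷ X)
  three-term-plücker cs X u v w z = begin
    D u v * D w z
      ≡⟨ solve 6 (λ a b c d e f → a :* b := a :* b :- (c :* d :- e :* f) :+ (c :* d :- e :* f)) refl
           (D u v) (D w z) (D w v) (D u z) (D z v) (D u w) ⟩
    D u v * D w z - (D w v * D u z - D z v * D u w) + (D w v * D u z - D z v * D u w)
      ≡⟨ cong (_+ (D w v * D u z - D z v * D u w)) zero-sum ⟩
    0ℚ + (D w v * D u z - D z v * D u w)
      ≡⟨ cong₂ (λ x y → 0ℚ + (x * D u z - y * D u w)) (det-rowSwap cs [] w v X) (det-rowSwap cs [] z v X) ⟩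
    0ℚ + (- D v w * D u z - - D v z * D u w)
      ≡⟨ solve 4 (λ a b c d → con 0ℚ :+ ((:- a) :* b :- (:- c) :* d) := d :* c :- b :* a) refl (D v w) (D u z) (D v z) (D u w) ⟩
    D u w * D v z - D u z * D v w ∎
    where
    open ≡-Reasoning
    D : Row → Row → ℚ
    D x y = det cs (x ∷ y ∷ X)
    T = alt (λ r rest → det cs (r ∷ v ∷ X) * det cs (u ∷ w ∷ z ∷ rest)) X
    T≡0 : T ≡ 0ℚ
    T≡0 = alt-zero X λ { ps r qs refl → trans (cong (_* det cs (u ∷ w ∷ z ∷ ps ++ qs)) (det-repeatedRow cs r (v ∷ ps) qs))
            (ℚP.*-zeroˡ (det cs (u ∷ w ∷ z ∷ ps ++ qs))) }
    zero-sum : D u v * D w z - (D w v * D u z - D z v * D u w) ≡ 0ℚ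
    zero-sum = begin
      D u v * D w z - (D w v * D u z - D z v * D u w)
        ≡⟨ solve 3 (λ a b c → a :- (b :- c) := a :- (b :- (c :- con 0ℚ))) refl (D u v * D w z) (D w v * D u z) (D z v * D u w) ⟩
      D u v * D w z - (D w v * D u z - (D z v * D u w - 0ℚ))
        ≡⟨ cong (λ t → D u v * D w z - (D w v * D u z - (D z v * D u w - t))) T≡0 ⟨
      D u v * D w z - (D w v * D u z - (D z v * D u w - T))
        ≡⟨ plücker cs (v ∷ X) (u ∷ w ∷ z ∷ X) ⟩
      0ℚ ∎

  -- The three-term relation for `u`, `v` and the unit rows at `c` and `d`: a unit row deletes its
  -- column, so determinants on all columns become minors. Moving `v` past `X` and the unit row at
  -- `d` past `cs` gives the same sign because the lengths agree.
  dodgson : ∀ c cs d u X v → c ∉ cs → c ≢ d → d ∉ cs → length cs ≡ length X →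
    det (c ∷ cs ++ [ d ]) (u ∷ X ++ [ v ]) * det cs X ≡
    det (c ∷ cs) (u ∷ X) * det (cs ++ [ d ]) (X ++ [ v ]) - det (cs ++ [ d ]) (u ∷ X) * det (c ∷ cs) (X ++ [ v ])
  dodgson c cs d u X v c∉cs c≢d d∉cs len = begin
    D * D″                       ≡⟨ solve 2 (λ x y → x :* y := con 1ℚ :* x :* y) refl D D″ ⟩
    1ℚ * D * D″                  ≡⟨ cong (λ e → e * D * D″) (sgn² (length X)) ⟨
    s * s * D * D″               ≡⟨ solve 3 (λ s x y → s :* s :* x :* y := s :* x :* (s :* y)) refl s D D″ ⟩
    s * D * (s * D″)             ≡⟨ cong₂ _*_ D-uv D-cd ⟨
    det C (u ∷ v ∷ X) * det C (unit c ∷ unit d ∷ X) ≡⟨ three-term-plücker C X u v (unit c) (unit d) ⟩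
    det C (u ∷ unit c ∷ X) * det C (v ∷ unit d ∷ X) - det C (u ∷ unit d ∷ X) * det C (v ∷ unit c ∷ X)
      ≡⟨ cong₂ _-_ (cong₂ _*_ (first u) (last v)) (cong₂ _*_ (last u) (first v)) ⟩
    - det C₂ (u ∷ X) * (s * det C₁ (v ∷ X)) - s * det C₁ (u ∷ X) * - det C₂ (v ∷ X)
      ≡⟨ solve 5 (λ s p q x y → (:- p) :* (s :* q) :- s :* x :* (:- y) := x :* (s :* y) :- p :* (s :* q)) refl
           s (det C₂ (u ∷ X)) (det C₁ (v ∷ X)) (det C₁ (u ∷ X)) (det C₂ (v ∷ X)) ⟩
    det C₁ (u ∷ X) * (s * det C₂ (v ∷ X)) - det C₂ (u ∷ X) * (s * det C₁ (v ∷ X))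
      ≡⟨ cong₂ (λ x y → det C₁ (u ∷ X) * x - det C₂ (u ∷ X) * y) (toEnd C₂) (toEnd C₁) ⟨
    det C₁ (u ∷ X) * det C₂ (X ++ [ v ]) - det C₂ (u ∷ X) * det C₁ (X ++ [ v ]) ∎
    where
    open ≡-Reasoning
    C  = c ∷ cs ++ [ d ]
    C₁ = c ∷ cs
    C₂ = cs ++ [ d ]
    s  = sgn (length X)
    D  = det C (u ∷ X ++ [ v ])
    D″ = det cs X
    c∉C₂ : c ∉ C₂
    c∉C₂ i with ∈-++⁻ cs i
    ... | inj₁ j           = c∉cs j
    ... | inj₂ (here c≡d)  = c≢d c≡d
    d∉C₁ : d ∉ C₁
    d∉C₁ (here refl) = c≢d refl
    d∉C₁ (there i)   = d∉cs i
    toEnd : ∀ E → det E (X ++ [ v ]) ≡ s * det E (v ∷ X)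
    toEnd E = trans (det-moveToFront E X v []) (cong (λ l → s * det E (v ∷ l)) (++-identityʳ X))
    first : ∀ r → det C (r ∷ unit c ∷ X) ≡ - det C₂ (r ∷ X)
    first r = trans (det-rowSwap C [] r (unit c) X)
      (cong -_ (trans (det-unitRow [] c C₂ (r ∷ X) (λ ()) c∉C₂) (ℚP.*-identityˡ _)))
    last : ∀ r → det C (r ∷ unit d ∷ X) ≡ s * det C₁ (r ∷ X)
    last r = trans (det-rowSwap C [] r (unit d) X)
      (trans (cong -_ (trans (det-unitRow C₁ d [] (r ∷ X) d∉C₁ λ ())
        (cong₂ (λ n l → - sgn n * det l (r ∷ X)) len (++-identityʳ C₁))))
      (solve 2 (λ s x → :- ((:- s) :* x) := s :* x) refl s (det C₁ (r ∷ X))))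
    D-cd : det C (unit c ∷ unit d ∷ X) ≡ s * D″
    D-cd = trans (det-unitRow [] c C₂ (unit d ∷ X) (λ ()) c∉C₂) (trans (ℚP.*-identityˡ _)
      (trans (det-unitRow cs d [] X d∉cs λ ()) (cong₂ (λ n l → sgn n * det l X) len (++-identityʳ cs))))
    D-uv : det C (u ∷ v ∷ X) ≡ s * D
    D-uv = begin
      det C (u ∷ v ∷ X)                              ≡⟨ solve 1 (λ x → x := con 1ℚ :* x) refl _ ⟩
      1ℚ * det C (u ∷ v ∷ X)                         ≡⟨ cong (_* det C (u ∷ v ∷ X)) (sgn² (length X)) ⟨
      s * s * det C (u ∷ v ∷ X)                      ≡⟨ solve 2 (λ s x → s :* s :* x := s :* (:- s :* (:- x))) refl s _ ⟩
      s * (- s * - det C (u ∷ v ∷ X))                ≡⟨ cong (λ x → s * (- s * x)) (det-rowSwap C [] v u X) ⟨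
      s * (- s * det C (v ∷ u ∷ X))                  ≡⟨ cong (λ l → s * (- s * det C (v ∷ u ∷ l))) (++-identityʳ X) ⟨
      s * (- s * det C (v ∷ u ∷ X ++ []))            ≡⟨ cong (s *_) (det-moveToFront C (u ∷ X) v []) ⟨
      s * D                                          ∎

-- Restricted Cauchy matrices and the sign of their determinants.

module RestrictedCauchy where

  open Determinants
  open import Data.Rational using (_+_; _*_; -_; _-_; _<_; _≤_)
  open import Data.Rational.Solver using (module +-*-Solver)
  open +-*-Solver using (solve; _:=_; _:+_; _:*_; :-_; _:-_; con)

  toℚᵘ-toℚ : ∀ n → toℚᵘ (toℚ n) ℚᵘ.≃ ℚᵘ.mkℚᵘ (ℤ.+ n) 0
  toℚᵘ-toℚ n = ℚP.toℚᵘ-fromℚᵘ (ℚᵘ.mkℚᵘ (ℤ.+ n) 0)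

  toℚ-+ : ∀ m n → toℚ (m ℕ.+ n) ≡ toℚ m + toℚ n
  toℚ-+ m n = ℚP.toℚᵘ-injective (begin
    toℚᵘ (toℚ (m ℕ.+ n))                       ≈⟨ toℚᵘ-toℚ (m ℕ.+ n) ⟩
    ℚᵘ.mkℚᵘ (ℤ.+ (m ℕ.+ n)) 0                    ≈⟨ ℚᵘ.*≡* (cong (ℤ._* ℤ.+ 1) (cong₂ ℤ._+_ (sym (ℤP.*-identityʳ (ℤ.+ m))) (sym (ℤP.*-identityʳ (ℤ.+ n))))) ⟩
    ℚᵘ.mkℚᵘ (ℤ.+ m) 0 ℚᵘ.+ ℚᵘ.mkℚᵘ (ℤ.+ n) 0       ≈⟨ ℚᵘP.+-cong (toℚᵘ-toℚ m) (toℚᵘ-toℚ n) ⟨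
    toℚᵘ (toℚ m) ℚᵘ.+ toℚᵘ (toℚ n)             ≈⟨ ℚP.toℚᵘ-homo-+ (toℚ m) (toℚ n) ⟨
    toℚᵘ (toℚ m + toℚ n)                       ∎)
    where open ℚᵘP.≃-Reasoning

  toℚ-* : ∀ m n → toℚ (m ℕ.* n) ≡ toℚ m * toℚ n
  toℚ-* m n = ℚP.toℚᵘ-injective (begin
    toℚᵘ (toℚ (m ℕ.* n))                       ≈⟨ toℚᵘ-toℚ (m ℕ.* n) ⟩
    ℚᵘ.mkℚᵘ (ℤ.+ (m ℕ.* n)) 0                    ≈⟨ ℚᵘ.*≡* (cong (ℤ._* ℤ.+ 1) (ℤP.pos-* m n)) ⟩
    ℚᵘ.mkℚᵘ (ℤ.+ m) 0 ℚᵘ.* ℚᵘ.mkℚᵘ (ℤ.+ n) 0       ≈⟨ ℚᵘP.*-cong (toℚᵘ-toℚ m) (toℚᵘ-toℚ n) ⟨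
    toℚᵘ (toℚ m) ℚᵘ.* toℚᵘ (toℚ n)             ≈⟨ ℚP.toℚᵘ-homo-* (toℚ m) (toℚ n) ⟨
    toℚᵘ (toℚ m * toℚ n)                       ∎)
    where open ℚᵘP.≃-Reasoning

  toℚ-∸ : ∀ {m n} → n ℕ.≤ m → toℚ (m ∸ n) ≡ toℚ m - toℚ n
  toℚ-∸ {m} {n} n≤m = begin
    toℚ (m ∸ n)                    ≡⟨ solve 2 (λ x y → x := x :+ y :- y) refl (toℚ (m ∸ n)) (toℚ n) ⟩
    toℚ (m ∸ n) + toℚ n - toℚ n    ≡⟨ cong (_- toℚ n) (toℚ-+ (m ∸ n) n) ⟨
    toℚ (m ∸ n ℕ.+ n) - toℚ n      ≡⟨ cong (λ k → toℚ k - toℚ n) (ℕP.m∸n+n≡m n≤m) ⟩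
    toℚ m - toℚ n                  ∎
    where open ≡-Reasoning

  toℚ-pos : ∀ {n} → 0 ℕ.< n → 0ℚ < toℚ n
  toℚ-pos {suc n} _ = ℚP.positive⁻¹ (toℚ (suc n)) {{ℚP.normalize-pos (suc n) 1}}

  recip : ℕ → ℚ
  recip zero    = 0ℚ
  recip (suc n) = ℤ.+ 1 ℚ./ suc n

  recip-pos : ∀ {n} → 0 ℕ.< n → 0ℚ < recip n
  recip-pos {suc n} _ = ℚP.positive⁻¹ (recip (suc n)) {{ℚP.normalize-pos 1 (suc n)}}

  toℚ-recip : ∀ {n} → 0 ℕ.< n → toℚ n * recip n ≡ 1ℚ
  toℚ-recip {suc n} _ = ℚP.toℚᵘ-injective (begin
    toℚᵘ (toℚ (suc n) * recip (suc n))              ≈⟨ ℚP.toℚᵘ-homo-* (toℚ (suc n)) (recip (suc n)) ⟩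
    toℚᵘ (toℚ (suc n)) ℚᵘ.* toℚᵘ (recip (suc n))    ≈⟨ ℚᵘP.*-cong (toℚᵘ-toℚ (suc n)) (ℚP.toℚᵘ-fromℚᵘ (ℚᵘ.mkℚᵘ (ℤ.+ 1) n)) ⟩
    ℚᵘ.mkℚᵘ (ℤ.+ suc n) 0 ℚᵘ.* ℚᵘ.mkℚᵘ (ℤ.+ 1) n        ≈⟨ ℚᵘ.*≡* (trans (ℤP.*-identityʳ _) (trans (ℤP.*-identityʳ (ℤ.+ suc n)) (sym (trans (ℤP.*-identityˡ _) (cong ℤ.+_ (ℕP.+-identityʳ (suc n))))))) ⟩
    toℚᵘ 1ℚ                                          ∎)
    where open ℚᵘP.≃-Reasoning

  *-pos : ∀ {x y} → 0ℚ < x → 0ℚ < y → 0ℚ < x * y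
  *-pos {x} {y} p q = ℚP.positive⁻¹ (x * y) {{ℚP.pos*pos⇒pos x {{ℚ.positive p}} y {{ℚ.positive q}}}}

  *-nonNeg : ∀ {x y} → 0ℚ ≤ x → 0ℚ ≤ y → 0ℚ ≤ x * y
  *-nonNeg {x} {y} p q = ℚP.nonNegative⁻¹ (x * y) {{ℚP.nonNeg*nonNeg⇒nonNeg x {{ℚ.nonNegative p}} y {{ℚ.nonNegative q}}}}

  *-pos-cancel : ∀ {x y} → 0ℚ < y → 0ℚ < x * y → 0ℚ < x
  *-pos-cancel {x} {y} p q = ℚP.*-cancelʳ-<-nonNeg y {{ℚP.pos⇒nonNeg y {{ℚ.positive p}}}} (subst (_< x * y) (sym (ℚP.*-zeroˡ y)) q)

  prod : {A : Set} → (A → ℚ) → List A → ℚ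
  prod f []       = 1ℚ
  prod f (x ∷ xs) = f x * prod f xs

  module _ {A : Set} where

    prod-++ : (f : A → ℚ) → ∀ xs ys → prod f (xs ++ ys) ≡ prod f xs * prod f ys
    prod-++ f [] ys = sym (ℚP.*-identityˡ _)
    prod-++ f (x ∷ xs) ys = trans (cong (f x *_) (prod-++ f xs ys)) (sym (ℚP.*-assoc (f x) (prod f xs) (prod f ys)))

    prod-insert : (f : A → ℚ) → ∀ xs y ys → prod f (xs ++ y ∷ ys) ≡ f y * prod f (xs ++ ys)
    prod-insert f [] y ys = refl
    prod-insert f (x ∷ xs) y ys = trans (cong (f x *_) (prod-insert f xs y ys))
      (solve 3 (λ a b c → a :* (b :* c) := b :* (a :* c)) refl (f x) (f y) (prod f (xs ++ ys)))

    prod-* : (f g : A → ℚ) → ∀ xs → prod (λ x → f x * g x) xs ≡ prod f xs * prod g xs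
    prod-* f g [] = refl
    prod-* f g (x ∷ xs) = trans (cong (f x * g x *_) (prod-* f g xs))
      (solve 4 (λ a b c d → a :* b :* (c :* d) := a :* c :* (b :* d)) refl (f x) (g x) (prod f xs) (prod g xs))

    prod-cong : {f g : A → ℚ} → ∀ xs → (∀ {x} → x ∈ xs → f x ≡ g x) → prod f xs ≡ prod g xs
    prod-cong [] h = refl
    prod-cong (x ∷ xs) h = cong₂ _*_ (h (here refl)) (prod-cong xs (h ∘ there))

    prod-1 : {f : A → ℚ} → ∀ xs → (∀ {x} → x ∈ xs → f x ≡ 1ℚ) → prod f xs ≡ 1ℚ
    prod-1 [] h = refl
    prod-1 (x ∷ xs) h = cong₂ _*_ (h (here refl)) (prod-1 xs (h ∘ there))

    prod-pos : {f : A → ℚ} → ∀ xs → (∀ {x} → x ∈ xs → 0ℚ < f x) → 0ℚ < prod f xs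
    prod-pos [] h = ℚP.positive⁻¹ 1ℚ
    prod-pos (x ∷ xs) h = *-pos (h (here refl)) (prod-pos xs (h ∘ there))

    det-scale : (f : A → ℚ) (g : ℕ → ℚ) (F : A → Row) → ∀ cs as →
      det cs (map (λ a c → f a * g c * F a c) as) ≡ prod f as * prod g cs * det cs (map F as)
    det-scale f g F [] []      = refl
    det-scale f g F [] (a ∷ as) = sym (ℚP.*-zeroʳ (prod f (a ∷ as) * 1ℚ))
    det-scale f g F (c ∷ cs) as = begin
      det (c ∷ cs) (map F′ as)                               ≡⟨ det-map c cs F′ as ⟩
      alt (λ a rest → F′ a c * det cs (map F′ rest)) as      ≡⟨ alt-cong as step ⟩
      alt (λ a rest → k * (F a c * det cs (map F rest))) as  ≡⟨ alt-*ˡ k as ⟩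
      k * alt (λ a rest → F a c * det cs (map F rest)) as    ≡⟨ cong (k *_) (det-map c cs F as) ⟨
      k * det (c ∷ cs) (map F as)                            ∎
      where
      open ≡-Reasoning
      F′ : A → Row
      F′ a c = f a * g c * F a c
      k = prod f as * prod g (c ∷ cs)
      step : ∀ ps a qs → as ≡ ps ++ a ∷ qs →
        F′ a c * det cs (map F′ (ps ++ qs)) ≡ k * (F a c * det cs (map F (ps ++ qs)))
      step ps a qs refl = begin
        F′ a c * det cs (map F′ (ps ++ qs))
          ≡⟨ cong (F′ a c *_) (det-scale f g F cs (ps ++ qs)) ⟩
        f a * g c * F a c * (prod f (ps ++ qs) * prod g cs * det cs (map F (ps ++ qs)))
          ≡⟨ solve 6 (λ a b c d e f → a :* b :* c :* (d :* e :* f) := a :* d :* (b :* e) :* (c :* f)) refl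
               (f a) (g c) (F a c) (prod f (ps ++ qs)) (prod g cs) (det cs (map F (ps ++ qs))) ⟩
        f a * prod f (ps ++ qs) * prod g (c ∷ cs) * (F a c * det cs (map F (ps ++ qs)))
          ≡⟨ cong (λ p → p * prod g (c ∷ cs) * (F a c * det cs (map F (ps ++ qs)))) (prod-insert f ps a qs) ⟨
        k * (F a c * det cs (map F (ps ++ qs))) ∎

    det-eliminate : ∀ cs r (k : A → ℚ) (F V : A → Row) as →
      (∀ {a c} → a ∈ as → c ∈ cs → F a c ≡ V a c + k a * r c) →
      det cs (r ∷ map F as) ≡ det cs (r ∷ map V as)
    det-eliminate cs r k F V as = go [] as
      where
      open ≡-Reasoning
      go : ∀ ps as → (∀ {a c} → a ∈ as → c ∈ cs → F a c ≡ V a c + k a * r c) →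
        det cs (r ∷ ps ++ map F as) ≡ det cs (r ∷ ps ++ map V as)
      go ps [] h = refl
      go ps (a ∷ as) h = begin
        det cs (r ∷ ps ++ F a ∷ map F as)
          ≡⟨ det-rowLinear cs (r ∷ ps) (k a) (F a) (V a) r (map F as) (h (here refl)) ⟩
        det cs (r ∷ ps ++ V a ∷ map F as) + k a * det cs (r ∷ ps ++ r ∷ map F as)
          ≡⟨ cong₂ (λ x y → x + k a * y) (cong (λ l → det cs (r ∷ l)) (sym (++-assoc ps [ V a ] (map F as)))) (det-repeatedRow cs r ps (map F as)) ⟩
        det cs (r ∷ (ps ++ [ V a ]) ++ map F as) + k a * 0ℚ
          ≡⟨ solve 2 (λ x k → x :+ k :* con 0ℚ := x) refl _ (k a) ⟩
        det cs (r ∷ (ps ++ [ V a ]) ++ map F as)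
          ≡⟨ go (ps ++ [ V a ]) as (h ∘ there) ⟩
        det cs (r ∷ (ps ++ [ V a ]) ++ map V as)
          ≡⟨ cong (λ l → det cs (r ∷ l)) (++-assoc ps [ V a ] (map V as)) ⟩
        det cs (r ∷ ps ++ V a ∷ map V as) ∎

  -- 1 / (a - b) if b < a, and 0 otherwise, by truncated subtraction and recip 0 = 0.
  cauchy : ℕ → Row
  cauchy a b = recip (a ∸ b)

  cauchy-zero : ∀ {a b} → a ℕ.≤ b → cauchy a b ≡ 0ℚ
  cauchy-zero a≤b = cong recip (ℕP.m≤n⇒m∸n≡0 a≤b)

  cauchy-pos : ∀ {a b} → b ℕ.< a → 0ℚ < cauchy a b
  cauchy-pos b<a = recip-pos (ℕP.m<n⇒0<n∸m b<a)

  cauchy-inv : ∀ {a b} → b ℕ.< a → (toℚ a - toℚ b) * cauchy a b ≡ 1ℚ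
  cauchy-inv {a} {b} b<a = trans (cong (_* cauchy a b) (sym (toℚ-∸ (ℕP.<⇒≤ b<a)))) (toℚ-recip (ℕP.m<n⇒0<n∸m b<a))

  difference-pos : ∀ {a b} → b ℕ.< a → 0ℚ < toℚ a - toℚ b
  difference-pos b<a = subst (0ℚ <_) (toℚ-∸ (ℕP.<⇒≤ b<a)) (toℚ-pos (ℕP.m<n⇒0<n∸m b<a))

  Increasing Decreasing : List ℕ → Set
  Increasing = AllPairs ℕ._<_
  Decreasing = AllPairs ℕ._>_

  -- Schur complement of the top left entry: the remaining block is again a Cauchy matrix, up to
  -- positive row and column factors.
  det-cauchy-pos : ∀ as bs → length as ≡ length bs → Increasing as → Decreasing bs →
    (∀ {a b} → a ∈ as → b ∈ bs → b ℕ.< a) → 0ℚ < det bs (map cauchy as)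
  det-cauchy-pos [] [] _ _ _ _ = ℚP.positive⁻¹ 1ℚ
  det-cauchy-pos (a ∷ as) (b ∷ bs) len (a< ∷ inc) (b> ∷ dec) b<a =
    subst (0ℚ <_) (sym expansion)
      (*-pos (cauchy-pos ab) (*-pos (*-pos
        (prod-pos as λ i → *-pos (difference-pos (All.lookup a< i)) (cauchy-pos (b<a (there i) (here refl))))
        (prod-pos bs λ j → *-pos (difference-pos (All.lookup b> j)) (cauchy-pos (b<a (here refl) (there j)))))
        (det-cauchy-pos as bs (ℕP.suc-injective len) inc dec λ i j → b<a (there i) (there j))))
    where
    open ≡-Reasoning
    q = toℚ
    ab = b<a (here refl) (here refl)
    f g k : ℕ → ℚ
    f x = (q x - q a) * cauchy x b
    g c = (q b - q c) * cauchy a c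
    k x = cauchy x b * (q a - q b)
    V : ℕ → Row
    V x c = f x * g c * cauchy x c
    eliminate : ∀ {x c} → x ∈ as → c ∈ b ∷ bs → cauchy x c ≡ V x c + k x * cauchy a c
    eliminate {x} {c} i j = begin
      X
        ≡⟨ solve 1 (λ x → x := con 1ℚ :* con 1ℚ :* x) refl X ⟩
      1ℚ * 1ℚ * X
        ≡⟨ cong₂ (λ u v → u * v * X) (cauchy-inv (b<a (there i) (here refl))) (cauchy-inv (b<a (here refl) j)) ⟨
      (q x - q b) * cauchy x b * ((q a - q c) * cauchy a c) * X
        -- This is (x - b)(a - c) = (x - a)(b - c) + (a - b)(x - c), divided by (x - b)(a - c)(x -
        -- c).
        ≡⟨ solve 7 (λ x a b c xb ac xc → (x :- b) :* xb :* ((a :- c) :* ac) :* xc :=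
             (x :- a) :* xb :* ((b :- c) :* ac) :* xc :+ xb :* (a :- b) :* ac :* ((x :- c) :* xc)) refl
             (q x) (q a) (q b) (q c) (cauchy x b) (cauchy a c) X ⟩
      V x c + k x * cauchy a c * ((q x - q c) * X)
        ≡⟨ cong (λ u → V x c + k x * cauchy a c * u) (cauchy-inv (b<a (there i) j)) ⟩
      V x c + k x * cauchy a c * 1ℚ
        ≡⟨ cong (V x c +_) (ℚP.*-identityʳ _) ⟩
      V x c + k x * cauchy a c ∎
      where X = cauchy x c
    V-b : ∀ x → V x b ≡ 0ℚ
    V-b x = solve 4 (λ f b y z → f :* ((b :- b) :* y) :* z := con 0ℚ) refl (f x) (q b) (cauchy a b) (cauchy x b)
    expansion : det (b ∷ bs) (map cauchy (a ∷ as)) ≡ cauchy a b * (prod f as * prod g bs * det bs (map cauchy as))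
    expansion = begin
      det (b ∷ bs) (cauchy a ∷ map cauchy as)     ≡⟨ det-eliminate (b ∷ bs) (cauchy a) k cauchy V as eliminate ⟩
      det (b ∷ bs) (cauchy a ∷ map V as)          ≡⟨⟩
      cauchy a b * det bs (map V as) - alt (λ r rest → r b * det bs (cauchy a ∷ rest)) (map V as)
        ≡⟨ cong₂ (λ x y → cauchy a b * x - y) (det-scale f g cauchy bs as)
             (trans (alt-map V as) (alt-zero as λ ps x qs _ → trans (cong (_* det bs (cauchy a ∷ map V (ps ++ qs))) (V-b x))
               (ℚP.*-zeroˡ (det bs (cauchy a ∷ map V (ps ++ qs)))))) ⟩
      cauchy a b * (prod f as * prod g bs * det bs (map cauchy as)) - 0ℚ
        ≡⟨ ℚP.+-identityʳ _ ⟩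
      cauchy a b * (prod f as * prod g bs * det bs (map cauchy as)) ∎

  -- Zero blocks and the ballot condition.

  bit : Bool → ℕ
  bit true  = 1
  bit false = 0

  count : {A : Set} → (A → Bool) → List A → ℕ
  count p []       = 0
  count p (x ∷ xs) = bit (p x) ℕ.+ count p xs

  ≤ᵇ-true : ∀ {m n} → m ℕ.≤ n → (m ≤ᵇ n) ≡ true
  ≤ᵇ-true p = Equivalence.to T-≡ (ℕP.≤⇒≤ᵇ p)

  ≤ᵇ-false : ∀ {m n} → n ℕ.< m → (m ≤ᵇ n) ≡ false
  ≤ᵇ-false {m} {n} n<m with m ≤ᵇ n in eq
  ... | false = refl
  ... | true  = contradiction (ℕP.≤ᵇ⇒≤ m n (Equivalence.from T-≡ eq)) (ℕP.<⇒≱ n<m)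

  ≤ᵇ-true⁻¹ : ∀ {m n} → (m ≤ᵇ n) ≡ true → m ℕ.≤ n
  ≤ᵇ-true⁻¹ {m} {n} eq = ℕP.≤ᵇ⇒≤ m n (Equivalence.from T-≡ eq)

  ≤ᵇ-false⁻¹ : ∀ {m n} → (m ≤ᵇ n) ≡ false → n ℕ.< m
  ≤ᵇ-false⁻¹ {m} {n} eq = ℕP.≰⇒> λ m≤n → contradiction (trans (sym eq) (≤ᵇ-true m≤n)) λ ()

  module _ {A : Set} (p : A → Bool) where

    count-insert : ∀ xs y ys → count p (xs ++ y ∷ ys) ≡ bit (p y) ℕ.+ count p (xs ++ ys)
    count-insert [] y ys = refl
    count-insert (x ∷ xs) y ys = begin
      bit (p x) ℕ.+ count p (xs ++ y ∷ ys)               ≡⟨ cong (bit (p x) ℕ.+_) (count-insert xs y ys) ⟩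
      bit (p x) ℕ.+ (bit (p y) ℕ.+ count p (xs ++ ys))   ≡⟨ ℕP.+-assoc (bit (p x)) _ _ ⟨
      bit (p x) ℕ.+ bit (p y) ℕ.+ count p (xs ++ ys)     ≡⟨ cong (ℕ._+ count p (xs ++ ys)) (ℕP.+-comm (bit (p x)) _) ⟩
      bit (p y) ℕ.+ bit (p x) ℕ.+ count p (xs ++ ys)     ≡⟨ ℕP.+-assoc (bit (p y)) _ _ ⟩
      bit (p y) ℕ.+ count p (x ∷ xs ++ ys)               ∎
      where open ≡-Reasoning

    count≤length : ∀ xs → count p xs ℕ.≤ length xs
    count≤length []       = z≤n
    count≤length (x ∷ xs) = ℕP.+-mono-≤ (bit≤1 (p x)) (count≤length xs)
      where
      bit≤1 : ∀ b → bit b ℕ.≤ 1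
      bit≤1 true  = ℕP.≤-refl
      bit≤1 false = z≤n

    count-all : ∀ {xs} → All (λ x → p x ≡ true) xs → count p xs ≡ length xs
    count-all []         = refl
    count-all (eq ∷ eqs) = cong₂ ℕ._+_ (cong bit eq) (count-all eqs)

    count-none : ∀ {xs} → All (λ x → p x ≡ false) xs → count p xs ≡ 0
    count-none []         = refl
    count-none (eq ∷ eqs) = cong₂ ℕ._+_ (cong bit eq) (count-none eqs)

  -- One direction of the Frobenius-König theorem: the rows with `p` are supported on the columns
  -- with `q`, of which there are fewer. In the expansion along the first column, a term either has
  -- a zero entry or leaves a matrix that still has too few such columns.
  det-zeroBlock : ∀ {A : Set} (F : A → Row) (p : A → Bool) (q : ℕ → Bool) →
    (∀ {a c} → p a ≡ true → q c ≡ false → F a c ≡ 0ℚ) →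
    ∀ cs as → count q cs ℕ.< count p as → det cs (map F as) ≡ 0ℚ
  det-zeroBlock F p q h [] (a ∷ as) _ = refl
  det-zeroBlock F p q h (c ∷ cs) as lt = trans (det-map c cs F as) (alt-zero as step)
    where
    step : ∀ ps a qs → as ≡ ps ++ a ∷ qs → F a c * det cs (map F (ps ++ qs)) ≡ 0ℚ
    step ps a qs refl with q c in qc | p a in pa | subst (count q (c ∷ cs) ℕ.<_) (count-insert p ps a qs) lt
    ... | false | true  | _ = trans (cong (_* det cs (map F (ps ++ qs))) (h pa qc)) (ℚP.*-zeroˡ (det cs (map F (ps ++ qs))))
    ... | false | false | l = trans (cong (F a c *_) (det-zeroBlock F p q h cs (ps ++ qs) l)) (ℚP.*-zeroʳ (F a c))
    ... | true  | true  | l = trans (cong (F a c *_) (det-zeroBlock F p q h cs (ps ++ qs) (ℕP.≤-pred l))) (ℚP.*-zeroʳ (F a c))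
    ... | true  | false | l = trans (cong (F a c *_) (det-zeroBlock F p q h cs (ps ++ qs) (ℕP.<⇒≤ l))) (ℚP.*-zeroʳ (F a c))

  countLe : ℕ → List ℕ → ℕ
  countLe v = count (_≤ᵇ v)

  -- For decreasing lists of equal length this is the entrywise inequality b ≤ a. The counting form
  -- does not depend on the order of the lists and turns the deletion of a common value into a
  -- cancellation.
  Ballot : List ℕ → List ℕ → Set
  Ballot as bs = ∀ v → countLe v as ℕ.≤ countLe v bs

  Disjoint : List ℕ → List ℕ → Set
  Disjoint as bs = ∀ {x} → x ∈ as → x ∉ bs

  countLe-all : ∀ {v xs} → All (ℕ._≤ v) xs → countLe v xs ≡ length xs
  countLe-all a = count-all _ (All.map ≤ᵇ-true a)

  countLe-none : ∀ {v xs} → All (v ℕ.<_) xs → countLe v xs ≡ 0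
  countLe-none a = count-none _ (All.map ≤ᵇ-false a)

  -- The search can stop at `sum bs`: from there on every entry of `bs` is counted, and `as` has no
  -- more entries than `bs`.
  ballot? : ∀ as bs → length as ≡ length bs → Ballot as bs ⊎ Σ ℕ λ v → countLe v bs ℕ.< countLe v as
  ballot? as bs len with ℕP.anyUpTo? (λ v → countLe v bs ℕ.<? countLe v as) (sum bs)
  ... | yes (v , _ , lt) = inj₂ (v , lt)
  ... | no none = inj₁ λ v → ok v (v ℕ.<? s)
    where
    s = sum bs
    ∈≤sum : ∀ {x xs} → x ∈ xs → x ℕ.≤ sum xs
    ∈≤sum {xs = x ∷ xs} (here refl) = ℕP.m≤m+n x (sum xs)
    ∈≤sum {xs = y ∷ xs} (there i)   = ℕP.≤-trans (∈≤sum i) (ℕP.m≤n+m (sum xs) y)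
    ok : ∀ v → Dec (v ℕ.< s) → countLe v as ℕ.≤ countLe v bs
    ok v (yes v<s) = ℕP.≮⇒≥ λ lt → none (v , v<s , lt)
    ok v (no v≮s)  = begin
      countLe v as  ≤⟨ count≤length _ as ⟩
      length as     ≡⟨ len ⟩
      length bs     ≡⟨ countLe-all {v} {bs} (All.tabulate λ i → ℕP.≤-trans (∈≤sum i) (ℕP.≮⇒≥ v≮s)) ⟨
      countLe v bs  ∎
      where open ℕP.≤-Reasoning

  countLe-snoc : ∀ v xs x → countLe v (xs ++ [ x ]) ≡ bit (x ≤ᵇ v) ℕ.+ countLe v xs
  countLe-snoc v xs x = trans (count-insert _ xs x []) (cong (λ l → bit (x ≤ᵇ v) ℕ.+ countLe v l) (++-identityʳ xs))

  -- Below `a` nothing in `xs` is counted; from `a` on, `a` and `y` are both counted, so both sides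
  -- drop by one.
  ballot-dropSmallest : ∀ {a xs ys y} → y ℕ.< a → All (a ℕ.<_) xs → Ballot (a ∷ xs) (ys ++ [ y ]) → Ballot xs ys
  ballot-dropSmallest {a} {xs} {ys} {y} y<a a<xs B v with v ℕ.<? a
  ... | yes v<a = subst (ℕ._≤ countLe v ys) (sym (countLe-none (All.map (ℕP.<-trans v<a) a<xs))) z≤n
  ... | no v≮a with B v
  ...   | b rewrite ≤ᵇ-true (ℕP.≮⇒≥ v≮a) | countLe-snoc v ys y
                  | ≤ᵇ-true (ℕP.≤-trans (ℕP.<⇒≤ y<a) (ℕP.≮⇒≥ v≮a)) = ℕP.≤-pred b

  -- From `b` on all of `ys` is counted, and the lengths agree; below `b` neither `b` nor the larger
  -- `x` is counted, so the inequality is the old one.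
  ballot-dropLargest : ∀ {xs x b ys} → b ℕ.< x → All (ℕ._< b) ys → length xs ≡ length ys →
    Ballot (xs ++ [ x ]) (b ∷ ys) → Ballot xs ys
  ballot-dropLargest {xs} {x} {b} {ys} b<x ys<b len B v with b ℕ.≤? v
  ... | yes b≤v = subst₂ ℕ._≤_ refl (trans len (sym (countLe-all (All.map (λ y<b → ℕP.≤-trans (ℕP.<⇒≤ y<b) b≤v) ys<b))))
                    (count≤length _ xs)
  ... | no b≰v with B v
  ...   | l rewrite countLe-snoc v xs x | ≤ᵇ-false (ℕP.<-trans (ℕP.≰⇒> b≰v) b<x) | ≤ᵇ-false (ℕP.≰⇒> b≰v) = l

  -- The sign (-1)^z, where z is the number of zero entries of the restricted Cauchy matrix, is the
  -- product of the signs of its entries.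
  entrySign : ℕ → ℕ → ℚ
  entrySign a b = if a ≤ᵇ b then - 1ℚ else 1ℚ

  rowSign : List ℕ → ℕ → ℚ
  rowSign bs a = prod (entrySign a) bs

  columnSign : List ℕ → ℕ → ℚ
  columnSign as b = prod (λ a → entrySign a b) as

  sign : List ℕ → List ℕ → ℚ
  sign as bs = prod (rowSign bs) as

  entrySign-> : ∀ {a b} → b ℕ.< a → entrySign a b ≡ 1ℚ
  entrySign-> {a} {b} b<a rewrite ≤ᵇ-false b<a = refl

  entrySign-< : ∀ {a b} → a ℕ.< b → entrySign a b ≡ - 1ℚ
  entrySign-< {a} {b} a<b rewrite ≤ᵇ-true (ℕP.<⇒≤ a<b) = refl

  sign-firstColumn : ∀ as b bs → sign as (b ∷ bs) ≡ columnSign as b * sign as bs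
  sign-firstColumn as b bs = prod-* (λ a → entrySign a b) (rowSign bs) as

  sign-dropLastRow : ∀ as a bs → (∀ {b} → b ∈ bs → b ℕ.< a) → sign (as ++ [ a ]) bs ≡ sign as bs
  sign-dropLastRow as a bs h = begin
    sign (as ++ [ a ]) bs             ≡⟨ prod-++ (rowSign bs) as [ a ] ⟩
    sign as bs * (rowSign bs a * 1ℚ)  ≡⟨ cong (λ x → sign as bs * (x * 1ℚ)) (prod-1 bs λ i → entrySign-> (h i)) ⟩
    sign as bs * 1ℚ                   ≡⟨ ℚP.*-identityʳ _ ⟩
    sign as bs                        ∎
    where open ≡-Reasoning

  sign-dropLastColumn : ∀ as bs b → (∀ {a} → a ∈ as → b ℕ.< a) → sign as (bs ++ [ b ]) ≡ sign as bs
  sign-dropLastColumn as bs b h = prod-cong as λ {a} i → begin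
    rowSign (bs ++ [ b ]) a                 ≡⟨ prod-++ (entrySign a) bs [ b ] ⟩
    rowSign bs a * (entrySign a b * 1ℚ)     ≡⟨ cong (λ x → rowSign bs a * (x * 1ℚ)) (entrySign-> (h i)) ⟩
    rowSign bs a * 1ℚ                       ≡⟨ ℚP.*-identityʳ _ ⟩
    rowSign bs a                            ∎
    where open ≡-Reasoning

  module _ {A : Set} {R : A → A → Set} where

    allPairs-++⁻ˡ : ∀ xs {ys} → AllPairs R (xs ++ ys) → AllPairs R xs
    allPairs-++⁻ˡ []       _        = []
    allPairs-++⁻ˡ (x ∷ xs) (p ∷ ps) = AllP.++⁻ˡ xs p ∷ allPairs-++⁻ˡ xs ps

    allPairs-last : ∀ xs {y} → AllPairs R (xs ++ [ y ]) → All (λ x → R x y) xs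
    allPairs-last []       _        = []
    allPairs-last (x ∷ xs) (p ∷ ps) = All.head (AllP.++⁻ʳ xs p) ∷ allPairs-last xs ps

    allPairs-remove : ∀ xs {y ys} → AllPairs R (xs ++ y ∷ ys) → AllPairs R (xs ++ ys)
    allPairs-remove []       (_ ∷ ps) = ps
    allPairs-remove (x ∷ xs) (p ∷ ps) = AllP.++⁺ (AllP.++⁻ˡ xs p) (All.tail (AllP.++⁻ʳ xs p)) ∷ allPairs-remove xs ps

  signedDet : List ℕ → List ℕ → ℚ
  signedDet as bs = sign as bs * det bs (map cauchy as)

  -- The rows with a ≤ v are zero in every column with v < b, so they live on the fewer columns with
  -- b ≤ v.
  det-nonBallot : ∀ {as bs v} → countLe v bs ℕ.< countLe v as → det bs (map cauchy as) ≡ 0ℚ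
  det-nonBallot {as} {bs} {v} = det-zeroBlock cauchy (_≤ᵇ v) (_≤ᵇ v)
    (λ {a} {c} a≤v c≰v → cauchy-zero {a} {c} (ℕP.≤-trans (≤ᵇ-true⁻¹ {a} {v} a≤v) (ℕP.<⇒≤ (≤ᵇ-false⁻¹ {c} {v} c≰v)))) bs as

  signedDet-full-pos : ∀ as bs → length as ≡ length bs → Increasing as → Decreasing bs →
    (∀ {a b} → a ∈ as → b ∈ bs → b ℕ.< a) → 0ℚ < signedDet as bs
  signedDet-full-pos as bs len inc dec full = *-pos
    (prod-pos as λ i → prod-pos bs λ j → subst (0ℚ <_) (sym (entrySign-> (full i j))) (ℚP.positive⁻¹ 1ℚ))
    (det-cauchy-pos as bs len inc dec full)

  SignedDetPos : ℕ → Set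
  SignedDetPos n = ∀ as bs → length as ≡ n → length bs ≡ n → Increasing as → Decreasing bs →
    Disjoint as bs → Ballot as bs → 0ℚ < signedDet as bs

  -- Serves the one minor in the condensation step that can lose the ballot condition: without it
  -- the determinant is 0.
  signedDet-nonNeg : ∀ {n} → SignedDetPos n → ∀ as bs → length as ≡ n → length bs ≡ n →
    Increasing as → Decreasing bs → Disjoint as bs → 0ℚ ≤ signedDet as bs
  signedDet-nonNeg pos as bs la lb inc dec dis with ballot? as bs (trans la (sym lb))
  ... | inj₁ B        = ℚP.<⇒≤ (pos as bs la lb inc dec dis B)
  ... | inj₂ (v , lt) = ℚP.≤-reflexive (sym (trans (cong (sign as bs *_) (det-nonBallot {as} {bs} {v} lt)) (ℚP.*-zeroʳ (sign as bs))))

  signedDet-pos₀ : SignedDetPos 0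
  signedDet-pos₀ [] [] _ _ _ _ _ _ = ℚP.positive⁻¹ 1ℚ

  signedDet-pos₁ : SignedDetPos 1
  signedDet-pos₁ (a ∷ []) (b ∷ []) _ _ inc dec dis B =
    signedDet-full-pos (a ∷ []) (b ∷ []) refl inc dec λ { (here refl) (here refl) → b<a }
    where
    b<a : b ℕ.< a
    b<a with ℕP.<-cmp b a
    ... | tri< l _ _ = l
    ... | tri≈ _ refl _ = contradiction (here refl) (dis (here refl))
    ... | tri> _ _ a<b = contradiction
            (subst₂ ℕ._≤_ (countLe-all {a} {[ a ]} (ℕP.≤-refl ∷ [])) (countLe-none {a} {[ b ]} (a<b ∷ [])) (B a)) λ ()
  signedDet-pos₁ (a ∷ []) (b ∷ _ ∷ _) _ () inc dec dis B
  signedDet-pos₁ (a ∷ _ ∷ _) _ () _ inc dec dis B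

  -- If the smallest a lies below the largest b, Dodgson condensation on the corners of the matrix
  -- becomes, with the signs included, an identity P * P″ = P₁ * P₂ + P₃ * P₄ between quantities that
  -- are nonnegative by induction; otherwise the matrix is a full Cauchy matrix.
  signedDet-step : ∀ {k} → SignedDetPos k → SignedDetPos (suc k) → SignedDetPos (suc (suc k))
  signedDet-step {k} pos₀ pos₁ (a ∷ as) (b ∷ bs) la lb inc@(a<as ∷ _) dec@(bs<b ∷ _) dis B
    with ℕP.<-cmp a b | initLast as | initLast bs
  ... | tri≈ _ refl _ | _ | _ = contradiction (here refl) (dis (here refl))
  ... | tri> _ _ b<a | _ | _ = signedDet-full-pos (a ∷ as) (b ∷ bs) (trans la (sym lb)) inc dec full
    where
    full : ∀ {x y} → x ∈ a ∷ as → y ∈ b ∷ bs → y ℕ.< x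
    full (here refl) (here refl) = b<a
    full (here refl) (there j)   = ℕP.<-trans (All.lookup bs<b j) b<a
    full (there i)   (here refl) = ℕP.<-trans b<a (All.lookup a<as i)
    full (there i)   (there j)   = ℕP.<-trans (All.lookup bs<b j) (ℕP.<-trans b<a (All.lookup a<as i))
  ... | tri< a<b _ _ | [] | _ = contradiction la λ ()
  ... | tri< a<b _ _ | _ ∷ʳ′ _ | [] = contradiction lb λ ()
  -- `P₁` can vanish, since its lists need not satisfy `Ballot`; the strict sign of the right-hand
  -- side comes from the product of `P₃` and `P₄`.
  ... | tri< a<b _ _ | am ∷ʳ′ a′ | bm ∷ʳ′ b′ = *-pos-cancel P″-pos (subst (0ℚ <_) (sym condensation)
        (ℚP.+-mono-≤-< (*-nonNeg P₁-nonNeg (ℚP.<⇒≤ P₂-pos)) (*-pos P₃-pos P₄-pos)))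
    where
    open ≡-Reasoning
    len-m : ∀ (xs : List ℕ) {x} → suc (length (xs ++ [ x ])) ≡ suc (suc k) → length xs ≡ k
    len-m xs e = ℕP.suc-injective (trans (ℕP.+-comm 1 (length xs)) (trans (sym (length-++ xs)) (ℕP.suc-injective e)))
    lam : length am ≡ k
    lam = len-m am la
    lbm : length bm ≡ k
    lbm = len-m bm lb
    inc′ = AllPairs.tail inc
    dec′ = AllPairs.tail dec
    inc-am = allPairs-++⁻ˡ am inc′
    dec-bm = allPairs-++⁻ˡ bm dec′
    inc-a = allPairs-++⁻ˡ (a ∷ am) inc
    dec-b = allPairs-++⁻ˡ (b ∷ bm) dec
    a<a′ : All (ℕ._< a′) (a ∷ am)
    a<a′ = allPairs-last (a ∷ am) inc
    b>b′ : All (ℕ._> b′) (b ∷ bm)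
    b>b′ = allPairs-last (b ∷ bm) dec
    a∈ : a ∈ a ∷ am ++ [ a′ ]
    a∈ = here refl
    a′∈ : a′ ∈ a ∷ am ++ [ a′ ]
    a′∈ = there (∈-insert am)
    b′∈ : b′ ∈ b ∷ bm ++ [ b′ ]
    b′∈ = there (∈-insert bm)
    -- `Ballot` at v = a, and below at v = a′, shows that the column of the smallest b and the row
    -- of the largest a contain no zero entry, so dropping them leaves the sign unchanged.
    b′<a : b′ ℕ.< a
    b′<a with ℕP.<-cmp b′ a
    ... | tri< l _ _ = l
    ... | tri≈ _ refl _ = contradiction b′∈ (dis a∈)
    ... | tri> _ _ a<b′ = contradiction
            (subst (countLe a (a ∷ am ++ [ a′ ]) ℕ.≤_) (countLe-none (AllP.++⁺ (All.map (ℕP.<-trans a<b′) b>b′) (a<b′ ∷ []))) (B a))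
            (subst (λ t → ¬ (bit t ℕ.+ countLe a (am ++ [ a′ ]) ℕ.≤ 0)) (sym (≤ᵇ-true (ℕP.≤-refl {a}))) λ ())
    b<a′ : b ℕ.< a′
    b<a′ with ℕP.<-cmp b a′
    ... | tri< l _ _ = l
    ... | tri≈ _ refl _ = contradiction (here refl) (dis a′∈)
    ... | tri> _ _ a′<b = contradiction (subst₂ ℕ._≤_
            (trans (countLe-all {a′} (AllP.++⁺ (All.map ℕP.<⇒≤ a<a′) (ℕP.≤-refl ∷ []))) (trans la (sym lb)))
            (cong (λ t → bit t ℕ.+ countLe a′ (bm ++ [ b′ ])) (≤ᵇ-false a′<b)) (B a′))
            (ℕP.<⇒≱ (s≤s (count≤length _ (bm ++ [ b′ ]))))
    b′<as : ∀ {x} → x ∈ a ∷ am → b′ ℕ.< x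
    b′<as (here refl) = b′<a
    b′<as (there i)   = ℕP.<-trans b′<a (All.lookup a<as (∈-++⁺ˡ i))
    bs<a′ : ∀ {y} → y ∈ b ∷ bm ++ [ b′ ] → y ℕ.< a′
    bs<a′ (here refl) = b<a′
    bs<a′ (there j)   = ℕP.<-trans (All.lookup bs<b j) b<a′
    B₃ : Ballot (a ∷ am) (bm ++ [ b′ ])
    B₃ = ballot-dropLargest {a ∷ am} {a′} {b} {bm ++ [ b′ ]} b<a′ bs<b (trans (cong suc lam) (trans (ℕP.+-comm 1 k) (trans (cong (ℕ._+ 1) (sym lbm)) (sym (length-++ bm))))) B
    B₄ : Ballot (am ++ [ a′ ]) (b ∷ bm)
    B₄ = ballot-dropSmallest {a} {am ++ [ a′ ]} {b ∷ bm} {b′} b′<a a<as B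
    B″ : Ballot am bm
    B″ = ballot-dropLargest {am} {a′} {b} {bm} b<a′ (AllP.++⁻ˡ bm bs<b) (trans lam (sym lbm)) B₄
    B₂ : Ballot (am ++ [ a′ ]) (bm ++ [ b′ ])
    B₂ v with B″ v
    ... | l rewrite countLe-snoc v am a′ | countLe-snoc v bm b′ = ℕP.+-mono-≤ bits l
      where
      bits : bit (a′ ≤ᵇ v) ℕ.≤ bit (b′ ≤ᵇ v)
      bits with a′ ≤ᵇ v in eq
      ... | false = z≤n
      ... | true rewrite ≤ᵇ-true (ℕP.≤-trans (ℕP.<⇒≤ (bs<a′ b′∈)) (≤ᵇ-true⁻¹ {a′} {v} eq)) = ℕP.≤-refl
    snoc-len : ∀ (xs : List ℕ) {x} → length xs ≡ k → length (xs ++ [ x ]) ≡ suc k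
    snoc-len xs e = trans (length-++ xs) (trans (ℕP.+-comm (length xs) 1) (cong suc e))
    keep : ∀ {x : ℕ} {xs y} → x ∈ xs → x ∈ xs ++ [ y ]
    keep = ∈-++⁺ˡ
    P″-pos : 0ℚ < signedDet am bm
    P″-pos = pos₀ am bm lam lbm inc-am dec-bm (λ i j → dis (there (keep i)) (there (keep j))) B″
    P₁-nonNeg : 0ℚ ≤ signedDet (a ∷ am) (b ∷ bm)
    P₁-nonNeg = signedDet-nonNeg pos₁ (a ∷ am) (b ∷ bm) (cong suc lam) (cong suc lbm) inc-a dec-b (λ i j → dis (keep i) (keep j))
    P₂-pos : 0ℚ < signedDet (am ++ [ a′ ]) (bm ++ [ b′ ])
    P₂-pos = pos₁ _ _ (snoc-len am lam) (snoc-len bm lbm) inc′ dec′ (λ i j → dis (there i) (there j)) B₂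
    P₃-pos : 0ℚ < signedDet (a ∷ am) (bm ++ [ b′ ])
    P₃-pos = pos₁ _ _ (cong suc lam) (snoc-len bm lbm) inc-a dec′ (λ i j → dis (keep i) (there j)) B₃
    P₄-pos : 0ℚ < signedDet (am ++ [ a′ ]) (b ∷ bm)
    P₄-pos = pos₁ _ _ (snoc-len am lam) (cong suc lbm) inc′ dec-b (λ i j → dis (there i) (keep j)) B₄
    K = map cauchy
    D   = det (b ∷ bm ++ [ b′ ]) (K (a ∷ am ++ [ a′ ]))
    D″  = det bm (K am)
    D₁  = det (b ∷ bm) (K (a ∷ am))
    D₂  = det (bm ++ [ b′ ]) (K (am ++ [ a′ ]))
    D₃  = det (bm ++ [ b′ ]) (K (a ∷ am))
    D₄  = det (b ∷ bm) (K (am ++ [ a′ ]))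
    dodgson′ : D * D″ ≡ D₁ * D₂ - D₃ * D₄
    dodgson′ rewrite map-++ cauchy am [ a′ ] = dodgson b bm b′ (cauchy a) (K am) (cauchy a′)
      (λ i → ℕP.<-irrefl refl (All.lookup bs<b (keep i)))
      (λ { refl → ℕP.<-irrefl refl (All.head b>b′) })
      (λ i → ℕP.<-irrefl refl (All.lookup b>b′ (there i)))
      (trans lbm (trans (sym lam) (sym (length-map cauchy am))))
    z  = sign am bm
    r  = rowSign bm a
    c  = columnSign am b
    -- The zero at the corner (a , b) contributes a factor -1 to `s₁` and `s` but to none of `s₂`,
    -- `s₃`, `s₄`; this turns the minus in Dodgson's identity into a plus.
    s₁ : sign (a ∷ am) (b ∷ bm) ≡ (- 1ℚ) * r * (c * z)
    s₁ = cong₂ _*_ (cong (_* r) (entrySign-< a<b)) (sign-firstColumn am b bm)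
    s : sign (a ∷ am ++ [ a′ ]) (b ∷ bm ++ [ b′ ]) ≡ (- 1ℚ) * r * (c * z)
    s = trans (sign-dropLastRow (a ∷ am) a′ (b ∷ bm ++ [ b′ ]) bs<a′) (trans (sign-dropLastColumn (a ∷ am) (b ∷ bm) b′ b′<as) s₁)
    s₃ : sign (a ∷ am) (bm ++ [ b′ ]) ≡ r * z
    s₃ = sign-dropLastColumn (a ∷ am) bm b′ b′<as
    s₄ : sign (am ++ [ a′ ]) (b ∷ bm) ≡ c * z
    s₄ = trans (sign-dropLastRow am a′ (b ∷ bm) (λ j → bs<a′ (keep j))) (sign-firstColumn am b bm)
    s₂ : sign (am ++ [ a′ ]) (bm ++ [ b′ ]) ≡ z
    s₂ = trans (sign-dropLastRow am a′ (bm ++ [ b′ ]) (bs<a′ ∘ there)) (sign-dropLastColumn am bm b′ (b′<as ∘ there))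
    condensation : signedDet (a ∷ am ++ [ a′ ]) (b ∷ bm ++ [ b′ ]) * signedDet am bm ≡
      signedDet (a ∷ am) (b ∷ bm) * signedDet (am ++ [ a′ ]) (bm ++ [ b′ ]) +
      signedDet (a ∷ am) (bm ++ [ b′ ]) * signedDet (am ++ [ a′ ]) (b ∷ bm)
    condensation = begin
      signedDet (a ∷ am ++ [ a′ ]) (b ∷ bm ++ [ b′ ]) * (z * D″)
        ≡⟨ cong (λ x → x * D * (z * D″)) s ⟩
      (- 1ℚ) * r * (c * z) * D * (z * D″)
        ≡⟨ solve 4 (λ m z d e → m :* d :* (z :* e) := m :* z :* (d :* e)) refl ((- 1ℚ) * r * (c * z)) z D D″ ⟩
      (- 1ℚ) * r * (c * z) * z * (D * D″)
        ≡⟨ cong ((- 1ℚ) * r * (c * z) * z *_) dodgson′ ⟩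
      (- 1ℚ) * r * (c * z) * z * (D₁ * D₂ - D₃ * D₄)
        ≡⟨ solve 7 (λ r c z d1 d2 d3 d4 → con (- 1ℚ) :* r :* (c :* z) :* z :* (d1 :* d2 :- d3 :* d4) :=
             con (- 1ℚ) :* r :* (c :* z) :* d1 :* (z :* d2) :+ r :* z :* d3 :* (c :* z :* d4)) refl r c z D₁ D₂ D₃ D₄ ⟩
      (- 1ℚ) * r * (c * z) * D₁ * (z * D₂) + r * z * D₃ * (c * z * D₄)
        ≡⟨ cong₂ _+_ (cong₂ (λ x y → x * D₁ * (y * D₂)) s₁ s₂) (cong₂ (λ x y → x * D₃ * (y * D₄)) s₃ s₄) ⟨
      signedDet (a ∷ am) (b ∷ bm) * signedDet (am ++ [ a′ ]) (bm ++ [ b′ ]) +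
      signedDet (a ∷ am) (bm ++ [ b′ ]) * signedDet (am ++ [ a′ ]) (b ∷ bm) ∎

  signedDet-pos : ∀ n → SignedDetPos n
  signedDet-pos zero          = signedDet-pos₀
  signedDet-pos (suc zero)    = signedDet-pos₁
  signedDet-pos (suc (suc k)) = signedDet-step (signedDet-pos k) (signedDet-pos (suc k))

  -- The lowest order coefficients in t of the Jacobi–Trudi matrix: a row with an entry h₀ = 1 starts
  -- in degree 0, where it is a unit row, and every other row starts in degree 1.
  leading : List ℕ → ℕ → Row
  leading bs a with a ∈? bs
  ... | yes _ = unit a
  ... | no _  = cauchy a

  leading-∈ : ∀ {bs a} → a ∈ bs → leading bs a ≡ unit a
  leading-∈ {bs} {a} a∈bs with a ∈? bs
  ... | yes _   = refl
  ... | no a∉bs = contradiction a∈bs a∉bs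

  leading-∉ : ∀ {bs a} → a ∉ bs → leading bs a ≡ cauchy a
  leading-∉ {bs} {a} a∉bs with a ∈? bs
  ... | yes a∈bs = contradiction a∈bs a∉bs
  ... | no _     = refl

  module _ {A : Set} where

    ∈-insert⁺ : ∀ {x y : A} xs {ys} → x ∈ xs ++ ys → x ∈ xs ++ y ∷ ys
    ∈-insert⁺ xs i with ∈-++⁻ xs i
    ... | inj₁ j = ∈-++⁺ˡ j
    ... | inj₂ j = ∈-++⁺ʳ xs (there j)

    ∈-insert⁻ : ∀ {x y : A} xs {ys} → x ≢ y → x ∈ xs ++ y ∷ ys → x ∈ xs ++ ys
    ∈-insert⁻ xs x≢y i with ∈-++⁻ xs i
    ... | inj₁ j           = ∈-++⁺ˡ j
    ... | inj₂ (here x≡y)  = contradiction x≡y x≢y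
    ... | inj₂ (there j)   = ∈-++⁺ʳ xs j

    allPairs-reverse : ∀ {R : A → A → Set} {xs} → AllPairs R xs → AllPairs (λ x y → R y x) (reverse xs)
    allPairs-reverse [] = []
    allPairs-reverse {R} {x ∷ xs} (p ∷ ps) rewrite unfold-reverse x xs =
      AllPairsP.++⁺ (allPairs-reverse ps) ([] ∷ []) (All.tabulate λ i → All.lookup p (∈-resp-↭ (↭-reverse xs) i) ∷ [])

    count-reverse : ∀ (p : A → Bool) xs → count p (reverse xs) ≡ count p xs
    count-reverse p [] = refl
    count-reverse p (x ∷ xs) rewrite unfold-reverse x xs = begin
      count p (reverse xs ++ [ x ])               ≡⟨ count-insert p (reverse xs) x [] ⟩
      bit (p x) ℕ.+ count p (reverse xs ++ [])    ≡⟨ cong (λ l → bit (p x) ℕ.+ count p l) (++-identityʳ (reverse xs)) ⟩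
      bit (p x) ℕ.+ count p (reverse xs)          ≡⟨ cong (bit (p x) ℕ.+_) (count-reverse p xs) ⟩
      bit (p x) ℕ.+ count p xs                    ∎
      where open ≡-Reasoning

  decreasing-∉ : ∀ xs {x ys} → Decreasing (xs ++ x ∷ ys) → x ∉ xs ++ ys
  decreasing-∉ []       (x> ∷ _) i           = ℕP.<-irrefl refl (All.lookup x> i)
  decreasing-∉ (z ∷ xs) (z> ∷ _) (here refl) = ℕP.<-irrefl refl (All.lookup z> (∈-insert xs))
  decreasing-∉ (z ∷ xs) (_ ∷ d)  (there i)   = decreasing-∉ xs d i

  ballot-remove : ∀ ps x qs xs ys → Ballot (ps ++ x ∷ qs) (xs ++ x ∷ ys) → Ballot (ps ++ qs) (xs ++ ys)
  ballot-remove ps x qs xs ys B v = ℕP.+-cancelˡ-≤ (bit (x ≤ᵇ v)) _ _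
    (subst₂ ℕ._≤_ (count-insert _ ps x qs) (count-insert _ xs x ys) (B v))

  sgn*x≡0⇒x≡0 : ∀ n {x} → sgn n * x ≡ 0ℚ → x ≡ 0ℚ
  sgn*x≡0⇒x≡0 n {x} e = begin
    x                    ≡⟨ ℚP.*-identityˡ x ⟨
    1ℚ * x               ≡⟨ cong (_* x) (sgn² n) ⟨
    sgn n * sgn n * x    ≡⟨ ℚP.*-assoc (sgn n) (sgn n) x ⟩
    sgn n * (sgn n * x)  ≡⟨ cong (sgn n *_) e ⟩
    sgn n * 0ℚ           ≡⟨ ℚP.*-zeroʳ (sgn n) ⟩
    0ℚ                   ∎
    where open ≡-Reasoning

  -- A common value `x` has a unit row; expanding along it removes `x` from both lists and keeps the
  -- other rows, as `x` occurs only once in each list. With no common value left the rows form the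
  -- restricted Cauchy matrix, up to the reversal that makes them increase. The removed elements lie
  -- inside the lists, hence the recursion on the length `n`.
  det-leading≢0 : ∀ n as bs → length as ≡ n → length bs ≡ n → Decreasing as → Decreasing bs →
    Ballot as bs → det bs (map (leading bs) as) ≢ 0ℚ
  det-leading≢0 n as bs la lb da db B with Any.any? (_∈? bs) as
  ... | no none = λ e → ℚP.<⇒≢ pos (sym (begin
    signedDet (reverse as) bs  ≡⟨ cong (sign (reverse as) bs *_) (det-permuteRows (map⁺ cauchy (↭-reverse as)) bs (begin
      det bs (map cauchy as)         ≡⟨ det-map-cong bs as (λ {a} {c} i _ → cong (λ r → r c) (leading-∉ (dis i))) ⟨
      det bs (map (leading bs) as)   ≡⟨ e ⟩
      0ℚ                             ∎)) ⟩
    sign (reverse as) bs * 0ℚ  ≡⟨ ℚP.*-zeroʳ (sign (reverse as) bs) ⟩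
    0ℚ                         ∎))
    where
    open ≡-Reasoning
    dis : ∀ {x} → x ∈ as → x ∉ bs
    dis i j = none (Any.map (λ { refl → j }) i)
    pos : 0ℚ < signedDet (reverse as) bs
    pos = signedDet-pos n (reverse as) bs (trans (length-reverse as) la) lb (allPairs-reverse da) db
      (λ i → dis (∈-resp-↭ (↭-reverse as) i)) (λ v → subst (ℕ._≤ countLe v bs) (sym (count-reverse _ as)) (B v))
  ... | yes some with find some
  ...   | x , x∈as , x∈bs with ∈-∃++ x∈as | ∈-∃++ x∈bs
  ...     | ps , qs , refl | xs , ys , refl = shrink n la lb
    where
    open ≡-Reasoning
    L  = leading (xs ++ x ∷ ys)
    L′ = leading (xs ++ ys)
    x∉bs : x ∉ xs ++ ys
    x∉bs = decreasing-∉ xs db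
    x∉as : x ∉ ps ++ qs
    x∉as = decreasing-∉ ps da
    same : ∀ {a c} → a ∈ ps ++ qs → L a c ≡ L′ a c
    same {a} {c} i with a ∈? xs ++ ys
    ... | yes j = cong (λ r → r c) (leading-∈ (∈-insert⁺ xs j))
    ... | no a∉ = cong (λ r → r c) (leading-∉ λ j → a∉ (∈-insert⁻ xs (λ { refl → x∉as i }) j))
    reduction : det (xs ++ x ∷ ys) (map L (ps ++ x ∷ qs)) ≡
      sgn (length (map L ps)) * (sgn (length xs) * det (xs ++ ys) (map L′ (ps ++ qs)))
    reduction = begin
      det (xs ++ x ∷ ys) (map L (ps ++ x ∷ qs))
        ≡⟨ cong (det (xs ++ x ∷ ys)) (map-++ L ps (x ∷ qs)) ⟩
      det (xs ++ x ∷ ys) (map L ps ++ L x ∷ map L qs)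
        ≡⟨ det-moveToFront (xs ++ x ∷ ys) (map L ps) (L x) (map L qs) ⟩
      s * det (xs ++ x ∷ ys) (L x ∷ map L ps ++ map L qs)
        ≡⟨ cong₂ (λ r l → s * det (xs ++ x ∷ ys) (r ∷ l)) (leading-∈ (∈-insert xs)) (sym (map-++ L ps qs)) ⟩
      s * det (xs ++ x ∷ ys) (unit x ∷ map L (ps ++ qs))
        ≡⟨ cong (s *_) (det-unitRow xs x ys _ (x∉bs ∘ ∈-++⁺ˡ) (x∉bs ∘ ∈-++⁺ʳ xs)) ⟩
      s * (sgn (length xs) * det (xs ++ ys) (map L (ps ++ qs)))
        ≡⟨ cong (λ d → s * (sgn (length xs) * d)) (det-map-cong (xs ++ ys) (ps ++ qs) λ i _ → same i) ⟩
      s * (sgn (length xs) * det (xs ++ ys) (map L′ (ps ++ qs))) ∎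
      where s = sgn (length (map L ps))
    length-remove : ∀ (us : List ℕ) {u vs m} → length (us ++ u ∷ vs) ≡ suc m → length (us ++ vs) ≡ m
    length-remove []       e = ℕP.suc-injective e
    length-remove (_ ∷ us) {m = suc m} e = cong suc (length-remove us (ℕP.suc-injective e))
    length-remove (_ ∷ us) {vs = vs} {zero} e = contradiction (trans (sym (length-++ us)) (ℕP.suc-injective e))
      λ e′ → ℕP.1+n≢0 (trans (sym (ℕP.+-suc (length us) (length vs))) e′)
    shrink : ∀ n → length (ps ++ x ∷ qs) ≡ n → length (xs ++ x ∷ ys) ≡ n →
      det (xs ++ x ∷ ys) (map L (ps ++ x ∷ qs)) ≢ 0ℚ
    shrink zero la _ = contradiction (trans (sym (length-++ ps)) la)
      λ e′ → ℕP.1+n≢0 (trans (sym (ℕP.+-suc (length ps) (length qs))) e′)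
    shrink (suc m) la lb e = det-leading≢0 m (ps ++ qs) (xs ++ ys) (length-remove ps la) (length-remove xs lb)
      (allPairs-remove ps da) (allPairs-remove xs db) (ballot-remove ps x qs xs ys B)
      (sgn*x≡0⇒x≡0 (length xs) (sgn*x≡0⇒x≡0 (length (map L ps)) (trans (sym reduction) e)))

-- Lowest-order terms in t of functions on the natural numbers.

module LowestOrderTerms where

  open Determinants
  open RestrictedCauchy
  open import Data.Rational using (_+_; _*_; -_; _-_; _<_)
  open import Data.Rational.Solver using (module +-*-Solver)
  open +-*-Solver using (solve; _:=_; _:+_; _:*_; :-_; _:-_; con)

  infixl 6 _+ₚ_
  _+ₚ_ : List ℚ → List ℚ → List ℚ
  []       +ₚ q        = q
  (a ∷ p)  +ₚ []       = a ∷ p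
  (a ∷ p)  +ₚ (b ∷ q)  = a + b ∷ p +ₚ q

  scaleₚ : ℚ → List ℚ → List ℚ
  scaleₚ k = map (k *_)

  _*ₚ_ : List ℚ → List ℚ → List ℚ
  []      *ₚ q = []
  (a ∷ p) *ₚ q = scaleₚ a q +ₚ (0ℚ ∷ p *ₚ q)

  evalPoly-+ : ∀ p q x → evalPoly (p +ₚ q) x ≡ evalPoly p x + evalPoly q x
  evalPoly-+ []      q       x = sym (ℚP.+-identityˡ _)
  evalPoly-+ (a ∷ p) []      x = sym (ℚP.+-identityʳ _)
  evalPoly-+ (a ∷ p) (b ∷ q) x = trans (cong (λ y → a + b + x * y) (evalPoly-+ p q x))
    (solve 5 (λ a b x p q → a :+ b :+ x :* (p :+ q) := a :+ x :* p :+ (b :+ x :* q)) refl a b x (evalPoly p x) (evalPoly q x))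

  evalPoly-scale : ∀ k p x → evalPoly (scaleₚ k p) x ≡ k * evalPoly p x
  evalPoly-scale k []      x = sym (ℚP.*-zeroʳ k)
  evalPoly-scale k (a ∷ p) x = trans (cong (λ y → k * a + x * y) (evalPoly-scale k p x))
    (solve 4 (λ k a x p → k :* a :+ x :* (k :* p) := k :* (a :+ x :* p)) refl k a x (evalPoly p x))

  evalPoly-* : ∀ p q x → evalPoly (p *ₚ q) x ≡ evalPoly p x * evalPoly q x
  evalPoly-* []      q x = sym (ℚP.*-zeroˡ (evalPoly q x))
  evalPoly-* (a ∷ p) q x = begin
    evalPoly (scaleₚ a q +ₚ (0ℚ ∷ p *ₚ q)) x                     ≡⟨ evalPoly-+ (scaleₚ a q) (0ℚ ∷ p *ₚ q) x ⟩
    evalPoly (scaleₚ a q) x + (0ℚ + x * evalPoly (p *ₚ q) x)     ≡⟨ cong₂ (λ u v → u + (0ℚ + x * v)) (evalPoly-scale a q x) (evalPoly-* p q x) ⟩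
    a * evalPoly q x + (0ℚ + x * (evalPoly p x * evalPoly q x))
      ≡⟨ solve 4 (λ a x p q → a :* q :+ (con 0ℚ :+ x :* (p :* q)) := (a :+ x :* p) :* q) refl a x (evalPoly p x) (evalPoly q x) ⟩
    (a + x * evalPoly p x) * evalPoly q x                        ∎
    where open ≡-Reasoning

  -- The coefficient `c` may be 0, so `k` is only a lower bound for the order. This keeps the notion
  -- closed under sums and products; that the order is exactly `k` follows from `c ≢ 0ℚ` in
  -- `lowOrder-sharp`.
  record LowOrder (f : ℕ → ℚ) (k : ℕ) (c : ℚ) : Set where
    constructor lowOrder
    field
      higher    : List ℚ
      expansion : ∀ t → f t ≡ toℚ (t ^ k) * evalPoly (c ∷ higher) (toℚ t)

  lowOrder-cong : ∀ {f g k c d} → (∀ t → g t ≡ f t) → c ≡ d → LowOrder f k c → LowOrder g k d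
  lowOrder-cong f≡g refl (lowOrder Q h) = lowOrder Q λ t → trans (f≡g t) (h t)

  lowOrder-zero : ∀ k → LowOrder (λ _ → 0ℚ) k 0ℚ
  lowOrder-zero k = lowOrder [] λ t → solve 2 (λ a x → con 0ℚ := a :* (con 0ℚ :+ x :* con 0ℚ)) refl (toℚ (t ^ k)) (toℚ t)

  lowOrder-const : ∀ c → LowOrder (λ _ → c) 0 c
  lowOrder-const c = lowOrder [] λ t → solve 2 (λ c x → c := con 1ℚ :* (c :+ x :* con 0ℚ)) refl c (toℚ t)

  lowOrder-- : ∀ {f g k c d} → LowOrder f k c → LowOrder g k d → LowOrder (λ t → f t - g t) k (c - d)
  lowOrder-- {f} {g} {k} {c} {d} (lowOrder P p) (lowOrder Q q) = lowOrder (P +ₚ scaleₚ (- 1ℚ) Q) λ t →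
    let x = toℚ t; m = toℚ (t ^ k) in begin
    f t - g t                                                             ≡⟨ cong₂ _-_ (p t) (q t) ⟩
    m * (c + x * evalPoly P x) - m * (d + x * evalPoly Q x)
      ≡⟨ solve 6 (λ m c d x p q → m :* (c :+ x :* p) :- m :* (d :+ x :* q) := m :* (c :- d :+ x :* (p :+ con (- 1ℚ) :* q))) refl
           m c d x (evalPoly P x) (evalPoly Q x) ⟩
    m * (c - d + x * (evalPoly P x + (- 1ℚ) * evalPoly Q x))
      ≡⟨ cong (λ y → m * (c - d + x * y)) (trans (evalPoly-+ P _ x) (cong (evalPoly P x +_) (evalPoly-scale (- 1ℚ) Q x))) ⟨
    m * (c - d + x * evalPoly (P +ₚ scaleₚ (- 1ℚ) Q) x)                   ∎
    where open ≡-Reasoning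

  lowOrder-* : ∀ {f g k l c d} → LowOrder f k c → LowOrder g l d → LowOrder (λ t → f t * g t) (k ℕ.+ l) (c * d)
  lowOrder-* {f} {g} {k} {l} {c} {d} (lowOrder P p) (lowOrder Q q) = lowOrder (scaleₚ c Q +ₚ scaleₚ d P +ₚ (0ℚ ∷ P *ₚ Q)) λ t →
    let x = toℚ t; m = toℚ (t ^ k); n = toℚ (t ^ l); u = evalPoly P x; v = evalPoly Q x in begin
    f t * g t                                      ≡⟨ cong₂ _*_ (p t) (q t) ⟩
    m * (c + x * u) * (n * (d + x * v))
      ≡⟨ solve 7 (λ m n c d x u v → m :* (c :+ x :* u) :* (n :* (d :+ x :* v)) :=
           m :* n :* (c :* d :+ x :* (c :* v :+ d :* u :+ (con 0ℚ :+ x :* (u :* v))))) refl m n c d x u v ⟩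
    m * n * (c * d + x * (c * v + d * u + (0ℚ + x * (u * v))))
      ≡⟨ cong₂ (λ a b → a * (c * d + x * b)) (trans (cong toℚ (ℕP.^-distribˡ-+-* t k l)) (toℚ-* (t ^ k) (t ^ l)))
           (trans (evalPoly-+ (scaleₚ c Q +ₚ scaleₚ d P) (0ℚ ∷ P *ₚ Q) x)
             (cong₂ (λ a b → a + (0ℚ + x * b))
               (trans (evalPoly-+ (scaleₚ c Q) (scaleₚ d P) x) (cong₂ _+_ (evalPoly-scale c Q x) (evalPoly-scale d P x)))
               (evalPoly-* P Q x))) ⟨
    toℚ (t ^ (k ℕ.+ l)) * (c * d + x * evalPoly (scaleₚ c Q +ₚ scaleₚ d P +ₚ (0ℚ ∷ P *ₚ Q)) x) ∎
    where open ≡-Reasoning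

  lowOrder-weaken : ∀ {f k c} → LowOrder f (suc k) c → LowOrder f k 0ℚ
  lowOrder-weaken {f} {k} {c} (lowOrder Q q) = lowOrder (c ∷ Q) λ t → begin
    f t                                                ≡⟨ q t ⟩
    toℚ (t ℕ.* t ^ k) * evalPoly (c ∷ Q) (toℚ t)       ≡⟨ cong (_* evalPoly (c ∷ Q) (toℚ t)) (toℚ-* t (t ^ k)) ⟩
    toℚ t * toℚ (t ^ k) * evalPoly (c ∷ Q) (toℚ t)
      ≡⟨ solve 3 (λ x m e → x :* m :* e := m :* (con 0ℚ :+ x :* e)) refl (toℚ t) (toℚ (t ^ k)) (evalPoly (c ∷ Q) (toℚ t)) ⟩
    toℚ (t ^ k) * evalPoly (0ℚ ∷ c ∷ Q) (toℚ t)        ∎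
    where open ≡-Reasoning

  lowOrder-alt : ∀ {A : Set} {f : ℕ → A → List A → ℚ} {g : A → List A → ℚ} {k} as →
    (∀ ps a qs → as ≡ ps ++ a ∷ qs → LowOrder (λ t → f t a (ps ++ qs)) k (g a (ps ++ qs))) →
    LowOrder (λ t → alt (f t) as) k (alt g as)
  lowOrder-alt {k = k} []       h = lowOrder-zero k
  lowOrder-alt {k = k} (a ∷ as) h = lowOrder-- {k = k} (h [] a as refl) (lowOrder-alt as λ ps a′ qs e → h (a ∷ ps) a′ qs (cong (a ∷_) e))

  -- Each term of the determinant takes one entry from every row, so the orders of the rows add up
  -- and the coefficients form a determinant of their own.
  lowOrder-det : ∀ {A : Set} (F : ℕ → A → Row) (p : A → Bool) (C : A → Row) cs as →
    (∀ {a c} → c ∈ cs → LowOrder (λ t → F t a c) (bit (p a)) (C a c)) →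
    LowOrder (λ t → det cs (map (F t) as)) (count p as) (det cs (map C as))
  lowOrder-det F p C [] []       h = lowOrder-const 1ℚ
  lowOrder-det F p C [] (a ∷ as) h = lowOrder-zero (count p (a ∷ as))
  lowOrder-det F p C (c ∷ cs) as h =
    lowOrder-cong {k = count p as} (λ t → det-map c cs (F t) as) (sym (det-map c cs C as)) (lowOrder-alt as step)
    where
    step : ∀ ps a qs → as ≡ ps ++ a ∷ qs →
      LowOrder (λ t → F t a c * det cs (map (F t) (ps ++ qs))) (count p as) (C a c * det cs (map C (ps ++ qs)))
    step ps a qs refl = subst (λ k → LowOrder (λ t → F t a c * det cs (map (F t) (ps ++ qs))) k (C a c * det cs (map C (ps ++ qs))))
      (sym (count-insert p ps a qs))
      (lowOrder-* {k = bit (p a)} (h (here refl)) (lowOrder-det F p C cs (ps ++ qs) (h ∘ there)))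

  -- h t n is the complete homogeneous symmetric function h_n(1^t).
  h : ℕ → ℕ → ℚ
  h zero    zero    = 1ℚ
  h zero    (suc n) = 0ℚ
  h (suc t) zero    = 1ℚ
  h (suc t) (suc n) = h (suc t) n + h t (suc n)

  h-zero : ∀ t → h t 0 ≡ 1ℚ
  h-zero zero    = refl
  h-zero (suc t) = refl

  toℚ-suc : ∀ n → toℚ (suc n) ≡ 1ℚ + toℚ n
  toℚ-suc n = toℚ-+ 1 n

  -- The ratio of consecutive binomial coefficients, as `h t n` is t + n - 1 choose n. It gives a
  -- recursion in n with t fixed, from which the polynomial dependence on t can be read off.
  h-step : ∀ t n → toℚ (suc n) * h t (suc n) ≡ toℚ (t ℕ.+ n) * h t n
  h-step zero zero = refl
  h-step zero (suc n) = trans (ℚP.*-zeroʳ (toℚ (suc (suc n)))) (sym (ℚP.*-zeroʳ (toℚ (suc n))))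
  h-step (suc t) zero = begin
    1ℚ * (1ℚ + h t 1)                  ≡⟨ solve 1 (λ x → con 1ℚ :* (con 1ℚ :+ x) := con 1ℚ :+ con 1ℚ :* x) refl (h t 1) ⟩
    1ℚ + toℚ 1 * h t 1                 ≡⟨ cong (1ℚ +_) (h-step t 0) ⟩
    1ℚ + toℚ (t ℕ.+ 0) * h t 0         ≡⟨ cong (λ y → 1ℚ + toℚ (t ℕ.+ 0) * y) (h-zero t) ⟩
    1ℚ + toℚ (t ℕ.+ 0) * 1ℚ            ≡⟨ solve 1 (λ x → con 1ℚ :+ x :* con 1ℚ := (con 1ℚ :+ x) :* con 1ℚ) refl (toℚ (t ℕ.+ 0)) ⟩
    (1ℚ + toℚ (t ℕ.+ 0)) * 1ℚ          ≡⟨ cong (_* 1ℚ) (toℚ-suc (t ℕ.+ 0)) ⟨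
    toℚ (suc (t ℕ.+ 0)) * 1ℚ           ∎
    where open ≡-Reasoning
  h-step (suc t) (suc m) = begin
    toℚ (suc n) * (H + h t (suc n))
      ≡⟨ ℚP.*-distribˡ-+ (toℚ (suc n)) H (h t (suc n)) ⟩
    toℚ (suc n) * H + toℚ (suc n) * h t (suc n)
      ≡⟨ cong₂ (λ x y → x * H + y) (toℚ-suc n) (h-step t n) ⟩
    (1ℚ + toℚ n) * H + s * h t n
      ≡⟨ solve 4 (λ n H s x → (con 1ℚ :+ n) :* H :+ s :* x := n :* H :+ H :+ s :* x) refl (toℚ n) H s (h t n) ⟩
    toℚ n * H + H + s * h t n
      ≡⟨ cong (λ x → x + H + s * h t n) (h-step (suc t) m) ⟩
    toℚ (suc t ℕ.+ m) * h (suc t) m + H + s * h t n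
      ≡⟨ cong (λ k → toℚ k * h (suc t) m + H + s * h t n) (sym (ℕP.+-suc t m)) ⟩
    s * h (suc t) m + (h (suc t) m + h t n) + s * h t n
      ≡⟨ solve 3 (λ s x y → s :* x :+ (x :+ y) :+ s :* y := (con 1ℚ :+ s) :* (x :+ y)) refl s (h (suc t) m) (h t n) ⟩
    (1ℚ + s) * H
      ≡⟨ cong (_* H) (toℚ-suc (t ℕ.+ n)) ⟨
    toℚ (suc t ℕ.+ n) * H ∎
    where
    open ≡-Reasoning
    n = suc m
    H = h (suc t) n
    s = toℚ (t ℕ.+ n)

  -- In closed form the function is t (t + 1) ... (t + n) / (n + 1)!, and its coefficient of t is n!
  -- / (n + 1)!.
  lowOrder-h : ∀ n → LowOrder (λ t → h t (suc n)) 1 (recip (suc n))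
  lowOrder-h zero = lowOrder [] λ t → begin
    h t 1                              ≡⟨ ℚP.*-identityˡ (h t 1) ⟨
    toℚ 1 * h t 1                      ≡⟨ h-step t 0 ⟩
    toℚ (t ℕ.+ 0) * h t 0              ≡⟨ cong₂ (λ m x → toℚ m * x) (trans (ℕP.+-identityʳ t) (sym (ℕP.*-identityʳ t))) (h-zero t) ⟩
    toℚ (t ^ 1) * 1ℚ                   ≡⟨ solve 2 (λ m x → m :* con 1ℚ := m :* (con 1ℚ :+ x :* con 0ℚ)) refl (toℚ (t ^ 1)) (toℚ t) ⟩
    toℚ (t ^ 1) * (1ℚ + toℚ t * 0ℚ)    ∎
    where open ≡-Reasoning
  lowOrder-h (suc n) = lowOrder-cong {k = 1} eq coeff
    (lowOrder-* {k = 0} (lowOrder-const r) (lowOrder-* {k = 0} {l = 1} linear (lowOrder-h n)))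
    where
    open ≡-Reasoning
    r = recip (suc (suc n))
    linear : LowOrder (λ t → toℚ (t ℕ.+ suc n)) 0 (toℚ (suc n))
    linear = lowOrder (1ℚ ∷ []) λ t → trans (toℚ-+ t (suc n))
      (solve 2 (λ x c → x :+ c := con 1ℚ :* (c :+ x :* (con 1ℚ :+ x :* con 0ℚ))) refl (toℚ t) (toℚ (suc n)))
    eq : ∀ t → h t (suc (suc n)) ≡ r * (toℚ (t ℕ.+ suc n) * h t (suc n))
    eq t = begin
      h t (suc (suc n))                              ≡⟨ ℚP.*-identityˡ _ ⟨
      1ℚ * h t (suc (suc n))                         ≡⟨ cong (_* h t (suc (suc n))) (toℚ-recip {suc (suc n)} (s≤s z≤n)) ⟨
      toℚ (suc (suc n)) * r * h t (suc (suc n))      ≡⟨ solve 3 (λ a r x → a :* r :* x := r :* (a :* x)) refl (toℚ (suc (suc n))) r (h t (suc (suc n))) ⟩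
      r * (toℚ (suc (suc n)) * h t (suc (suc n)))    ≡⟨ cong (r *_) (h-step t (suc n)) ⟩
      r * (toℚ (t ℕ.+ suc n) * h t (suc n))          ∎
    coeff : r * (toℚ (suc n) * recip (suc n)) ≡ r
    coeff = trans (cong (r *_) (toℚ-recip {suc n} (s≤s z≤n))) (ℚP.*-identityʳ r)

  -- The test encodes that h vanishes at negative indices; truncated subtraction alone would yield
  -- h₀ = 1 there.
  hRow : ℕ → ℕ → Row
  hRow t a b = if b ≤ᵇ a then h t (a ∸ b) else 0ℚ

  hRow-≥ : ∀ t {a b} → b ℕ.≤ a → hRow t a b ≡ h t (a ∸ b)
  hRow-≥ t b≤a rewrite ≤ᵇ-true b≤a = refl

  hRow-< : ∀ t {a b} → a ℕ.< b → hRow t a b ≡ 0ℚ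
  hRow-< t a<b rewrite ≤ᵇ-false a<b = refl

  hRow-≡ : ∀ t a → hRow t a a ≡ 1ℚ
  hRow-≡ t a = trans (hRow-≥ t (ℕP.≤-refl {a})) (trans (cong (h t) (ℕP.n∸n≡0 a)) (h-zero t))

  lowOrder-hRow-> : ∀ {a b} → b ℕ.< a → LowOrder (λ t → hRow t a b) 1 (cauchy a b)
  lowOrder-hRow-> {a} {b} b<a = lowOrder-cong {k = 1} (λ t → hRow-≥ t (ℕP.<⇒≤ b<a)) refl (positive-degree (ℕP.m<n⇒0<n∸m b<a))
    where
    positive-degree : ∀ {d} → 0 ℕ.< d → LowOrder (λ t → h t d) 1 (recip d)
    positive-degree {suc d} _ = lowOrder-h d

  outside : List ℕ → ℕ → Bool
  outside bs a = not (does (a ∈? bs))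

  lowOrder-hRow : ∀ bs {a b} → b ∈ bs → LowOrder (λ t → hRow t a b) (bit (outside bs a)) (leading bs a b)
  lowOrder-hRow bs {a} {b} b∈bs with a ∈? bs | ℕP.<-cmp a b
  ... | yes _   | tri< a<b a≢b _ = lowOrder-cong {k = 0} (λ t → hRow-< t a<b) (sym (unit-≢ a b a≢b)) (lowOrder-zero 0)
  ... | yes _   | tri≈ _ refl _  = lowOrder-cong {k = 0} (λ t → hRow-≡ t a) (sym (unit-≡ a)) (lowOrder-const 1ℚ)
  -- The row has order 0 because of its entry 1, so an entry of order 1 enters it with coefficient
  -- 0.
  ... | yes _   | tri> _ a≢b b<a = lowOrder-cong {k = 0} (λ _ → refl) (sym (unit-≢ a b a≢b)) (lowOrder-weaken (lowOrder-hRow-> b<a))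
  ... | no _    | tri< a<b _ _   = lowOrder-cong {k = 1} (λ t → hRow-< t a<b) (sym (cauchy-zero (ℕP.<⇒≤ a<b))) (lowOrder-zero 1)
  ... | no a∉bs | tri≈ _ refl _  = contradiction b∈bs a∉bs
  ... | no _    | tri> _ _ b<a   = lowOrder-hRow-> b<a

  -- Integrality and the uniqueness of the lowest coefficient.

  IsInteger : ℚ → Set
  IsInteger x = Σ ℤ λ z → x ≡ z ℚ./ 1

  toℚᵘ-/1 : ∀ z → toℚᵘ (z ℚ./ 1) ℚᵘ.≃ ℚᵘ.mkℚᵘ z 0
  toℚᵘ-/1 z = ℚP.toℚᵘ-fromℚᵘ (ℚᵘ.mkℚᵘ z 0)

  /1-+ : ∀ y z → (y ℤ.+ z) ℚ./ 1 ≡ (y ℚ./ 1) + (z ℚ./ 1)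
  /1-+ y z = ℚP.toℚᵘ-injective (begin
    toℚᵘ ((y ℤ.+ z) ℚ./ 1)                     ≈⟨ toℚᵘ-/1 (y ℤ.+ z) ⟩
    ℚᵘ.mkℚᵘ (y ℤ.+ z) 0                        ≈⟨ ℚᵘ.*≡* (cong (ℤ._* ℤ.+ 1) (cong₂ ℤ._+_ (sym (ℤP.*-identityʳ y)) (sym (ℤP.*-identityʳ z)))) ⟩
    ℚᵘ.mkℚᵘ y 0 ℚᵘ.+ ℚᵘ.mkℚᵘ z 0               ≈⟨ ℚᵘP.+-cong (toℚᵘ-/1 y) (toℚᵘ-/1 z) ⟨
    toℚᵘ (y ℚ./ 1) ℚᵘ.+ toℚᵘ (z ℚ./ 1)         ≈⟨ ℚP.toℚᵘ-homo-+ (y ℚ./ 1) (z ℚ./ 1) ⟨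
    toℚᵘ ((y ℚ./ 1) + (z ℚ./ 1))                   ∎)
    where open ℚᵘP.≃-Reasoning

  /1-* : ∀ y z → (y ℤ.* z) ℚ./ 1 ≡ (y ℚ./ 1) * (z ℚ./ 1)
  /1-* y z = ℚP.toℚᵘ-injective (begin
    toℚᵘ ((y ℤ.* z) ℚ./ 1)                     ≈⟨ toℚᵘ-/1 (y ℤ.* z) ⟩
    ℚᵘ.mkℚᵘ y 0 ℚᵘ.* ℚᵘ.mkℚᵘ z 0               ≈⟨ ℚᵘP.*-cong (toℚᵘ-/1 y) (toℚᵘ-/1 z) ⟨
    toℚᵘ (y ℚ./ 1) ℚᵘ.* toℚᵘ (z ℚ./ 1)         ≈⟨ ℚP.toℚᵘ-homo-* (y ℚ./ 1) (z ℚ./ 1) ⟨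
    toℚᵘ ((y ℚ./ 1) * (z ℚ./ 1))                   ∎)
    where open ℚᵘP.≃-Reasoning

  /1-injective : ∀ {y z} → y ℚ./ 1 ≡ z ℚ./ 1 → y ≡ z
  /1-injective {y} {z} e with ℚᵘP.≃-trans (ℚᵘP.≃-sym (toℚᵘ-/1 y)) (ℚᵘP.≃-trans (ℚᵘP.≃-reflexive (cong toℚᵘ e)) (toℚᵘ-/1 z))
  ... | ℚᵘ.*≡* eq = ℤP.*-cancelʳ-≡ y z (ℤ.+ 1) eq

  isInteger-+ : ∀ {x y} → IsInteger x → IsInteger y → IsInteger (x + y)
  isInteger-+ (m , refl) (n , refl) = m ℤ.+ n , sym (/1-+ m n)

  isInteger-* : ∀ {x y} → IsInteger x → IsInteger y → IsInteger (x * y)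
  isInteger-* (m , refl) (n , refl) = m ℤ.* n , sym (/1-* m n)

  isInteger-toℚ : ∀ n → IsInteger (toℚ n)
  isInteger-toℚ n = ℤ.+ n , refl

  denominator : ∀ x → Σ ℕ λ d → 0 ℕ.< d × IsInteger (toℚ d * x)
  denominator x@(mkℚ n d-1 _) = suc d-1 , s≤s z≤n , n , ℚP.toℚᵘ-injective (begin
    toℚᵘ (toℚ (suc d-1) * x)                       ≈⟨ ℚP.toℚᵘ-homo-* (toℚ (suc d-1)) x ⟩
    toℚᵘ (toℚ (suc d-1)) ℚᵘ.* ℚᵘ.mkℚᵘ n d-1        ≈⟨ ℚᵘP.*-cong (toℚᵘ-toℚ (suc d-1)) ℚᵘP.≃-refl ⟩
    ℚᵘ.mkℚᵘ (ℤ.+ suc d-1) 0 ℚᵘ.* ℚᵘ.mkℚᵘ n d-1     ≈⟨ ℚᵘ.*≡* (trans (ℤP.*-identityʳ (ℤ.+ suc d-1 ℤ.* n))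
                                                        (trans (ℤP.*-comm (ℤ.+ suc d-1) n) (cong (λ k → n ℤ.* ℤ.+ suc k) (sym (ℕP.+-identityʳ d-1))))) ⟩
    ℚᵘ.mkℚᵘ n 0                                    ≈⟨ toℚᵘ-/1 n ⟨
    toℚᵘ (n ℚ./ 1)                                 ∎)
    where open ℚᵘP.≃-Reasoning

  commonDenominator : ∀ p → Σ ℕ λ d → 0 ℕ.< d × ∀ t → IsInteger (toℚ d * evalPoly p (toℚ t))
  commonDenominator [] = 1 , s≤s z≤n , λ t → ℤ.+ 0 , refl
  commonDenominator (c ∷ p) with denominator c | commonDenominator p
  ... | d , d>0 , i | e , e>0 , j = d ℕ.* e , ℕP.*-mono-≤ d>0 e>0 , λ t → subst IsInteger (eq t)
          (isInteger-+ (isInteger-* (isInteger-toℚ e) i) (isInteger-* (isInteger-toℚ d) (isInteger-* (isInteger-toℚ t) (j t))))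
    where
    eq : ∀ t → toℚ e * (toℚ d * c) + toℚ d * (toℚ t * (toℚ e * evalPoly p (toℚ t))) ≡ toℚ (d ℕ.* e) * (c + toℚ t * evalPoly p (toℚ t))
    eq t rewrite toℚ-* d e = solve 5 (λ d e c x p → e :* (d :* c) :+ d :* (x :* (e :* p)) := d :* e :* (c :+ x :* p)) refl
      (toℚ d) (toℚ e) c (toℚ t) (evalPoly p (toℚ t))

  *-cancel-pos : ∀ {m x y} → 0ℚ < m → m * x ≡ m * y → x ≡ y
  *-cancel-pos {m} m>0 e = ℚP.≤-antisym
    (ℚP.*-cancelˡ-≤-pos m {{ℚ.positive m>0}} (ℚP.≤-reflexive e))
    (ℚP.*-cancelˡ-≤-pos m {{ℚ.positive m>0}} (ℚP.≤-reflexive (sym e)))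

  ^-pos : ∀ t k → 0 ℕ.< suc t ^ k
  ^-pos t k = ℕ.>-nonZero⁻¹ (suc t ^ k) {{ℕP.m^n≢0 (suc t) k}}

  -- After clearing denominators, c = t P(t) for all t ≥ 1 makes a fixed integer divisible by all t ≥ 1.
  constantTerm-zero : ∀ c P → (∀ t → c ≡ toℚ (suc t) * evalPoly P (toℚ (suc t))) → c ≡ 0ℚ
  constantTerm-zero c P hyp with denominator c | commonDenominator P
  ... | d , d>0 , z , dc | e , e>0 , int with int (suc ℤ.∣ ℤ.+ e ℤ.* z ∣)
  -- The case split above is evaluated at t = |Z| + 1, where Z is the fixed integer e z: a multiple
  -- of a number exceeding |Z| can equal Z only if Z = 0.
  ...   | w , ew = *-cancel-pos (toℚ-pos (ℕP.*-mono-≤ e>0 d>0))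
            (trans (trans (cong (_* c) (toℚ-* e d)) (trans (ℚP.*-assoc (toℚ e) (toℚ d) c) ez))
              (trans (cong (ℚ._/ 1) Z≡0) (sym (ℚP.*-zeroʳ (toℚ (e ℕ.* d))))))
    where
    open ≡-Reasoning
    Z = ℤ.+ e ℤ.* z
    t = suc ℤ.∣ Z ∣
    ez : toℚ e * (toℚ d * c) ≡ Z ℚ./ 1
    ez = trans (cong (toℚ e *_) dc) (sym (/1-* (ℤ.+ e) z))
    divisible : Z ≡ ℤ.+ (d ℕ.* t) ℤ.* w
    divisible = /1-injective (begin
      Z ℚ./ 1                                          ≡⟨ ez ⟨
      toℚ e * (toℚ d * c)                              ≡⟨ cong (λ x → toℚ e * (toℚ d * x)) (hyp ℤ.∣ Z ∣) ⟩
      toℚ e * (toℚ d * (toℚ t * evalPoly P (toℚ t)))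
        ≡⟨ solve 4 (λ e d t p → e :* (d :* (t :* p)) := d :* t :* (e :* p)) refl (toℚ e) (toℚ d) (toℚ t) (evalPoly P (toℚ t)) ⟩
      toℚ d * toℚ t * (toℚ e * evalPoly P (toℚ t))     ≡⟨ cong₂ _*_ (sym (toℚ-* d t)) ew ⟩
      toℚ (d ℕ.* t) * (w ℚ./ 1)                        ≡⟨ /1-* (ℤ.+ (d ℕ.* t)) w ⟨
      (ℤ.+ (d ℕ.* t) ℤ.* w) ℚ./ 1                      ∎)
    ∣Z∣≡ : ℤ.∣ Z ∣ ≡ d ℕ.* t ℕ.* ℤ.∣ w ∣
    ∣Z∣≡ = trans (cong ℤ.∣_∣ divisible) (ℤP.abs-* (ℤ.+ (d ℕ.* t)) w)
    w-zero : ∀ n → ℤ.∣ Z ∣ ≡ d ℕ.* t ℕ.* n → ℤ.∣ Z ∣ ≡ 0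
    w-zero zero    eq = trans eq (ℕP.*-zeroʳ (d ℕ.* t))
    w-zero (suc n) eq = contradiction (ℕP.*-mono-≤ (ℕP.*-mono-≤ d>0 (ℕP.≤-refl {t})) (s≤s (z≤n {n})))
      (ℕP.<⇒≱ (subst₂ ℕ._<_ eq (sym (trans (ℕP.*-identityʳ _) (ℕP.+-identityʳ t))) (ℕP.n<1+n ℤ.∣ Z ∣)))
    Z≡0 : Z ≡ ℤ.+ 0
    Z≡0 = ℤP.∣i∣≡0⇒i≡0 (w-zero ℤ.∣ w ∣ ∣Z∣≡)

  -- At t ≥ 1 the factor t^k cancels between the two expansions, which leaves `c` equal to t times a
  -- polynomial value for all those t.
  lowOrder-sharp : ∀ {f k c} → LowOrder f k c → c ≢ 0ℚ →
    (Σ (List ℚ) λ Q → ∀ t → f t ≡ toℚ (t ^ suc k) * evalPoly Q (toℚ t)) → ⊥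
  lowOrder-sharp {f} {k} {c} (lowOrder P p) c≢0 (Q , q) = c≢0 (constantTerm-zero c (Q +ₚ scaleₚ (- 1ℚ) P) λ n →
    let t = suc n; x = toℚ t; m = toℚ (t ^ k); u = evalPoly P x; v = evalPoly Q x
        cancelled : c + x * u ≡ x * v
        cancelled = *-cancel-pos (toℚ-pos (^-pos n k)) (begin
          m * (c + x * u)          ≡⟨ p t ⟨
          f t                      ≡⟨ q t ⟩
          toℚ (t ℕ.* t ^ k) * v    ≡⟨ cong (_* v) (toℚ-* t (t ^ k)) ⟩
          x * m * v                ≡⟨ solve 3 (λ x m v → x :* m :* v := m :* (x :* v)) refl x m v ⟩
          m * (x * v)              ∎)
    in begin
    c                              ≡⟨ solve 2 (λ c y → c := c :+ y :- y) refl c (x * u) ⟩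
    c + x * u - x * u              ≡⟨ cong (_- x * u) cancelled ⟩
    x * v - x * u                  ≡⟨ solve 3 (λ x u v → x :* v :- x :* u := x :* (v :+ con (- 1ℚ) :* u)) refl x u v ⟩
    x * (v + (- 1ℚ) * u)           ≡⟨ cong (x *_) (trans (evalPoly-+ Q _ x) (cong (v +_) (evalPoly-scale (- 1ℚ) P x))) ⟨
    x * evalPoly (Q +ₚ scaleₚ (- 1ℚ) P) x ∎)
    where open ≡-Reasoning

-- The Jacobi-Trudi identity for chains of horizontal strips.

module JacobiTrudi where

  open Determinants
  open RestrictedCauchy
  open LowestOrderTerms
  open import Data.Rational using (_+_; _*_)
  open import Data.Rational.Solver using (module +-*-Solver)
  open +-*-Solver using (solve; _:=_; _:+_; _:*_; con)

  row : List ℕ → ℕ → ℕ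
  row xs i = rowLen xs (suc i)

  WeaklyDecreasing : List ℕ → Set
  WeaklyDecreasing xs = ∀ i → row xs (suc i) ℕ.≤ row xs i

  weaklyDecreasing-≤ : ∀ {xs} → WeaklyDecreasing xs → ∀ {i j} → i ℕ.≤ j → row xs j ℕ.≤ row xs i
  weaklyDecreasing-≤ {xs} d {i} {j} i≤j = go (ℕP.≤⇒≤′ i≤j)
    where
    go : ∀ {j} → i ℕ.≤′ j → row xs j ℕ.≤ row xs i
    go ℕ.≤′-refl     = ℕP.≤-refl
    go (ℕ.≤′-step p) = ℕP.≤-trans (d _) (go p)

  -- λ_i - i, shifted by the number of rows to stay in ℕ.
  stair : List ℕ → List ℕ
  stair []       = []
  stair (x ∷ xs) = x ℕ.+ length xs ∷ stair xs

  length-stair : ∀ xs → length (stair xs) ≡ length xs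
  length-stair []       = refl
  length-stair (x ∷ xs) = cong suc (length-stair xs)

  stair-bound : ∀ {m} xs → (∀ i → row xs i ℕ.≤ m) → All (ℕ._< m ℕ.+ length xs) (stair xs)
  stair-bound []       h = []
  stair-bound {m} (x ∷ xs) h = ℕP.+-mono-≤-< (h 0) (ℕP.n<1+n (length xs))
    ∷ All.map (λ {z} lt → ℕP.<-≤-trans lt (ℕP.+-monoʳ-≤ m (ℕP.n≤1+n (length xs)))) (stair-bound xs (h ∘ suc))

  stair-decreasing : ∀ xs → WeaklyDecreasing xs → Decreasing (stair xs)
  stair-decreasing []       d = []
  stair-decreasing (x ∷ xs) d = stair-bound xs (λ i → weaklyDecreasing-≤ {x ∷ xs} d (z≤n {suc i})) ∷ stair-decreasing xs (d ∘ suc)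

  stair-injective : ∀ xs ys → length xs ≡ length ys → stair xs ≡ stair ys → xs ≡ ys
  stair-injective []       []       _   _ = refl
  stair-injective (x ∷ xs) (y ∷ ys) len e with ∷-injective e
  ... | e₁ , e₂ = cong₂ _∷_
    (ℕP.+-cancelʳ-≡ (length xs) x y (trans e₁ (cong (y ℕ.+_) (sym (ℕP.suc-injective len)))))
    (stair-injective xs ys (ℕP.suc-injective len) e₂)

  -- Containment of the diagrams enters here: an entry of `stair xs` that is at most `v` has an
  -- entry of `stair ys` beneath it in the same place.
  stair-ballot : ∀ xs ys → length xs ≡ length ys → (∀ i → row ys i ℕ.≤ row xs i) → Ballot (stair xs) (stair ys)
  stair-ballot []       []       _   _ v = z≤n
  stair-ballot (x ∷ xs) (y ∷ ys) len h v = ℕP.+-mono-≤ bits (stair-ballot xs ys (ℕP.suc-injective len) (h ∘ suc) v)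
    where
    bits : bit (x ℕ.+ length xs ≤ᵇ v) ℕ.≤ bit (y ℕ.+ length ys ≤ᵇ v)
    bits with x ℕ.+ length xs ≤ᵇ v in eq
    ... | false = z≤n
    ... | true rewrite ≤ᵇ-true (ℕP.≤-trans (ℕP.+-mono-≤ (h 0) (ℕP.≤-reflexive (sym (ℕP.suc-injective len)))) (≤ᵇ-true⁻¹ {x ℕ.+ length xs} eq)) = ℕP.≤-refl

  from : ℕ → ℕ → List ℕ
  from m zero    = []
  from m (suc k) = m ∷ from (suc m) k

  interval : ℕ → ℕ → List ℕ
  interval m n = from m (suc n ∸ m)

  -- λ / ν is a horizontal strip if and only if λ_{i+1} ≤ ν_i ≤ λ_i for all i.
  strips : List ℕ → List (List ℕ)
  strips []       = [ [] ]
  strips (x ∷ xs) = concatMap (λ y → map (y ∷_) (strips xs)) (interval (row xs 0) x)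

  ∈-from⁻ : ∀ {m k y} → y ∈ from m k → m ℕ.≤ y × y ℕ.< m ℕ.+ k
  ∈-from⁻ {m} {suc k} (here refl) = ℕP.≤-refl , ℕP.m<m+n m (s≤s z≤n)
  ∈-from⁻ {m} {suc k} {y} (there i) with ∈-from⁻ i
  ... | p , q = ℕP.<⇒≤ p , subst (y ℕ.<_) (sym (ℕP.+-suc m k)) q

  ∈-from⁺ : ∀ {m k y} → m ℕ.≤ y → y ℕ.< m ℕ.+ k → y ∈ from m k
  ∈-from⁺ {m} {zero} {y} p q = contradiction (subst (y ℕ.<_) (ℕP.+-identityʳ m) q) (ℕP.≤⇒≯ p)
  ∈-from⁺ {m} {suc k} {y} p q with m ℕ.≟ y
  ... | yes refl = here refl
  ... | no m≢y   = there (∈-from⁺ (ℕP.≤∧≢⇒< p m≢y) (subst (y ℕ.<_) (ℕP.+-suc m k) q))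

  ∈-interval⁻ : ∀ {m n y} → y ∈ interval m n → m ℕ.≤ y × y ℕ.≤ n
  ∈-interval⁻ {m} {n} {y} i with ∈-from⁻ i
  ... | p , q with m ℕ.≤? suc n
  ...   | yes m≤ = p , ℕP.≤-pred (subst (y ℕ.<_) (ℕP.m+[n∸m]≡n m≤) q)
  ...   | no m≰  = contradiction (subst (y ℕ.<_) (trans (cong (m ℕ.+_) (ℕP.m≤n⇒m∸n≡0 (ℕP.<⇒≤ (ℕP.≰⇒> m≰)))) (ℕP.+-identityʳ m)) q) (ℕP.≤⇒≯ p)

  ∈-interval⁺ : ∀ {m n y} → m ℕ.≤ y → y ℕ.≤ n → y ∈ interval m n
  ∈-interval⁺ {m} {n} {y} p q = ∈-from⁺ p (subst (y ℕ.<_) (sym (ℕP.m+[n∸m]≡n (ℕP.≤-trans p (ℕP.≤-trans q (ℕP.n≤1+n n))))) (s≤s q))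

  record _∈Strips_ (ν λs : List ℕ) : Set where
    constructor strip
    field
      length≡ : length ν ≡ length λs
      lower   : ∀ i → row λs (suc i) ℕ.≤ row ν i
      upper   : ∀ i → row ν i ℕ.≤ row λs i
  open _∈Strips_ public

  strips-sound : ∀ λs {ν} → ν ∈ strips λs → ν ∈Strips λs
  strips-sound [] (here refl) = strip refl (λ _ → z≤n) (λ _ → z≤n)
  strips-sound (x ∷ xs) i with find (∈-concatMap⁻ (λ y → map (y ∷_) (strips xs)) {xs = interval (row xs 0) x} i)
  ... | y , y∈ , ν∈ with ∈-map⁻ (y ∷_) ν∈ | ∈-interval⁻ {row xs 0} {x} y∈
  ...   | ν , ν∈′ , refl | lo , up with strips-sound xs ν∈′
  ...     | strip len low upp = strip (cong suc len) (λ { zero → lo ; (suc i) → low i }) (λ { zero → up ; (suc i) → upp i })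

  strips-complete : ∀ λs {ν} → ν ∈Strips λs → ν ∈ strips λs
  strips-complete [] {[]} _ = here refl
  strips-complete (x ∷ xs) {y ∷ ν} (strip len low upp) = ∈-concatMap⁺ (λ y → map (y ∷_) (strips xs)) {xs = interval (row xs 0) x}
    (Any.map (λ { refl → ∈-map⁺ (y ∷_) (strips-complete xs (strip (ℕP.suc-injective len) (low ∘ suc) (upp ∘ suc))) })
      (∈-interval⁺ (low 0) (upp 0)))
  strips-complete [] {_ ∷ _} (strip () _ _)
  strips-complete (_ ∷ _) {[]} (strip () _ _)

  strip-weaklyDecreasing : ∀ {ν λs} → ν ∈Strips λs → WeaklyDecreasing ν
  strip-weaklyDecreasing s i = ℕP.≤-trans (upper s (suc i)) (lower s i)

  -- A chain of t horizontal strips from μs up to λs is listed downwards, without its top element λs.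
  chains : List ℕ → ℕ → List ℕ → List (List (List ℕ))
  chains μs zero λs with ≡-dec ℕ._≟_ λs μs
  ... | yes _ = [ [] ]
  ... | no _  = []
  chains μs (suc t) λs = concatMap (λ ν → map (ν ∷_) (chains μs t ν)) (strips λs)

  sumℚ : {A : Set} → (A → ℚ) → List A → ℚ
  sumℚ f []       = 0ℚ
  sumℚ f (x ∷ xs) = f x + sumℚ f xs

  module _ {A : Set} where

    sumℚ-cong : {f g : A → ℚ} → ∀ xs → (∀ {x} → x ∈ xs → f x ≡ g x) → sumℚ f xs ≡ sumℚ g xs
    sumℚ-cong []       h = refl
    sumℚ-cong (x ∷ xs) h = cong₂ _+_ (h (here refl)) (sumℚ-cong xs (h ∘ there))

    sumℚ-++ : (f : A → ℚ) → ∀ xs ys → sumℚ f (xs ++ ys) ≡ sumℚ f xs + sumℚ f ys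
    sumℚ-++ f []       ys = sym (ℚP.+-identityˡ _)
    sumℚ-++ f (x ∷ xs) ys = trans (cong (f x +_) (sumℚ-++ f xs ys)) (sym (ℚP.+-assoc (f x) (sumℚ f xs) (sumℚ f ys)))

    sumℚ-map : {B : Set} (f : A → ℚ) (g : B → A) → ∀ xs → sumℚ f (map g xs) ≡ sumℚ (f ∘ g) xs
    sumℚ-map f g []       = refl
    sumℚ-map f g (x ∷ xs) = cong (f (g x) +_) (sumℚ-map f g xs)

    sumℚ-concatMap : {B : Set} (f : A → ℚ) (g : B → List A) → ∀ xs → sumℚ f (concatMap g xs) ≡ sumℚ (λ x → sumℚ f (g x)) xs
    sumℚ-concatMap f g []       = refl
    sumℚ-concatMap f g (x ∷ xs) = trans (sumℚ-++ f (g x) (concatMap g xs)) (cong (sumℚ f (g x) +_) (sumℚ-concatMap f g xs))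

    length-concatMap : {B : Set} (g : B → List A) → ∀ xs → toℚ (length (concatMap g xs)) ≡ sumℚ (λ x → toℚ (length (g x))) xs
    length-concatMap g []       = refl
    length-concatMap g (x ∷ xs) = begin
      toℚ (length (g x ++ concatMap g xs))                   ≡⟨ cong toℚ (length-++ (g x)) ⟩
      toℚ (length (g x) ℕ.+ length (concatMap g xs))         ≡⟨ toℚ-+ (length (g x)) _ ⟩
      toℚ (length (g x)) + toℚ (length (concatMap g xs))     ≡⟨ cong (toℚ (length (g x)) +_) (length-concatMap g xs) ⟩
      sumℚ (λ x → toℚ (length (g x))) (x ∷ xs)               ∎
      where open ≡-Reasoning

  det-rowSum : ∀ {A : Set} cs ps (F : A → Row) qs ys (z r : Row) → (∀ c → z c ≡ r c + sumℚ (λ y → F y c) ys) →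
    det cs (ps ++ z ∷ qs) ≡ det cs (ps ++ r ∷ qs) + sumℚ (λ y → det cs (ps ++ F y ∷ qs)) ys
  det-rowSum cs ps F qs [] z r h = trans
    (det-rowLinear cs ps 0ℚ z r r qs λ {c} _ → trans (h c) (solve 1 (λ x → x :+ con 0ℚ := x :+ con 0ℚ :* x) refl (r c)))
    (solve 1 (λ x → x :+ con 0ℚ :* x := x :+ con 0ℚ) refl (det cs (ps ++ r ∷ qs)))
  det-rowSum cs ps F qs (y ∷ ys) z r h = begin
    det cs (ps ++ z ∷ qs)
      ≡⟨ det-rowLinear cs ps 1ℚ z z′ (F y) qs (λ {c} _ → trans (h c)
           (solve 3 (λ a b c → a :+ (b :+ c) := a :+ c :+ con 1ℚ :* b) refl (r c) (F y c) (sumℚ (λ y → F y c) ys))) ⟩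
    det cs (ps ++ z′ ∷ qs) + 1ℚ * det cs (ps ++ F y ∷ qs)
      ≡⟨ cong (_+ 1ℚ * det cs (ps ++ F y ∷ qs)) (det-rowSum cs ps F qs ys z′ r λ _ → refl) ⟩
    det cs (ps ++ r ∷ qs) + S + 1ℚ * det cs (ps ++ F y ∷ qs)
      ≡⟨ solve 3 (λ a b c → a :+ b :+ con 1ℚ :* c := a :+ (c :+ b)) refl (det cs (ps ++ r ∷ qs)) S (det cs (ps ++ F y ∷ qs)) ⟩
    det cs (ps ++ r ∷ qs) + (det cs (ps ++ F y ∷ qs) + S) ∎
    where
    open ≡-Reasoning
    z′ : Row
    z′ c = r c + sumℚ (λ y → F y c) ys
    S = sumℚ (λ y → det cs (ps ++ F y ∷ qs)) ys

  hRow-0 : ∀ t b → hRow (suc t) 0 b ≡ hRow t 0 b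
  hRow-0 t zero    = sym (h-zero t)
  hRow-0 t (suc b) = refl

  hRow-suc : ∀ t a b → hRow (suc t) (suc a) b ≡ hRow (suc t) a b + hRow t (suc a) b
  hRow-suc t a b with ℕP.<-cmp b (suc a)
  ... | tri< b<1+a _ _ = begin
    hRow (suc t) (suc a) b           ≡⟨ hRow-≥ (suc t) (ℕP.<⇒≤ b<1+a) ⟩
    h (suc t) (suc a ∸ b)            ≡⟨ cong (h (suc t)) (ℕP.+-∸-assoc 1 b≤a) ⟩
    h (suc t) (a ∸ b) + h t (suc (a ∸ b))
      ≡⟨ cong₂ _+_ (sym (hRow-≥ (suc t) b≤a)) (trans (cong (h t) (sym (ℕP.+-∸-assoc 1 b≤a))) (sym (hRow-≥ t (ℕP.<⇒≤ b<1+a)))) ⟩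
    hRow (suc t) a b + hRow t (suc a) b ∎
    where
    open ≡-Reasoning
    b≤a = ℕP.≤-pred b<1+a
  ... | tri≈ _ refl _ = trans (hRow-≡ (suc t) (suc a)) (trans (sym (ℚP.+-identityˡ 1ℚ))
          (cong₂ _+_ (sym (hRow-< (suc t) (ℕP.n<1+n a))) (sym (hRow-≡ t (suc a)))))
  ... | tri> _ _ 1+a<b = trans (hRow-< (suc t) 1+a<b) (sym (cong₂ _+_ (hRow-< (suc t) (ℕP.<-trans (ℕP.n<1+n a) 1+a<b)) (hRow-< t 1+a<b)))

  -- Iterates `hRow-suc`. The index is split so that, with `m` the next part and `l` the number of
  -- rows after it, `m + l` is the index of the next row of the matrix and `y + suc l` that of the
  -- current row once its part has become `y`.
  hRow-telescope : ∀ t m k l b →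
    hRow (suc t) (m ℕ.+ k ℕ.+ l) b ≡ hRow (suc t) (m ℕ.+ l) b + sumℚ (λ y → hRow t (y ℕ.+ suc l) b) (from m k)
  hRow-telescope t m zero l b = trans (cong (λ n → hRow (suc t) (n ℕ.+ l) b) (ℕP.+-identityʳ m)) (sym (ℚP.+-identityʳ _))
  hRow-telescope t m (suc k) l b = begin
    hRow (suc t) (m ℕ.+ suc k ℕ.+ l) b                        ≡⟨ cong (λ n → hRow (suc t) (n ℕ.+ l) b) (ℕP.+-suc m k) ⟩
    hRow (suc t) (suc m ℕ.+ k ℕ.+ l) b                        ≡⟨ hRow-telescope t (suc m) k l b ⟩
    hRow (suc t) (suc m ℕ.+ l) b + S                          ≡⟨ cong (_+ S) (hRow-suc t (m ℕ.+ l) b) ⟩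
    hRow (suc t) (m ℕ.+ l) b + hRow t (suc (m ℕ.+ l)) b + S   ≡⟨ ℚP.+-assoc (hRow (suc t) (m ℕ.+ l) b) _ S ⟩
    hRow (suc t) (m ℕ.+ l) b + (hRow t (suc (m ℕ.+ l)) b + S) ≡⟨ cong (λ n → hRow (suc t) (m ℕ.+ l) b + (hRow t n b + S)) (ℕP.+-suc m l) ⟨
    hRow (suc t) (m ℕ.+ l) b + (hRow t (m ℕ.+ suc l) b + S)   ∎
    where
    open ≡-Reasoning
    S = sumℚ (λ y → hRow t (y ℕ.+ suc l) b) (from (suc m) k)

  hRow-telescope₀ : ∀ t m k b → hRow (suc t) (m ℕ.+ k) b ≡ hRow (suc t) m b + sumℚ (λ y → hRow t (y ℕ.+ 0) b) (from (suc m) k)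
  hRow-telescope₀ t m zero b = trans (cong (λ n → hRow (suc t) n b) (ℕP.+-identityʳ m)) (sym (ℚP.+-identityʳ _))
  hRow-telescope₀ t m (suc k) b = begin
    hRow (suc t) (m ℕ.+ suc k) b                             ≡⟨ cong (λ n → hRow (suc t) n b) (ℕP.+-suc m k) ⟩
    hRow (suc t) (suc m ℕ.+ k) b                             ≡⟨ hRow-telescope₀ t (suc m) k b ⟩
    hRow (suc t) (suc m) b + S                               ≡⟨ cong (_+ S) (hRow-suc t m b) ⟩
    hRow (suc t) m b + hRow t (suc m) b + S                  ≡⟨ ℚP.+-assoc (hRow (suc t) m b) _ S ⟩
    hRow (suc t) m b + (hRow t (suc m) b + S)                ≡⟨ cong (λ n → hRow (suc t) m b + (hRow t n b + S)) (ℕP.+-identityʳ (suc m)) ⟨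
    hRow (suc t) m b + (hRow t (suc m ℕ.+ 0) b + S)          ∎
    where
    open ≡-Reasoning
    S = sumℚ (λ y → hRow t (y ℕ.+ 0) b) (from (suc (suc m)) k)

  -- Removal of one variable, row by row from the top, with the finished rows in `ps`. The
  -- telescoped row is a sum over y from λ_{i+1} to λ_i plus a remainder equal to the row below,
  -- which still has t + 1 variables; two equal adjacent rows kill the remainder. The ranges left
  -- for y are exactly those of a horizontal strip.
  det-hRow-suc : ∀ t cs ps λs → WeaklyDecreasing λs →
    det cs (ps ++ map (hRow (suc t)) (stair λs)) ≡ sumℚ (λ ν → det cs (ps ++ map (hRow t) (stair ν))) (strips λs)
  det-hRow-suc t cs ps [] d = sym (ℚP.+-identityʳ _)
  det-hRow-suc t cs ps (x ∷ xs) d = begin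
    det cs (ps ++ hRow (suc t) (x ℕ.+ length xs) ∷ rest)
      ≡⟨ firstRow xs d ⟩
    sumℚ (λ y → det cs (ps ++ hRow t (y ℕ.+ length xs) ∷ rest)) ys
      ≡⟨ sumℚ-cong ys (λ {y} _ → trans (cong (det cs) (sym (++-assoc ps [ hRow t (y ℕ.+ length xs) ] rest)))
           (trans (det-hRow-suc t cs (ps ++ [ hRow t (y ℕ.+ length xs) ]) xs (d ∘ suc))
             (sumℚ-cong (strips xs) λ {ν} ν∈ → cong (det cs) (trans (++-assoc ps [ hRow t (y ℕ.+ length xs) ] _)
               (cong (λ n → ps ++ hRow t (y ℕ.+ n) ∷ map (hRow t) (stair ν)) (sym (length≡ (strips-sound xs ν∈)))))))) ⟩
    sumℚ (λ y → sumℚ (λ ν → f (y ∷ ν)) (strips xs)) ys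
      ≡⟨ sumℚ-cong ys (λ {y} _ → sym (sumℚ-map f (y ∷_) (strips xs))) ⟩
    sumℚ (λ y → sumℚ f (map (y ∷_) (strips xs))) ys
      ≡⟨ sumℚ-concatMap f (λ y → map (y ∷_) (strips xs)) ys ⟨
    sumℚ f (strips (x ∷ xs)) ∎
    where
    open ≡-Reasoning
    rest = map (hRow (suc t)) (stair xs)
    ys   = interval (row xs 0) x
    f : List ℕ → ℚ
    f ν = det cs (ps ++ map (hRow t) (stair ν))
    firstRow : ∀ xs → WeaklyDecreasing (x ∷ xs) →
      det cs (ps ++ hRow (suc t) (x ℕ.+ length xs) ∷ map (hRow (suc t)) (stair xs)) ≡
      sumℚ (λ y → det cs (ps ++ hRow t (y ℕ.+ length xs) ∷ map (hRow (suc t)) (stair xs))) (interval (row xs 0) x)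
    -- The last row has no row below it. Its remainder is the row of index 0, which is the same for
    -- t and t + 1 variables and so supplies the term y = 0.
    firstRow [] _ = det-rowSum cs ps (λ y → hRow t (y ℕ.+ 0)) [] (from 1 x) (hRow (suc t) (x ℕ.+ 0)) (hRow t 0) λ c →
      trans (cong (λ n → hRow (suc t) n c) (ℕP.+-identityʳ x)) (trans (hRow-telescope₀ t 0 x c)
        (cong (_+ sumℚ (λ y → hRow t (y ℕ.+ 0) c) (from 1 x)) (hRow-0 t c)))
    firstRow (x′ ∷ xs′) d = begin
      det cs (ps ++ hRow (suc t) (x ℕ.+ suc l) ∷ rest′)
        ≡⟨ det-rowSum cs ps (λ y → hRow t (y ℕ.+ suc l)) rest′ (interval x′ x) (hRow (suc t) (x ℕ.+ suc l)) (hRow (suc t) (x′ ℕ.+ l))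
             (λ c → trans (cong (λ n → hRow (suc t) n c) index) (hRow-telescope t x′ (suc x ∸ x′) l c)) ⟩
      det cs (ps ++ hRow (suc t) (x′ ℕ.+ l) ∷ rest′) + S
        ≡⟨ cong (_+ S) (det-equalAdjacentRows cs ps (hRow (suc t) (x′ ℕ.+ l)) (map (hRow (suc t)) (stair xs′))) ⟩
      0ℚ + S
        ≡⟨ ℚP.+-identityˡ S ⟩
      S ∎
      where
      l = length xs′
      rest′ = map (hRow (suc t)) (stair (x′ ∷ xs′))
      S = sumℚ (λ y → det cs (ps ++ hRow t (y ℕ.+ suc l) ∷ rest′)) (interval x′ x)
      index : x ℕ.+ suc l ≡ x′ ℕ.+ (suc x ∸ x′) ℕ.+ l
      index = trans (ℕP.+-suc x l) (cong (ℕ._+ l) (sym (ℕP.m+[n∸m]≡n (ℕP.≤-trans (d 0) (ℕP.n≤1+n x)))))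

  hRow-zero-≢ : ∀ {a b} → a ≢ b → hRow 0 a b ≡ 0ℚ
  hRow-zero-≢ {a} {b} a≢b with ℕP.<-cmp a b
  ... | tri< a<b _ _ = hRow-< 0 a<b
  ... | tri≈ _ a≡b _ = contradiction a≡b a≢b
  ... | tri> _ _ b<a with a ∸ b | ℕP.m<n⇒0<n∸m b<a | hRow-≥ 0 (ℕP.<⇒≤ b<a)
  ...   | suc _ | _ | e = e

  hRow-zero : ∀ a b → hRow 0 a b ≡ unit a b
  hRow-zero a b with a ℕ.≟ b
  ... | yes refl = hRow-≡ 0 a
  ... | no a≢b   = hRow-zero-≢ a≢b

  det-hRow-zero-≡ : ∀ cs → Decreasing cs → det cs (map (hRow 0) cs) ≡ 1ℚ
  det-hRow-zero-≡ cs d = trans (det-map-cong cs cs λ {a} {c} _ _ → hRow-zero a c) (go cs d)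
    where
    go : ∀ cs → Decreasing cs → det cs (map unit cs) ≡ 1ℚ
    go [] _ = refl
    go (c ∷ cs) dec@(_ ∷ d) = trans (det-unitRow [] c cs (map unit cs) (λ ()) (decreasing-∉ [] dec))
      (trans (ℚP.*-identityˡ _) (go cs d))

  -- Compares the largest labels: if a < c the column of `c` is zero, if c < a the row of `a` is
  -- zero, and if they agree a unit row splits off.
  det-hRow-zero-≢ : ∀ as cs → length as ≡ length cs → Decreasing as → Decreasing cs → as ≢ cs → det cs (map (hRow 0) as) ≡ 0ℚ
  det-hRow-zero-≢ [] [] _ _ _ ne = contradiction refl ne
  det-hRow-zero-≢ (a ∷ as) (c ∷ cs) len (a> ∷ da) dc@(c> ∷ dc′) ne with ℕP.<-cmp a c
  ... | tri< a<c _ _ = trans (det-map c cs (hRow 0) (a ∷ as)) (alt-zero {f = λ r rest → hRow 0 r c * det cs (map (hRow 0) rest)} (a ∷ as) λ ps r qs e →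
          trans (cong (_* det cs (map (hRow 0) (ps ++ qs))) (hRow-< 0 (below (subst (r ∈_) (sym e) (∈-insert ps)))))
            (ℚP.*-zeroˡ (det cs (map (hRow 0) (ps ++ qs)))))
    where
    below : ∀ {r} → r ∈ a ∷ as → r ℕ.< c
    below (here refl) = a<c
    below (there i)   = ℕP.<-trans (All.lookup a> i) a<c
  ... | tri≈ _ refl _ = begin
    det (c ∷ cs) (map (hRow 0) (c ∷ as))   ≡⟨ det-map-cong (c ∷ cs) (c ∷ as) (λ {x} {y} _ _ → hRow-zero x y) ⟩
    det (c ∷ cs) (map unit (c ∷ as))       ≡⟨ det-unitRow [] c cs (map unit as) (λ ()) (decreasing-∉ [] dc) ⟩
    1ℚ * det cs (map unit as)              ≡⟨ ℚP.*-identityˡ _ ⟩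
    det cs (map unit as)                   ≡⟨ det-map-cong cs as (λ {x} {y} _ _ → hRow-zero x y) ⟨
    det cs (map (hRow 0) as)               ≡⟨ det-hRow-zero-≢ as cs (ℕP.suc-injective len) da dc′ (ne ∘ cong (c ∷_)) ⟩
    0ℚ                                     ∎
    where open ≡-Reasoning
  ... | tri> _ _ c<a = det-zeroRow (c ∷ cs) (hRow 0 a) (map (hRow 0) as) λ {x} i → hRow-zero-≢ {a} {x} λ { refl → ℕP.<-irrefl refl (above i) }
    where
    above : ∀ {x} → x ∈ c ∷ cs → x ℕ.< a
    above (here refl) = c<a
    above (there i)   = ℕP.<-trans (All.lookup c> i) c<a

  -- Both sides obey the same recursion over `strips λs`. With no variables the matrix consists of
  -- unit rows or zero rows, and its determinant tests whether λ and μ coincide.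
  jacobi-trudi : ∀ μs → WeaklyDecreasing μs → ∀ t λs → WeaklyDecreasing λs → length λs ≡ length μs →
    toℚ (length (chains μs t λs)) ≡ det (stair μs) (map (hRow t) (stair λs))
  jacobi-trudi μs dμ zero λs dλ len with ≡-dec ℕ._≟_ λs μs
  ... | yes refl = sym (det-hRow-zero-≡ (stair μs) (stair-decreasing μs dμ))
  ... | no λ≢μ   = sym (det-hRow-zero-≢ (stair λs) (stair μs) (trans (length-stair λs) (trans len (sym (length-stair μs))))
                     (stair-decreasing λs dλ) (stair-decreasing μs dμ) (λ≢μ ∘ stair-injective λs μs len))
  jacobi-trudi μs dμ (suc t) λs dλ len = begin
    toℚ (length (chains μs (suc t) λs))
      ≡⟨ length-concatMap (λ ν → map (ν ∷_) (chains μs t ν)) (strips λs) ⟩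
    sumℚ (λ ν → toℚ (length (map (ν ∷_) (chains μs t ν)))) (strips λs)
      ≡⟨ sumℚ-cong (strips λs) (λ {ν} ν∈ → let s = strips-sound λs ν∈ in
           trans (cong toℚ (length-map (ν ∷_) (chains μs t ν)))
             (jacobi-trudi μs dμ t ν (strip-weaklyDecreasing s) (trans (length≡ s) len))) ⟩
    sumℚ (λ ν → det (stair μs) (map (hRow t) (stair ν))) (strips λs)
      ≡⟨ det-hRow-suc t (stair μs) [] λs dλ ⟨
    det (stair μs) (map (hRow (suc t)) (stair λs)) ∎
    where open ≡-Reasoning

-- Semistandard tableaux as chains of horizontal strips.

module Tableaux where

  open Determinants
  open RestrictedCauchy
  open LowestOrderTerms
  open JacobiTrudi
  open import Data.Nat using (_+_; _≤_; _<_)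

  build : ℕ → (ℕ → ℕ) → List ℕ
  build zero    f = []
  build (suc n) f = f 0 ∷ build n (f ∘ suc)

  length-build : ∀ n f → length (build n f) ≡ n
  length-build zero    f = refl
  length-build (suc n) f = cong suc (length-build n (f ∘ suc))

  row-build : ∀ n f → (∀ {i} → n ≤ i → f i ≡ 0) → ∀ i → row (build n f) i ≡ f i
  row-build zero    f h i       = sym (h z≤n)
  row-build (suc n) f h zero    = refl
  row-build (suc n) f h (suc i) = row-build n (f ∘ suc) (h ∘ s≤s) i

  row-beyond : ∀ xs {i} → length xs ≤ i → row xs i ≡ 0
  row-beyond []       _                   = refl
  row-beyond (x ∷ xs) {suc i} (s≤s l) = row-beyond xs l

  row-extensional : ∀ xs ys → length xs ≡ length ys → (∀ i → row xs i ≡ row ys i) → xs ≡ ys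
  row-extensional []       []       _   _ = refl
  row-extensional (x ∷ xs) (y ∷ ys) len h = cong₂ _∷_ (h 0) (row-extensional xs ys (ℕP.suc-injective len) (h ∘ suc))

  -- The end of the longest run m+1, m+2, …, at most m+k, on which p holds.
  cut : (ℕ → Bool) → ℕ → ℕ → ℕ
  cut p m zero    = m
  cut p m (suc k) = if p (suc m) then cut p (suc m) k else m

  cut-lower : ∀ p m k → m ≤ cut p m k
  cut-lower p m zero = ℕP.≤-refl
  cut-lower p m (suc k) with p (suc m)
  ... | true  = ℕP.≤-trans (ℕP.n≤1+n m) (cut-lower p (suc m) k)
  ... | false = ℕP.≤-refl

  cut-upper : ∀ p m k → cut p m k ≤ m + k
  cut-upper p m zero = ℕP.≤-reflexive (sym (ℕP.+-identityʳ m))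
  cut-upper p m (suc k) with p (suc m)
  ... | true  = ℕP.≤-trans (cut-upper p (suc m) k) (ℕP.≤-reflexive (sym (ℕP.+-suc m k)))
  ... | false = ℕP.m≤m+n m (suc k)

  cut-holds : ∀ p m k {j} → m < j → j ≤ cut p m k → p j ≡ true
  cut-holds p m zero    m<j j≤ = contradiction j≤ (ℕP.<⇒≱ m<j)
  cut-holds p m (suc k) {j} m<j j≤ with p (suc m) in eq
  ... | false = contradiction j≤ (ℕP.<⇒≱ m<j)
  ... | true with ℕP.m≤n⇒m<n∨m≡n m<j
  ...   | inj₁ l    = cut-holds p (suc m) k l j≤
  ...   | inj₂ refl = eq

  cut-fails : ∀ p m k → cut p m k < m + k → p (suc (cut p m k)) ≡ false
  cut-fails p m zero    l = contradiction l (ℕP.<-irrefl (sym (ℕP.+-identityʳ m)))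
  cut-fails p m (suc k) l with p (suc m) in eq
  ... | true  = cut-fails p (suc m) k (subst (cut p (suc m) k <_) (ℕP.+-suc m k) l)
  ... | false = eq

  -- Rows are counted from 0 and columns from 1.
  Cell : List ℕ → List ℕ → ℕ → ℕ → Set
  Cell μs λs i j = row μs i < j × j ≤ row λs i

  record Semistandard (μs : List ℕ) (t : ℕ) (λs : List ℕ) (T : ℕ → ℕ → ℕ) : Set where
    field
      entry>0     : ∀ {i j} → Cell μs λs i j → 0 < T i j
      entry≤t     : ∀ {i j} → Cell μs λs i j → T i j ≤ t
      row-weak    : ∀ {i j j′} → Cell μs λs i j → Cell μs λs i j′ → j < j′ → T i j ≤ T i j′
      column-strict : ∀ {i i′ j} → Cell μs λs i j → Cell μs λs i′ j → i < i′ → T i j < T i′ j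
  open Semistandard

  -- The entry of a square is the step of the chain at which the square is added.
  tableau : List (List ℕ) → ℕ → ℕ → ℕ
  tableau []      i j = 0
  tableau (ν ∷ c) i j = if j ≤ᵇ row ν i then tableau c i j else suc (length c)

  tableau-old : ∀ ν c {i j} → j ≤ row ν i → tableau (ν ∷ c) i j ≡ tableau c i j
  tableau-old ν c {i} {j} l rewrite ≤ᵇ-true l = refl

  tableau-new : ∀ ν c {i j} → row ν i < j → tableau (ν ∷ c) i j ≡ suc (length c)
  tableau-new ν c {i} {j} l rewrite ≤ᵇ-false l = refl

  chains-zero⁻ : ∀ {μs λs c} → c ∈ chains μs 0 λs → λs ≡ μs × c ≡ []
  chains-zero⁻ {μs} {λs} i with ≡-dec ℕ._≟_ λs μs | i
  ... | yes eq | here refl = eq , refl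

  chains-zero⁺ : ∀ {μs λs} → λs ≡ μs → [] ∈ chains μs 0 λs
  chains-zero⁺ {μs} {λs} eq with ≡-dec ℕ._≟_ λs μs
  ... | yes _ = here refl
  ... | no ne = contradiction eq ne

  chains-suc⁻ : ∀ {μs t λs c} → c ∈ chains μs (suc t) λs →
    Σ (List ℕ) λ ν → Σ (List (List ℕ)) λ c′ → c ≡ ν ∷ c′ × ν ∈Strips λs × c′ ∈ chains μs t ν
  chains-suc⁻ {μs} {t} {λs} i with find (∈-concatMap⁻ (λ ν → map (ν ∷_) (chains μs t ν)) {xs = strips λs} i)
  ... | ν , ν∈ , j with ∈-map⁻ (ν ∷_) j
  ...   | c′ , c′∈ , eq = ν , c′ , eq , strips-sound λs ν∈ , c′∈

  chains-suc⁺ : ∀ {μs t λs ν c} → ν ∈Strips λs → c ∈ chains μs t ν → ν ∷ c ∈ chains μs (suc t) λs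
  chains-suc⁺ {μs} {t} {λs} {ν} s c∈ = ∈-concatMap⁺ (λ ν → map (ν ∷_) (chains μs t ν)) {xs = strips λs}
    (lose (strips-complete λs s) (∈-map⁺ (ν ∷_) c∈))

  chains-length : ∀ {μs} t {λs c} → c ∈ chains μs t λs → length c ≡ t
  chains-length zero    i with chains-zero⁻ i
  ... | _ , refl = refl
  chains-length {μs} (suc t) {λs} i with chains-suc⁻ {μs} {t} {λs} i
  ... | ν , c′ , refl , _ , c′∈ = cong suc (chains-length {μs} t {ν} c′∈)

  chains-bounded : ∀ {μs} t {λs c} → c ∈ chains μs t λs → ∀ i → row μs i ≤ row λs i
  chains-bounded zero    c∈ i with chains-zero⁻ c∈
  ... | refl , _ = ℕP.≤-refl
  chains-bounded {μs} (suc t) {λs} c∈ i with chains-suc⁻ {μs} {t} {λs} c∈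
  ... | ν , c′ , refl , s , c′∈ = ℕP.≤-trans (chains-bounded {μs} t {ν} c′∈ i) (upper s i)

  -- New squares carry the largest entry and end their rows, so rows stay weakly increasing. Columns
  -- stay strict because λ_{i+1} ≤ ν_i makes every square above a new one old.
  tableau-semistandard : ∀ {μs} t {λs c} → WeaklyDecreasing λs → c ∈ chains μs t λs → Semistandard μs t λs (tableau c)
  tableau-semistandard {μs} zero {λs} dλ c∈ with chains-zero⁻ c∈
  ... | refl , refl = record { entry>0 = none ; entry≤t = none ; row-weak = λ c _ _ → none c ; column-strict = λ c _ _ → none c }
    where
    none : ∀ {i j} {X : Set} → Cell μs μs i j → X
    none (l , u) = contradiction u (ℕP.<⇒≱ l)
  tableau-semistandard {μs} (suc t) {λs} dλ c∈ with chains-suc⁻ {μs} {t} {λs} c∈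
  ... | ν , c , refl , s , c∈′ = record { entry>0 = pos ; entry≤t = bounded ; row-weak = rows ; column-strict = columns }
    where
    IH = tableau-semistandard t (strip-weaklyDecreasing s) c∈′
    len : length c ≡ t
    len = chains-length {μs} t {ν} c∈′
    T = tableau (ν ∷ c)
    pos : ∀ {i j} → Cell μs λs i j → 0 < T i j
    pos {i} {j} (l , u) with j ℕ.≤? row ν i
    ... | yes j≤ = subst (0 <_) (sym (tableau-old ν c j≤)) (entry>0 IH (l , j≤))
    ... | no j≰  = subst (0 <_) (sym (tableau-new ν c (ℕP.≰⇒> j≰))) (s≤s z≤n)
    bounded : ∀ {i j} → Cell μs λs i j → T i j ≤ suc t
    bounded {i} {j} (l , u) with j ℕ.≤? row ν i
    ... | yes j≤ = subst (_≤ suc t) (sym (tableau-old ν c j≤)) (ℕP.m≤n⇒m≤1+n (entry≤t IH (l , j≤)))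
    ... | no j≰  = ℕP.≤-reflexive (trans (tableau-new ν c (ℕP.≰⇒> j≰)) (cong suc len))
    rows : ∀ {i j j′} → Cell μs λs i j → Cell μs λs i j′ → j < j′ → T i j ≤ T i j′
    rows {i} {j} {j′} p@(l , u) q@(l′ , u′) j<j′ with j′ ℕ.≤? row ν i
    ... | yes j′≤ = subst₂ _≤_ (sym (tableau-old ν c (ℕP.≤-trans (ℕP.<⇒≤ j<j′) j′≤))) (sym (tableau-old ν c j′≤))
                      (row-weak IH (l , ℕP.≤-trans (ℕP.<⇒≤ j<j′) j′≤) (l′ , j′≤) j<j′)
    ... | no j′≰  = ℕP.≤-trans (bounded p) (ℕP.≤-reflexive (sym (trans (tableau-new ν c (ℕP.≰⇒> j′≰)) (cong suc len))))
    columns : ∀ {i i′ j} → Cell μs λs i j → Cell μs λs i′ j → i < i′ → T i j < T i′ j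
    columns {i} {i′} {j} (l , u) (l′ , u′) i<i′ with j ℕ.≤? row ν i′
    ... | yes j≤ = subst₂ _<_ (sym (tableau-old ν c j≤ν)) (sym (tableau-old ν c j≤)) (column-strict IH (l , j≤ν) (l′ , j≤) i<i′)
      where
      j≤ν : j ≤ row ν i
      j≤ν = ℕP.≤-trans j≤ (weaklyDecreasing-≤ {ν} (strip-weaklyDecreasing s) (ℕP.<⇒≤ i<i′))
    ... | no j≰  = subst₂ _<_ (sym (tableau-old ν c j≤ν)) (sym (trans (tableau-new ν c (ℕP.≰⇒> j≰)) (cong suc len))) (s≤s (entry≤t IH (l , j≤ν)))
      where
      j≤ν : j ≤ row ν i
      j≤ν = ℕP.≤-trans u′ (ℕP.≤-trans (weaklyDecreasing-≤ {λs} dλ i<i′) (lower s i))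

  -- The top strip is read off the tableau: ν is the shape of the entries at most t. Weak increase
  -- along rows makes these entries an initial run of each row, which `cut` finds.
  semistandard-tableau : ∀ {μs} → WeaklyDecreasing μs → ∀ t {λs T} → WeaklyDecreasing λs → length λs ≡ length μs →
    (∀ i → row μs i ≤ row λs i) → Semistandard μs t λs T →
    Σ (List (List ℕ)) λ c → c ∈ chains μs t λs × (∀ {i j} → Cell μs λs i j → T i j ≡ tableau c i j)
  semistandard-tableau {μs} dμ zero {λs} {T} dλ len μ≤λ S = [] , chains-zero⁺ (row-extensional λs μs len λ i → ℕP.≤-antisym (λ≤μ i) (μ≤λ i)) , λ c → none c
    where
    none : ∀ {i j} {X : Set} → Cell μs λs i j → X
    none c = contradiction (entry≤t S c) (ℕP.<⇒≱ (entry>0 S c))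
    λ≤μ : ∀ i → row λs i ≤ row μs i
    λ≤μ i = ℕP.≮⇒≥ λ l → none {i} {row λs i} (l , ℕP.≤-refl)
  semistandard-tableau {μs} dμ (suc t) {λs} {T} dλ len μ≤λ S = ν ∷ c , chains-suc⁺ {μs} {t} {λs} s c∈ , agree
    where
    p : ℕ → ℕ → Bool
    p i j = T i j ≤ᵇ t
    gap : ℕ → ℕ
    gap i = row λs i ∸ row μs i
    f : ℕ → ℕ
    f i = cut (p i) (row μs i) (gap i)
    ν = build (length λs) f
    f≤λ : ∀ i → f i ≤ row λs i
    f≤λ i = ℕP.≤-trans (cut-upper (p i) (row μs i) (gap i)) (ℕP.≤-reflexive (ℕP.m+[n∸m]≡n (μ≤λ i)))
    row-ν : ∀ i → row ν i ≡ f i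
    row-ν = row-build (length λs) f λ {i} l → ℕP.n≤0⇒n≡0 (subst (f i ≤_) (row-beyond λs l) (f≤λ i))
    μ≤ν : ∀ i → row μs i ≤ row ν i
    μ≤ν i = subst (row μs i ≤_) (sym (row-ν i)) (cut-lower (p i) (row μs i) (gap i))
    -- Otherwise rows i and i + 1 both contain the square in column `f i + 1`; the upper entry
    -- exceeds t, so by strictness the lower one exceeds t + 1.
    λ≤f : ∀ i → row λs (suc i) ≤ f i
    λ≤f i = ℕP.≮⇒≥ λ l → let
      j = suc (f i)
      l′ = ℕP.≤-trans l (dλ i)
      μ<j : row μs i < j
      μ<j = s≤s (cut-lower (p i) (row μs i) (gap i))
      c = μ<j , l′
      c′ = ℕP.≤-<-trans (dμ i) μ<j , l
      big = ≤ᵇ-false⁻¹ {T i j} {t} (cut-fails (p i) (row μs i) (gap i) (subst (f i <_) (sym (ℕP.m+[n∸m]≡n (μ≤λ i))) l′))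
      in ℕP.<-irrefl refl (ℕP.<-≤-trans (ℕP.≤-<-trans big (column-strict S c c′ (ℕP.n<1+n i))) (entry≤t S c′))
    s : ν ∈Strips λs
    s = strip (length-build (length λs) f) (λ i → subst (row λs (suc i) ≤_) (sym (row-ν i)) (λ≤f i))
          (λ i → subst (_≤ row λs i) (sym (row-ν i)) (f≤λ i))
    up : ∀ {i j} → Cell μs ν i j → Cell μs λs i j
    up {i} (l , u) = l , ℕP.≤-trans u (upper s i)
    S′ : Semistandard μs t ν T
    S′ = record
      { entry>0 = entry>0 S ∘ up
      ; entry≤t = λ { {i} {j} (l , u) → ≤ᵇ-true⁻¹ {T i j} (cut-holds (p i) (row μs i) (gap i) l (subst (j ≤_) (row-ν i) u)) }
      ; row-weak = λ c c′ → row-weak S (up c) (up c′)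
      ; column-strict = λ c c′ → column-strict S (up c) (up c′)
      }
    IH = semistandard-tableau dμ t {ν} {T} (strip-weaklyDecreasing s) (trans (length-build (length λs) f) len) μ≤ν S′
    c = proj₁ IH
    c∈ = proj₁ (proj₂ IH)
    agree : ∀ {i j} → Cell μs λs i j → T i j ≡ tableau (ν ∷ c) i j
    agree {i} {j} x@(l , u) with j ℕ.≤? row ν i
    ... | yes j≤ = trans (proj₂ (proj₂ IH) (l , j≤)) (sym (tableau-old ν c j≤))
    ... | no j≰  = trans (ℕP.≤-antisym (entry≤t S x) big) (sym (trans (tableau-new ν c (ℕP.≰⇒> j≰)) (cong suc (chains-length {μs} t {ν} c∈))))
      where
      f<j : f i < j
      f<j = subst (_< j) (row-ν i) (ℕP.≰⇒> j≰)
      first : t < T i (suc (f i))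
      first = ≤ᵇ-false⁻¹ {T i (suc (f i))} {t} (cut-fails (p i) (row μs i) (gap i)
        (subst (f i <_) (sym (ℕP.m+[n∸m]≡n (μ≤λ i))) (ℕP.<-≤-trans f<j u)))
      big : t < T i j
      big with ℕP.m≤n⇒m<n∨m≡n f<j
      ... | inj₁ l′   = ℕP.<-≤-trans first (row-weak S (s≤s (cut-lower (p i) (row μs i) (gap i)) , ℕP.≤-trans f<j u) x l′)
      ... | inj₂ refl = first

  -- The shape ν is determined by the entries: at the end of a row where ν′ is longer than ν, one
  -- tableau has the entry t + 1 and the other an entry at most t.
  tableau-injective : ∀ {μs} t {λs c c′} → WeaklyDecreasing λs → c ∈ chains μs t λs → c′ ∈ chains μs t λs →
    (∀ {i j} → Cell μs λs i j → tableau c i j ≡ tableau c′ i j) → c ≡ c′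
  tableau-injective zero dλ c∈ c′∈ same = trans (proj₂ (chains-zero⁻ c∈)) (sym (proj₂ (chains-zero⁻ c′∈)))
  tableau-injective {μs} (suc t) {λs} dλ c∈ c′∈ same with chains-suc⁻ {μs} {t} {λs} c∈ | chains-suc⁻ {μs} {t} {λs} c′∈
  ... | ν , c , refl , s , c∈′ | ν′ , c′ , refl , s′ , c′∈′ = conclude ν≡ν′ c′∈′ same′
    where
    no-larger : ∀ {ν ν′ c c′} → ν ∈Strips λs → ν′ ∈Strips λs → c ∈ chains μs t ν → c′ ∈ chains μs t ν′ →
      (∀ {i j} → Cell μs λs i j → tableau (ν ∷ c) i j ≡ tableau (ν′ ∷ c′) i j) → ∀ i → row ν′ i ≤ row ν i
    no-larger {ν} {ν′} {c} {c′} s s′ c∈ c′∈ same i = ℕP.≮⇒≥ λ l →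
      let μ<ν′ = ℕP.≤-<-trans (chains-bounded {μs} t {ν} c∈ i) l in
      ℕP.<-irrefl refl (begin-strict
        t                               ≡⟨ chains-length {μs} t {ν} c∈ ⟨
        length c                        <⟨ ℕP.n<1+n (length c) ⟩
        suc (length c)                  ≡⟨ tableau-new ν c l ⟨
        tableau (ν ∷ c) i (row ν′ i)    ≡⟨ same (μ<ν′ , upper s′ i) ⟩
        tableau (ν′ ∷ c′) i (row ν′ i)  ≡⟨ tableau-old ν′ c′ ℕP.≤-refl ⟩
        tableau c′ i (row ν′ i)         ≤⟨ entry≤t (tableau-semistandard t (strip-weaklyDecreasing s′) c′∈) (μ<ν′ , ℕP.≤-refl) ⟩
        t                               ∎)
      where open ℕP.≤-Reasoning
    ν≡ν′ : ν ≡ ν′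
    ν≡ν′ = row-extensional ν ν′ (trans (length≡ s) (sym (length≡ s′)))
      λ i → ℕP.≤-antisym (no-larger s′ s c′∈′ c∈′ (sym ∘ same) i) (no-larger s s′ c∈′ c′∈′ same i)
    same′ : ∀ {i j} → Cell μs ν i j → j ≤ row ν′ i → tableau c i j ≡ tableau c′ i j
    same′ {i} (l , u) u′ = trans (sym (tableau-old ν c u)) (trans (same (l , ℕP.≤-trans u (upper s i))) (tableau-old ν′ c′ u′))
    conclude : ∀ {ν′ c′} → ν ≡ ν′ → c′ ∈ chains μs t ν′ →
      (∀ {i j} → Cell μs ν i j → j ≤ row ν′ i → tableau c i j ≡ tableau c′ i j) → ν ∷ c ≡ ν′ ∷ c′
    conclude refl c′∈ same = cong (ν ∷_) (tableau-injective t (strip-weaklyDecreasing s) c∈′ c′∈ λ x → same x (proj₂ x))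

  -- Counting with duplicate-free lists.

  module _ {A B : Set} where

    map-unique : ∀ {f : A → B} {xs} → Unique xs → (∀ {x y} → x ∈ xs → y ∈ xs → f x ≡ f y → x ≡ y) → Unique (map f xs)
    map-unique [] inj = []
    map-unique {f} (x∉ ∷ u) inj = All.tabulate (λ i e → let (y , y∈ , eq) = ∈-map⁻ f i in
        All.lookup x∉ y∈ (inj (here refl) (there y∈) (trans e eq)))
      ∷ map-unique u λ i j → inj (there i) (there j)

    concatMap-unique : ∀ {f : A → List B} {xs} → Unique xs → (∀ x → Unique (f x)) →
      (∀ {x y z} → z ∈ f x → z ∈ f y → x ≡ y) → Unique (concatMap f xs)
    concatMap-unique [] uf inj = []
    concatMap-unique {f} {x ∷ xs} (x∉ ∷ u) uf inj = AllPairsP.++⁺ (uf x) (concatMap-unique u uf inj)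
      (All.tabulate λ i → All.tabulate λ {b} j e → let (y , y∈ , b∈) = find (∈-concatMap⁻ f {xs = xs} j) in
        All.lookup x∉ y∈ (inj (subst (_∈ f x) e i) b∈))

  module _ {A : Set} where

    -- The pigeonhole principle; applied in both directions it yields equal lengths in
    -- `schurOnes-chains` from two inclusions.
    unique-⊆-length : ∀ {xs ys : List A} → Unique xs → (∀ {x} → x ∈ xs → x ∈ ys) → length xs ≤ length ys
    unique-⊆-length [] _ = z≤n
    unique-⊆-length {x ∷ xs} (x∉ ∷ u) sub with ∈-∃++ (sub (here refl))
    ... | ps , qs , refl = subst (suc (length xs) ≤_)
            (sym (trans (length-++ ps) (trans (ℕP.+-suc (length ps) (length qs)) (cong suc (sym (length-++ ps))))))
            (s≤s (unique-⊆-length u λ i → remove i (sub (there i))))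
      where
      remove : ∀ {y} → y ∈ xs → y ∈ ps ++ x ∷ qs → y ∈ ps ++ qs
      remove i j with ∈-++⁻ ps j
      ... | inj₁ k           = ∈-++⁺ˡ k
      ... | inj₂ (here refl) = contradiction refl (All.lookup x∉ i)
      ... | inj₂ (there k)   = ∈-++⁺ʳ ps k

    length-filterᵇ-map : ∀ {B : Set} (p : B → Bool) (f : A → B) xs → length (filterᵇ p (map f xs)) ≡ length (filterᵇ (p ∘ f) xs)
    length-filterᵇ-map p f [] = refl
    length-filterᵇ-map p f (x ∷ xs) with p (f x)
    ... | true  = cong suc (length-filterᵇ-map p f xs)
    ... | false = length-filterᵇ-map p f xs

    allᵇ-true⁺ : ∀ {p : A → Bool} xs → (∀ {x} → x ∈ xs → p x ≡ true) → allᵇ p xs ≡ true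
    allᵇ-true⁺ [] h = refl
    allᵇ-true⁺ (x ∷ xs) h rewrite h (here refl) = allᵇ-true⁺ xs (h ∘ there)

    allᵇ-true⁻ : ∀ {p : A → Bool} {xs} → allᵇ p xs ≡ true → ∀ {x} → x ∈ xs → p x ≡ true
    allᵇ-true⁻ {p} {y ∷ ys} e i with p y in eq | e | i
    ... | true | e′ | here refl = eq
    ... | true | e′ | there j   = allᵇ-true⁻ {p} e′ j

  from-unique : ∀ m k → Unique (from m k)
  from-unique m zero    = []
  from-unique m (suc k) = All.tabulate (λ i e → ℕP.<-irrefl e (proj₁ (∈-from⁻ i))) ∷ from-unique (suc m) k

  strips-unique : ∀ λs → Unique (strips λs)
  strips-unique [] = [] ∷ []
  strips-unique (x ∷ xs) = concatMap-unique (from-unique (row xs 0) (suc x ∸ row xs 0)) (λ y → map-unique (strips-unique xs) λ _ _ → ∷-injectiveʳ)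
    λ {y} {y′} i j → let (_ , _ , e) = ∈-map⁻ (y ∷_) i; (_ , _ , e′) = ∈-map⁻ (y′ ∷_) j in ∷-injectiveˡ (trans (sym e) e′)

  chains-unique : ∀ μs t λs → Unique (chains μs t λs)
  chains-unique μs zero λs with ≡-dec ℕ._≟_ λs μs
  ... | yes _ = [] ∷ []
  ... | no _  = []
  chains-unique μs (suc t) λs = concatMap-unique (strips-unique λs) (λ ν → map-unique (chains-unique μs t ν) λ _ _ → ∷-injectiveʳ)
    λ {ν} {ν′} i j → let (_ , _ , e) = ∈-map⁻ (ν ∷_) i; (_ , _ , e′) = ∈-map⁻ (ν′ ∷_) j in ∷-injectiveˡ (trans (sym e) e′)

  range1-unique : ∀ n → Unique (range1 n)
  range1-unique n = map-unique (UniqueP.upTo⁺ n) λ _ _ → ℕP.suc-injective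

  ∈-range1⁺ : ∀ {n x} → 0 < x → x ≤ n → x ∈ range1 n
  ∈-range1⁺ {n} {suc x} _ x<n = ∈-map⁺ suc (∈-upTo⁺ x<n)

  ∈-range1⁻ : ∀ {n x} → x ∈ range1 n → 0 < x × x ≤ n
  ∈-range1⁻ i with ∈-map⁻ suc i
  ... | y , y∈ , refl = s≤s z≤n , ∈-upTo⁻ y∈

  fillings-unique : ∀ n t → Unique (fillings n t)
  fillings-unique zero    t = [] ∷ []
  fillings-unique (suc n) t = concatMap-unique (range1-unique t) (λ v → map-unique (fillings-unique n t) λ _ _ → ∷-injectiveʳ)
    λ {v} {v′} i j → let (_ , _ , e) = ∈-map⁻ (v ∷_) i; (_ , _ , e′) = ∈-map⁻ (v′ ∷_) j in ∷-injectiveˡ (trans (sym e) e′)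

  ∈-fillings⁺ : ∀ {A : Set} {t} (f : A → ℕ) xs → (∀ {x} → x ∈ xs → 0 < f x × f x ≤ t) → map f xs ∈ fillings (length xs) t
  ∈-fillings⁺ f [] h = here refl
  ∈-fillings⁺ {t = t} f (x ∷ xs) h = ∈-concatMap⁺ (λ v → map (v ∷_) (fillings (length xs) t)) {xs = range1 t}
    (lose (∈-range1⁺ (proj₁ (h (here refl))) (proj₂ (h (here refl)))) (∈-map⁺ (f x ∷_) (∈-fillings⁺ f xs (h ∘ there))))

  ∈-fillings⁻ : ∀ {n t v} → v ∈ fillings n t → length v ≡ n × (∀ {x} → x ∈ v → 0 < x × x ≤ t)
  ∈-fillings⁻ {zero} (here refl) = refl , λ ()
  ∈-fillings⁻ {suc n} {t} i with find (∈-concatMap⁻ (λ v → map (v ∷_) (fillings n t)) {xs = range1 t} i)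
  ... | x , x∈ , j with ∈-map⁻ (x ∷_) j
  ...   | v , v∈ , refl with ∈-fillings⁻ {n} v∈
  ...     | len , bnd = cong suc len , λ { (here refl) → ∈-range1⁻ x∈ ; (there k) → bnd k }

  ∈-filterᵇ⁺ : ∀ {A : Set} (p : A → Bool) {x xs} → x ∈ xs → p x ≡ true → x ∈ filterᵇ p xs
  ∈-filterᵇ⁺ p i e = ∈-filter⁺ (T? ∘ p) i (Equivalence.from T-≡ e)

  ∈-filterᵇ⁻ : ∀ {A : Set} (p : A → Bool) {x xs} → x ∈ filterᵇ p xs → x ∈ xs × p x ≡ true
  ∈-filterᵇ⁻ p {xs = xs} i with ∈-filter⁻ (T? ∘ p) {xs = xs} i
  ... | j , t = j , Equivalence.to T-≡ t

  ∧-true⁻ : ∀ {a b} → a ∧ b ≡ true → a ≡ true × b ≡ true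
  ∧-true⁻ {true} e = refl , e

  linked-weaklyDecreasing : ∀ {xs} → Linked (λ a b → b ≤ a) xs → WeaklyDecreasing xs
  linked-weaklyDecreasing []        i       = z≤n
  linked-weaklyDecreasing [-]       i       = z≤n
  linked-weaklyDecreasing (l ∷ ls)  zero    = l
  linked-weaklyDecreasing (l ∷ ls)  (suc i) = linked-weaklyDecreasing ls i

  row≤sum : ∀ xs i → row xs i ≤ sum xs
  row≤sum []       i       = z≤n
  row≤sum (x ∷ xs) zero    = ℕP.m≤m+n x (sum xs)
  row≤sum (x ∷ xs) (suc i) = ℕP.≤-trans (row≤sum xs i) (ℕP.m≤n+m (sum xs) x)

  zip-map : ∀ {A B : Set} (f : A → B) xs → zip xs (map f xs) ≡ map (λ x → x , f x) xs
  zip-map f []       = refl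
  zip-map f (x ∷ xs) = cong ((x , f x) ∷_) (zip-map f xs)

  _≟²_ : (x y : ℕ × ℕ) → Dec (x ≡ y)
  _≟²_ = ×-≡-dec ℕ._≟_ ℕ._≟_

  -- Reads a filling as a function on squares, so that it can be compared with `tableau`. The
  -- default 0 is not reached for a square of the list when the lengths agree.
  entryAt : List (ℕ × ℕ) → List ℕ → ℕ × ℕ → ℕ
  entryAt (c ∷ cs) (v ∷ vs) d = if does (c ≟² d) then v else entryAt cs vs d
  entryAt _        _        d = 0

  entryAt-zip : ∀ cs vs {d} → length vs ≡ length cs → d ∈ cs → (d , entryAt cs vs d) ∈ zip cs vs
  entryAt-zip (c ∷ cs) (v ∷ vs) {d} len i with c ≟² d | i
  ... | yes refl | _         = here refl
  ... | no c≢d   | here refl = contradiction refl c≢d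
  ... | no _     | there j   = there (entryAt-zip cs vs (ℕP.suc-injective len) j)

  map-entryAt : ∀ {cs} → Unique cs → ∀ vs → length vs ≡ length cs → map (entryAt cs vs) cs ≡ vs
  map-entryAt [] [] _ = refl
  map-entryAt {c ∷ cs} (c∉ ∷ u) (v ∷ vs) len = cong₂ _∷_ first (trans (map-cong-∈ later) (map-entryAt u vs (ℕP.suc-injective len)))
    where
    first : entryAt (c ∷ cs) (v ∷ vs) c ≡ v
    first with c ≟² c
    ... | yes _ = refl
    ... | no ne = contradiction refl ne
    later : ∀ {d} → d ∈ cs → entryAt (c ∷ cs) (v ∷ vs) d ≡ entryAt cs vs d
    later {d} i with c ≟² d
    ... | yes e = contradiction e (All.lookup c∉ i)
    ... | no _  = refl
    map-cong-∈ : ∀ {xs} {f g : ℕ × ℕ → ℕ} → (∀ {d} → d ∈ xs → f d ≡ g d) → map f xs ≡ map g xs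
    map-cong-∈ {[]}     h = refl
    map-cong-∈ {x ∷ xs} h = cong₂ _∷_ (h (here refl)) (map-cong-∈ (h ∘ there))

  compatible⁺ : ∀ {i j a i′ j′ b} → (i ≡ i′ → j < j′ → a ≤ b) → (j ≡ j′ → i < i′ → a < b) →
    compatible ((i , j) , a) ((i′ , j′) , b) ≡ true
  compatible⁺ {i} {j} {a} {i′} {j′} {b} weak strict = cong₂ _∧_ weak′ strict′
    where
    ≡ᵇ-sound : ∀ {m n} → (m ≡ᵇ n) ≡ true → m ≡ n
    ≡ᵇ-sound {m} {n} e = ℕP.≡ᵇ⇒≡ m n (Equivalence.from T-≡ e)
    weak′ : (if (i ≡ᵇ i′) ∧ (j <ᵇ j′) then a ≤ᵇ b else true) ≡ true
    weak′ with (i ≡ᵇ i′) ∧ (j <ᵇ j′) in eq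
    ... | false = refl
    ... | true with ∧-true⁻ {i ≡ᵇ i′} eq
    ...   | e , l = ≤ᵇ-true (weak (≡ᵇ-sound e) (≤ᵇ-true⁻¹ {suc j} l))
    strict′ : (if (j ≡ᵇ j′) ∧ (i <ᵇ i′) then a <ᵇ b else true) ≡ true
    strict′ with (j ≡ᵇ j′) ∧ (i <ᵇ i′) in eq
    ... | false = refl
    ... | true with ∧-true⁻ {j ≡ᵇ j′} eq
    ...   | e , l = ≤ᵇ-true (strict (≡ᵇ-sound e) (≤ᵇ-true⁻¹ {suc i} l))

  ≡ᵇ-refl : ∀ n → (n ≡ᵇ n) ≡ true
  ≡ᵇ-refl n = Equivalence.to T-≡ (ℕP.≡⇒≡ᵇ n n refl)

  compatible-row : ∀ i {j j′ a b} → j < j′ → compatible ((i , j) , a) ((i , j′) , b) ≡ true → a ≤ b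
  compatible-row i {j} {j′} {a} {b} l e rewrite ≡ᵇ-refl i | ≤ᵇ-true l = ≤ᵇ-true⁻¹ (proj₁ (∧-true⁻ {a ≤ᵇ b} e))

  compatible-column : ∀ {i i′} j {a b} → i < i′ → compatible ((i , j) , a) ((i′ , j) , b) ≡ true → a < b
  compatible-column {i} {i′} j {a} {b} l e rewrite ≡ᵇ-refl j | ≤ᵇ-true l =
    ≤ᵇ-true⁻¹ {suc a} (proj₂ (∧-true⁻ {if (i ≡ᵇ i′) ∧ (j <ᵇ j) then a ≤ᵇ b else true} e))

  -- Fillings of a skew diagram counted by chains.

  module Skew (la mu : Partition) (mu⊆la : mu ⊆ₚ la) where

    N : ℕ
    N = bound la

    -- Both partitions are brought to the same number `N` of rows by padding with zeros or cutting
    -- off trailing zeros, which makes the Jacobi-Trudi matrix square.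
    λs μs : List ℕ
    λs = build N (row (parts la))
    μs = build N (row (parts mu))

    row-la-beyond : ∀ {i} → N ≤ i → row (parts la) i ≡ 0
    row-la-beyond l = row-beyond (parts la) (ℕP.≤-trans (ℕP.m≤m+n (length (parts la)) _) l)

    row-λs : ∀ i → row λs i ≡ row (parts la) i
    row-λs = row-build N (row (parts la)) row-la-beyond

    row-μs : ∀ i → row μs i ≡ row (parts mu) i
    row-μs = row-build N (row (parts mu)) λ {i} l → ℕP.n≤0⇒n≡0 (subst (row (parts mu) i ≤_) (row-la-beyond l) (mu⊆la (suc i)))

    μs≤λs : ∀ i → row μs i ≤ row λs i
    μs≤λs i = subst₂ _≤_ (sym (row-μs i)) (sym (row-λs i)) (mu⊆la (suc i))

    λs-decreasing : WeaklyDecreasing λs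
    λs-decreasing i = subst₂ _≤_ (sym (row-λs (suc i))) (sym (row-λs i)) (linked-weaklyDecreasing (decreasing la) i)

    μs-decreasing : WeaklyDecreasing μs
    μs-decreasing i = subst₂ _≤_ (sym (row-μs (suc i))) (sym (row-μs i)) (linked-weaklyDecreasing (decreasing mu) i)

    length-λs : length λs ≡ length μs
    length-λs = trans (length-build N _) (sym (length-build N _))

    inSkew⁺ : ∀ {i j} → Cell μs λs i j → inSkew la mu (suc i) j ≡ true
    inSkew⁺ {i} {j} (l , u) = cong₂ _∧_ (≤ᵇ-true (subst (_< j) (row-μs i) l)) (≤ᵇ-true (subst (j ≤_) (row-λs i) u))

    inSkew⁻ : ∀ {i j} → inSkew la mu (suc i) j ≡ true → Cell μs λs i j
    inSkew⁻ {i} {j} e with ∧-true⁻ {row (parts mu) i <ᵇ j} e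
    ... | l , u = subst (_< j) (sym (row-μs i)) (≤ᵇ-true⁻¹ {suc (row (parts mu) i)} l) , subst (j ≤_) (sym (row-λs i)) (≤ᵇ-true⁻¹ u)

    inSkew-row₀ : ∀ {j} → inSkew la mu 0 j ≢ true
    inSkew-row₀ {zero} ()
    inSkew-row₀ {suc j} ()

    inGrid : ∀ {i j} → Cell μs λs i j → suc i ∈ range1 N × j ∈ range1 N
    inGrid {i} {j} (l , u) = ∈-range1⁺ (s≤s z≤n) i<N , ∈-range1⁺ (ℕP.≤-<-trans z≤n l) j≤N
      where
      j≤N : j ≤ N
      j≤N = ℕP.≤-trans (subst (j ≤_) (row-λs i) u) (ℕP.≤-trans (row≤sum (parts la) i) (ℕP.m≤n+m (sum (parts la)) (length (parts la))))
      i<N : i < N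
      i<N = ℕP.≰⇒> λ N≤i → ℕP.n≮0 (ℕP.<-≤-trans l (subst (j ≤_) (trans (row-λs i) (row-la-beyond N≤i)) u))

    grid : List (ℕ × ℕ)
    grid = concatMap (λ i → map (i ,_) (range1 N)) (range1 N)

    inSkewᵇ : ℕ × ℕ → Bool
    inSkewᵇ c = inSkew la mu (proj₁ c) (proj₂ c)

    cells⁺ : ∀ {i j} → Cell μs λs i j → (suc i , j) ∈ cells la mu
    cells⁺ {i} {j} c = ∈-filterᵇ⁺ inSkewᵇ (∈-concatMap⁺ (λ i → map (i ,_) (range1 N)) {xs = range1 N}
      (lose (proj₁ (inGrid c)) (∈-map⁺ (suc i ,_) (proj₂ (inGrid c))))) (inSkew⁺ c)

    cells⁻ : ∀ {i j} → (i , j) ∈ cells la mu → Σ ℕ λ i′ → i ≡ suc i′ × Cell μs λs i′ j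
    cells⁻ {zero} {j} x = contradiction (proj₂ (∈-filterᵇ⁻ inSkewᵇ {xs = grid} x)) (inSkew-row₀ {j})
    cells⁻ {suc i} x = i , refl , inSkew⁻ (proj₂ (∈-filterᵇ⁻ inSkewᵇ {xs = grid} x))

    cells-unique : Unique (cells la mu)
    cells-unique = UniqueP.filter⁺ (T? ∘ _) (concatMap-unique (range1-unique N)
      (λ i → map-unique (range1-unique N) λ _ _ → cong proj₂)
      λ {i} {i′} x y → let (_ , _ , e) = ∈-map⁻ (i ,_) x; (_ , _ , e′) = ∈-map⁻ (i′ ,_) y in cong proj₁ (trans (sym e) e′))

    -- `cells` numbers rows from 1 and `tableau` from 0, hence the predecessor.
    fillingOf : List (List ℕ) → ℕ × ℕ → ℕ
    fillingOf c (i , j) = tableau c (ℕ.pred i) j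

    module _ (t : ℕ) where

      n = length (cells la mu)

      semistandardFillings : List (List ℕ)
      semistandardFillings = filterᵇ (isSSYT ∘ zip (cells la mu)) (fillings n t)

      chainFillings : List (List ℕ)
      chainFillings = map (λ c → map (fillingOf c) (cells la mu)) (chains μs t λs)

      chainFillings-unique : Unique chainFillings
      chainFillings-unique = map-unique (chains-unique μs t λs) λ {c} {c′} i j e →
        tableau-injective {μs} t {λs} λs-decreasing i j λ x → map-injective e (cells⁺ x)
        where
        map-injective : ∀ {f g : ℕ × ℕ → ℕ} {xs} → map f xs ≡ map g xs → ∀ {x} → x ∈ xs → f x ≡ g x
        map-injective {xs = x ∷ xs} e (here refl) = proj₁ (∷-injective e)
        map-injective {xs = x ∷ xs} e (there i)   = map-injective (proj₂ (∷-injective e)) i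

      chain⇒semistandard : ∀ {v} → v ∈ chainFillings → v ∈ semistandardFillings
      chain⇒semistandard v∈ with ∈-map⁻ (λ c → map (fillingOf c) (cells la mu)) v∈
      ... | c , c∈ , refl = ∈-filterᵇ⁺ (isSSYT ∘ zip (cells la mu))
        (∈-fillings⁺ (fillingOf c) (cells la mu) range)
        (subst (λ T → isSSYT T ≡ true) (sym (zip-map (fillingOf c) (cells la mu)))
          (allᵇ-true⁺ (map withEntry (cells la mu)) λ x∈ → allᵇ-true⁺ (map withEntry (cells la mu)) λ y∈ → compat x∈ y∈))
        where
        S = tableau-semistandard {μs} t {λs} λs-decreasing c∈
        withEntry : ℕ × ℕ → (ℕ × ℕ) × ℕ
        withEntry x = x , fillingOf c x
        range : ∀ {x} → x ∈ cells la mu → 0 < fillingOf c x × fillingOf c x ≤ t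
        range {i , j} x∈ with cells⁻ x∈
        ... | i′ , refl , cell = entry>0 S cell , entry≤t S cell
        compat : ∀ {x y} → x ∈ map withEntry (cells la mu) → y ∈ map withEntry (cells la mu) → compatible x y ≡ true
        compat x∈ y∈ with ∈-map⁻ withEntry x∈ | ∈-map⁻ withEntry y∈
        ... | (i , j) , p , refl | (k , l) , q , refl with cells⁻ p | cells⁻ q
        ...   | i′ , refl , cell | k′ , refl , cell′ = compatible⁺ {suc i′} {j} {fillingOf c (suc i′ , j)} {suc k′} {l} {fillingOf c (suc k′ , l)}
                (λ { refl j<l → row-weak S cell cell′ j<l }) (λ { refl (s≤s i<k) → column-strict S cell cell′ i<k })

      semistandard⇒chain : ∀ {v} → v ∈ semistandardFillings → v ∈ chainFillings
      semistandard⇒chain {v} v∈ with ∈-filterᵇ⁻ (isSSYT ∘ zip (cells la mu)) {xs = fillings n t} v∈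
      ... | v∈′ , ss = subst (_∈ chainFillings) recover (∈-map⁺ (λ c → map (fillingOf c) (cells la mu)) (proj₁ (proj₂ found)))
        where
        len = proj₁ (∈-fillings⁻ {n} v∈′)
        entry : ℕ → ℕ → ℕ
        entry i j = entryAt (cells la mu) v (suc i , j)
        at : ∀ {i j} → Cell μs λs i j → ((suc i , j) , entry i j) ∈ zip (cells la mu) v
        at c = entryAt-zip (cells la mu) v len (cells⁺ c)
        compat : ∀ {x y} → x ∈ zip (cells la mu) v → y ∈ zip (cells la mu) v → compatible x y ≡ true
        compat {x} x∈ y∈ = allᵇ-true⁻ {p = compatible x} (allᵇ-true⁻ {p = λ x → allᵇ (compatible x) (zip (cells la mu) v)} ss x∈) y∈
        range : ∀ {i j} → Cell μs λs i j → 0 < entry i j × entry i j ≤ t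
        range c = proj₂ (∈-fillings⁻ {n} v∈′) (zip-∈ (cells la mu) v (at c))
          where
          zip-∈ : ∀ cs vs {x y} → (x , y) ∈ zip {A = ℕ × ℕ} {B = ℕ} cs vs → y ∈ vs
          zip-∈ (_ ∷ cs) (_ ∷ vs) (here refl) = here refl
          zip-∈ (_ ∷ cs) (_ ∷ vs) (there i)   = there (zip-∈ cs vs i)
        S : Semistandard μs t λs entry
        S = record
          { entry>0 = proj₁ ∘ range
          ; entry≤t = proj₂ ∘ range
          ; row-weak = λ {i} c c′ l → compatible-row (suc i) l (compat (at c) (at c′))
          ; column-strict = λ {i} {i′} {j} c c′ l → compatible-column j (s≤s l) (compat (at c) (at c′))
          }
        found = semistandard-tableau {μs} μs-decreasing t {λs} {entry} λs-decreasing length-λs μs≤λs S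
        recover : map (fillingOf (proj₁ found)) (cells la mu) ≡ v
        recover = trans (agree (cells la mu) (λ i → i)) (map-entryAt cells-unique v len)
          where
          agree : ∀ xs → (∀ {x} → x ∈ xs → x ∈ cells la mu) →
            map (fillingOf (proj₁ found)) xs ≡ map (entryAt (cells la mu) v) xs
          agree []            sub = refl
          agree ((i , j) ∷ xs) sub with cells⁻ (sub (here refl))
          ... | i′ , refl , cell = cong₂ _∷_ (sym (proj₂ (proj₂ found) cell)) (agree xs (sub ∘ there))

      schurOnes-chains : schurOnes la mu t ≡ length (chains μs t λs)
      schurOnes-chains = begin
        schurOnes la mu t              ≡⟨ length-filterᵇ-map isSSYT (zip (cells la mu)) (fillings n t) ⟩
        length semistandardFillings    ≡⟨ ℕP.≤-antisym
          (unique-⊆-length (UniqueP.filter⁺ (T? ∘ _) (fillings-unique n t)) semistandard⇒chain)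
          (unique-⊆-length chainFillings-unique chain⇒semistandard) ⟩
        length chainFillings           ≡⟨ length-map _ (chains μs t λs) ⟩
        length (chains μs t λs)        ∎
        where open ≡-Reasoning

-- The rank in terms of the numbers λ_k - k and μ_i - i.

module DiagonalRank where

  open Determinants
  open RestrictedCauchy
  open LowestOrderTerms
  open JacobiTrudi
  open Tableaux
  open import Data.Nat using (_+_; _≤_; _<_)
  open import Data.Nat.Solver using (module +-*-Solver)
  open +-*-Solver using (solve; _:=_; _:+_; con)

  Σ< : ℕ → (ℕ → ℕ) → ℕ
  Σ< zero    f = 0
  Σ< (suc n) f = f 0 + Σ< n (f ∘ suc)

  Σ<-cong : ∀ n {f g} → (∀ {i} → i < n → f i ≡ g i) → Σ< n f ≡ Σ< n g
  Σ<-cong zero    h = refl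
  Σ<-cong (suc n) h = cong₂ _+_ (h (s≤s z≤n)) (Σ<-cong n (h ∘ s≤s))

  Σ<-zero : ∀ n {f} → (∀ {i} → i < n → f i ≡ 0) → Σ< n f ≡ 0
  Σ<-zero zero    h = refl
  Σ<-zero (suc n) h = cong₂ _+_ (h (s≤s z≤n)) (Σ<-zero n (h ∘ s≤s))

  Σ<-+ : ∀ n f g → Σ< n (λ i → f i + g i) ≡ Σ< n f + Σ< n g
  Σ<-+ zero    f g = refl
  Σ<-+ (suc n) f g = trans (cong (f 0 + g 0 +_) (Σ<-+ n (f ∘ suc) (g ∘ suc)))
    (solve 4 (λ a b c d → a :+ b :+ (c :+ d) := a :+ c :+ (b :+ d)) refl (f 0) (g 0) (Σ< n (f ∘ suc)) (Σ< n (g ∘ suc)))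

  Σ<-1 : ∀ n → Σ< n (λ _ → 1) ≡ n
  Σ<-1 zero    = refl
  Σ<-1 (suc n) = cong suc (Σ<-1 n)

  Σ<-single : ∀ n {f j} → j < n → (∀ {i} → i ≢ j → f i ≡ 0) → Σ< n f ≡ f j
  Σ<-single (suc n) {f} {zero}  _         h = trans (cong (f 0 +_) (Σ<-zero n λ _ → h λ ())) (ℕP.+-identityʳ (f 0))
  Σ<-single (suc n) {f} {suc j} (s≤s j<n) h = cong₂ _+_ (h {0} λ ()) (Σ<-single n j<n λ ne → h (ne ∘ ℕP.suc-injective))

  Σ<-split : ∀ a b f → Σ< (a + b) f ≡ Σ< a f + Σ< b (λ i → f (a + i))
  Σ<-split zero    b f = refl
  Σ<-split (suc a) b f = trans (cong (f 0 +_) (Σ<-split a b (f ∘ suc))) (sym (ℕP.+-assoc (f 0) _ _))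

  Σ<-swap : ∀ a b (f : ℕ → ℕ → ℕ) → Σ< a (λ i → Σ< b (f i)) ≡ Σ< b (λ j → Σ< a (λ i → f i j))
  Σ<-swap zero    b f = sym (Σ<-zero b λ _ → refl)
  Σ<-swap (suc a) b f = trans (cong (Σ< b (f 0) +_) (Σ<-swap a b (f ∘ suc))) (sym (Σ<-+ b (f 0) (λ j → Σ< a (λ i → f (suc i) j))))

  -- Converts a sum along a diagonal, started at its corner, into a sum over all rows of the
  -- diagram, where the summand vanishes before the corner.
  Σ<-shift : ∀ n i {f} → (∀ {k} → k < i → f k ≡ 0) → (∀ {k} → n ≤ k → f k ≡ 0) → Σ< (suc n) (λ p → f (i + p)) ≡ Σ< n f
  Σ<-shift n i {f} low high = begin
    Σ< (suc n) (λ p → f (i + p))                  ≡⟨ cong (_+ Σ< (suc n) (λ p → f (i + p))) (Σ<-zero i low) ⟨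
    Σ< i f + Σ< (suc n) (λ p → f (i + p))         ≡⟨ Σ<-split i (suc n) f ⟨
    Σ< (i + suc n) f                              ≡⟨ cong (λ k → Σ< k f) (trans (ℕP.+-suc i n) (trans (cong suc (ℕP.+-comm i n)) (sym (ℕP.+-suc n i)))) ⟩
    Σ< (n + suc i) f                              ≡⟨ Σ<-split n (suc i) f ⟩
    Σ< n f + Σ< (suc i) (λ p → f (n + p))         ≡⟨ cong (Σ< n f +_) (Σ<-zero (suc i) λ {p} _ → high (ℕP.m≤m+n n p)) ⟩
    Σ< n f + 0                                    ≡⟨ ℕP.+-identityʳ _ ⟩
    Σ< n f                                        ∎
    where open ≡-Reasoning

  sum-applyUpTo : ∀ (g : ℕ → ℕ) (f : ℕ → ℕ) n → sum (map g (applyUpTo f n)) ≡ Σ< n (g ∘ f)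
  sum-applyUpTo g f zero    = refl
  sum-applyUpTo g f (suc n) = cong (g (f 0) +_) (sum-applyUpTo g (f ∘ suc) n)

  sum-range1 : ∀ (g : ℕ → ℕ) n → sum (map g (range1 n)) ≡ Σ< n (g ∘ suc)
  sum-range1 g n = trans (cong sum (sym (map-∘ {g = g} {f = suc} (upTo n)))) (sum-applyUpTo (g ∘ suc) (λ i → i) n)

  module _ {A : Set} where

    sum-filterᵇ : ∀ (f : A → ℕ) (p : A → Bool) xs → sum (map f (filterᵇ p xs)) ≡ sum (map (λ x → if p x then f x else 0) xs)
    sum-filterᵇ f p [] = refl
    sum-filterᵇ f p (x ∷ xs) with p x
    ... | true  = cong (f x +_) (sum-filterᵇ f p xs)
    ... | false = sum-filterᵇ f p xs

    filterᵇ-filterᵇ : ∀ (p q : A → Bool) → (∀ {x} → p x ≡ true → q x ≡ true) → ∀ xs → filterᵇ p (filterᵇ q xs) ≡ filterᵇ p xs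
    filterᵇ-filterᵇ p q h [] = refl
    filterᵇ-filterᵇ p q h (x ∷ xs) with p x in px | q x in qx
    ... | true  | true  rewrite px = cong (x ∷_) (filterᵇ-filterᵇ p q h xs)
    ... | false | true  rewrite px = filterᵇ-filterᵇ p q h xs
    ... | false | false = filterᵇ-filterᵇ p q h xs
    ... | true  | false = contradiction (trans (sym qx) (h px)) λ ()

    sum-concatMap : ∀ {B : Set} (f : A → ℕ) (g : B → List A) xs → sum (map f (concatMap g xs)) ≡ sum (map (λ x → sum (map f (g x))) xs)
    sum-concatMap f g [] = refl
    sum-concatMap f g (x ∷ xs) = begin
      sum (map f (g x ++ concatMap g xs))                   ≡⟨ cong sum (map-++ f (g x) (concatMap g xs)) ⟩
      sum (map f (g x) ++ map f (concatMap g xs))           ≡⟨ sum-++ (map f (g x)) _ ⟩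
      sum (map f (g x)) + sum (map f (concatMap g xs))      ≡⟨ cong (sum (map f (g x)) +_) (sum-concatMap f g xs) ⟩
      sum (map (λ x → sum (map f (g x))) (x ∷ xs))          ∎
      where open ≡-Reasoning

  length-filterᵇ-applyUpTo : ∀ (p : ℕ → Bool) f n → length (filterᵇ p (applyUpTo f n)) ≡ Σ< n (bit ∘ p ∘ f)
  length-filterᵇ-applyUpTo p f zero = refl
  length-filterᵇ-applyUpTo p f (suc n) with p (f 0)
  ... | true  = cong suc (length-filterᵇ-applyUpTo p (f ∘ suc) n)
  ... | false = length-filterᵇ-applyUpTo p (f ∘ suc) n

  count-stair-build : ∀ (p : ℕ → Bool) n f → count p (stair (build n f)) ≡ Σ< n (λ i → bit (p (f i + (n ∸ suc i))))
  count-stair-build p zero    f = refl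
  count-stair-build p (suc n) f = cong₂ _+_ (cong (λ k → bit (p (f 0 + k))) (length-build n (f ∘ suc))) (count-stair-build p n (f ∘ suc))

  ≡ᵇ-false : ∀ {m n} → m ≢ n → (m ≡ᵇ n) ≡ false
  ≡ᵇ-false {m} {n} ne = ¬-not λ e → ne (ℕP.≡ᵇ⇒≡ m n (Equivalence.from T-≡ e))

  count-∉ : ∀ {a} bs → a ∉ bs → count (a ≡ᵇ_) bs ≡ 0
  count-∉ []       _  = refl
  count-∉ {a} (b ∷ bs) a∉ rewrite ≡ᵇ-false {a} {b} (a∉ ∘ here) = count-∉ bs (a∉ ∘ there)

  count-∈ : ∀ {a} bs → Decreasing bs → a ∈ bs → count (a ≡ᵇ_) bs ≡ 1
  count-∈ {a} (b ∷ bs) d (here refl) rewrite ≡ᵇ-refl b = cong suc (count-∉ bs (decreasing-∉ [] d))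
  count-∈ {a} (b ∷ bs) dec@(_ ∷ d) (there i) rewrite ≡ᵇ-false {a} {b} (λ { refl → decreasing-∉ [] dec i }) = count-∈ bs d i

  count-outside : ∀ a bs → Decreasing bs → count (a ≡ᵇ_) bs + bit (outside bs a) ≡ 1
  count-outside a bs d with a ∈? bs
  ... | yes a∈ = trans (ℕP.+-identityʳ _) (count-∈ bs d a∈)
  ... | no a∉  = cong (_+ 1) (count-∉ bs a∉)

  bit-≤∧≤-cong : ∀ u v w z u′ v′ w′ z′ → (u ≤ v → w ≤ z → u′ ≤ v′ × w′ ≤ z′) → (u′ ≤ v′ → w′ ≤ z′ → u ≤ v × w ≤ z) →
    bit ((u ≤ᵇ v) ∧ (w ≤ᵇ z)) ≡ bit ((u′ ≤ᵇ v′) ∧ (w′ ≤ᵇ z′))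
  bit-≤∧≤-cong u v w z u′ v′ w′ z′ f g with (u ≤ᵇ v) ∧ (w ≤ᵇ z) in e | (u′ ≤ᵇ v′) ∧ (w′ ≤ᵇ z′) in e′
  ... | true  | true  = refl
  ... | false | false = refl
  ... | true  | false = let (a , b) = ∧-true⁻ {u ≤ᵇ v} e; (c , d) = f (≤ᵇ-true⁻¹ a) (≤ᵇ-true⁻¹ b) in
          contradiction (trans (sym e′) (cong₂ _∧_ (≤ᵇ-true c) (≤ᵇ-true d))) λ ()
  ... | false | true  = let (a , b) = ∧-true⁻ {u′ ≤ᵇ v′} e′; (c , d) = g (≤ᵇ-true⁻¹ a) (≤ᵇ-true⁻¹ b) in
          contradiction (trans (sym e) (cong₂ _∧_ (≤ᵇ-true c) (≤ᵇ-true d))) λ ()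

  bit-≤∧≤-zero : ∀ u v w z → (u ≤ v → ¬ (w ≤ z)) → bit ((u ≤ᵇ v) ∧ (w ≤ᵇ z)) ≡ 0
  bit-≤∧≤-zero u v w z h with (u ≤ᵇ v) ∧ (w ≤ᵇ z) in e
  ... | false = refl
  ... | true  = let (a , b) = ∧-true⁻ {u ≤ᵇ v} e in contradiction (≤ᵇ-true⁻¹ b) (h (≤ᵇ-true⁻¹ {u} a))

  -- Both sides are the indicator of a ≤ x ≤ l, with the upper end split off on the left and the
  -- lower end on the right.
  interval-shift : ∀ {a l} x → a ≤ l →
    bit ((a ≤ᵇ x) ∧ (suc x ≤ᵇ l)) + bit (l ≡ᵇ x) ≡ bit ((suc a ≤ᵇ x) ∧ (x ≤ᵇ l)) + bit (a ≡ᵇ x)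
  interval-shift {a} {l} x a≤l with ℕP.<-cmp a x | ℕP.<-cmp x l
  ... | tri> _ a≢x x<a | _
    rewrite ≤ᵇ-false x<a | ≤ᵇ-false (ℕP.m≤n⇒m≤1+n x<a) | ≡ᵇ-false a≢x | ≡ᵇ-false {l} {x} (λ { refl → ℕP.<⇒≱ x<a a≤l }) = refl
  ... | tri≈ _ refl _ | tri< x<l x≢l _
    rewrite ≤ᵇ-true (ℕP.≤-refl {a}) | ≤ᵇ-true x<l | ≤ᵇ-false (ℕP.n<1+n a) | ≡ᵇ-refl a | ≡ᵇ-false (x≢l ∘ sym) = refl
  ... | tri≈ _ refl _ | tri≈ _ refl _
    rewrite ≤ᵇ-true (ℕP.≤-refl {a}) | ≤ᵇ-false (ℕP.n<1+n a) | ≡ᵇ-refl a = refl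
  ... | tri≈ _ refl _ | tri> _ _ l<x = contradiction a≤l (ℕP.<⇒≱ l<x)
  ... | tri< a<x a≢x _ | tri< x<l x≢l _
    rewrite ≤ᵇ-true (ℕP.<⇒≤ a<x) | ≤ᵇ-true a<x | ≤ᵇ-true x<l | ≤ᵇ-true (ℕP.<⇒≤ x<l) | ≡ᵇ-false a≢x | ≡ᵇ-false (x≢l ∘ sym) = refl
  ... | tri< a<x a≢x _ | tri≈ _ refl _
    rewrite ≤ᵇ-true (ℕP.<⇒≤ a<x) | ≤ᵇ-true a<x | ≤ᵇ-false (ℕP.n<1+n x) | ≤ᵇ-true (ℕP.≤-refl {x}) | ≡ᵇ-false a≢x | ≡ᵇ-refl x = refl
  ... | tri< a<x a≢x _ | tri> _ x≢l l<x
    rewrite ≤ᵇ-true (ℕP.<⇒≤ a<x) | ≤ᵇ-true a<x | ≤ᵇ-false (ℕP.m≤n⇒m≤1+n l<x) | ≤ᵇ-false l<x | ≡ᵇ-false a≢x | ≡ᵇ-false (x≢l ∘ sym) = refl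

  not-true⁻ : ∀ {b} → not b ≡ true → b ≢ true
  not-true⁻ {false} _ ()

  not-true⁺ : ∀ {b} → b ≢ true → not b ≡ true
  not-true⁺ {false} _  = refl
  not-true⁺ {true}  ne = contradiction refl ne

  if-true : ∀ {b} {x : ℕ} → b ≡ true → (if b then x else 0) ≡ x
  if-true refl = refl

  if-false : ∀ {b} {x : ℕ} → b ≢ true → (if b then x else 0) ≡ 0
  if-false {false} _  = refl
  if-false {true}  ne = contradiction refl ne

  Σ<-last : ∀ n f → Σ< (suc n) f ≡ Σ< n f + f n
  Σ<-last zero    f = ℕP.+-identityʳ (f 0)
  Σ<-last (suc n) f = trans (cong (f 0 +_) (Σ<-last n (f ∘ suc))) (sym (ℕP.+-assoc (f 0) _ _))

  -- The relation between rows pairs index i + 1 with `g i`; the boundary terms of this shift are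
  -- those in the remaining hypotheses, at index 0 and at the last row.
  Σ<-telescope : ∀ n (o g u e : ℕ → ℕ) → o 0 ≡ e 0 → u 0 ≡ 0 →
    (∀ {i} → suc i < n → o (suc i) + g i ≡ u (suc i) + e (suc i)) → (∀ {i} → suc i ≡ n → g i ≡ 0) →
    Σ< n o + Σ< n g ≡ Σ< n u + Σ< n e
  Σ<-telescope zero    o g u e _   _   _    _    = refl
  Σ<-telescope (suc n) o g u e o≡e u≡0 step last = begin
    o 0 + Σ< n (o ∘ suc) + Σ< (suc n) g
      ≡⟨ cong₂ (λ x y → x + Σ< n (o ∘ suc) + y) o≡e (trans (Σ<-last n g) (trans (cong (Σ< n g +_) (last refl)) (ℕP.+-identityʳ _))) ⟩
    e 0 + Σ< n (o ∘ suc) + Σ< n g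
      ≡⟨ ℕP.+-assoc (e 0) _ _ ⟩
    e 0 + (Σ< n (o ∘ suc) + Σ< n g)
      ≡⟨ cong (e 0 +_) (trans (sym (Σ<-+ n (o ∘ suc) g)) (trans (Σ<-cong n (step ∘ s≤s)) (Σ<-+ n (u ∘ suc) (e ∘ suc)))) ⟩
    e 0 + (Σ< n (u ∘ suc) + Σ< n (e ∘ suc))
      ≡⟨ solve 3 (λ a b c → a :+ (b :+ c) := b :+ (a :+ c)) refl (e 0) (Σ< n (u ∘ suc)) (Σ< n (e ∘ suc)) ⟩
    Σ< n (u ∘ suc) + (e 0 + Σ< n (e ∘ suc))
      ≡⟨ cong (λ x → x + Σ< n (u ∘ suc) + Σ< (suc n) e) u≡0 ⟨
    Σ< (suc n) u + Σ< (suc n) e ∎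
    where open ≡-Reasoning

  -- With rows counted from 0, an outer corner of row i lies in column μ_i + 1 and an inner corner of
  -- row i + 1 in column μ_i + 1; e i and g i are the lengths of the diagonals starting at these two
  -- places. They are 0 if the square is not in the diagram, and where μ_{i+1} = μ_i neither place is
  -- a corner but e (i + 1) = g i.
  module Rank (la mu : Partition) (mu⊆la : mu ⊆ₚ la) where
    open Skew la mu mu⊆la

    l m : ℕ → ℕ
    l = row (parts la)
    m = row (parts mu)

    l-≤ : ∀ {i j} → i ≤ j → l j ≤ l i
    l-≤ = weaklyDecreasing-≤ {parts la} (linked-weaklyDecreasing (decreasing la))

    m-≤ : ∀ {i j} → i ≤ j → m j ≤ m i
    m-≤ = weaklyDecreasing-≤ {parts mu} (linked-weaklyDecreasing (decreasing mu))

    m≤l : ∀ i → m i ≤ l i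
    m≤l i = mu⊆la (suc i)

    l≤N : ∀ i → l i ≤ N
    l≤N i = ℕP.≤-trans (row≤sum (parts la) i) (ℕP.m≤n+m (sum (parts la)) (length (parts la)))

    skew⁺ : ∀ {i j} → m i < j → j ≤ l i → inSkew la mu (suc i) j ≡ true
    skew⁺ p q = cong₂ _∧_ (≤ᵇ-true p) (≤ᵇ-true q)

    skew⁻ : ∀ i j → inSkew la mu (suc i) j ≡ true → m i < j × j ≤ l i
    skew⁻ i j e with ∧-true⁻ {m i <ᵇ j} e
    ... | p , q = ≤ᵇ-true⁻¹ {suc (m i)} p , ≤ᵇ-true⁻¹ q

    -- The condition μ_i < μ_{i-1} for an outer corner, vacuous in the first row, which has nothing
    -- above it.
    BelowPrevious : ℕ → ℕ → Set
    BelowPrevious zero    x = ⊤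
    BelowPrevious (suc i) x = x < m i

    outer⁻ : ∀ i {j} → isOuterCorner la mu (suc i , suc j) ≡ true → j ≡ m i × m i < l i × BelowPrevious i (m i)
    outer⁻ i {j} e with ∧-true⁻ {inSkew la mu (suc i) (suc j)} e
    ... | inside , e₁ with ∧-true⁻ {not (inSkew la mu i j)} e₁
    ...   | _ , e₂ with ∧-true⁻ {not (inSkew la mu (suc i) j)} e₂ | skew⁻ i (suc j) inside
    ...     | ¬left , ¬up | s≤s m≤j , j<l with ℕP.≤-antisym m≤j (ℕP.≮⇒≥ λ m<j → not-true⁻ ¬left (skew⁺ m<j (ℕP.<⇒≤ j<l)))
    ...       | refl = refl , j<l , previous i ¬up j<l
      where
      previous : ∀ i → not (inSkew la mu i (suc (m i))) ≡ true → m i < l i → BelowPrevious i (m i)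
      previous zero    _   _   = tt
      previous (suc i) ¬up j<l = ℕP.≰⇒> λ le → not-true⁻ ¬up (skew⁺ (s≤s le) (ℕP.≤-trans j<l (l-≤ (ℕP.n≤1+n i))))

    outer⁺ : ∀ i → m i < l i → BelowPrevious i (m i) → isOuterCorner la mu (suc i , suc (m i)) ≡ true
    outer⁺ i m<l below = cong₂ _∧_ (skew⁺ ℕP.≤-refl m<l) (cong₂ _∧_ (not-true⁺ (diagonal i))
        (cong₂ _∧_ (not-true⁺ λ e → ℕP.<-irrefl refl (proj₁ (skew⁻ i (m i) e))) (not-true⁺ (up i below))))
      where
      diagonal : ∀ i → inSkew la mu i (m i) ≢ true
      diagonal zero    = inSkew-row₀ {m 0}
      diagonal (suc i) e = ℕP.<⇒≱ (proj₁ (skew⁻ i (m (suc i)) e)) (m-≤ (ℕP.n≤1+n i))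
      up : ∀ i → BelowPrevious i (m i) → inSkew la mu i (suc (m i)) ≢ true
      up zero    _ = inSkew-row₀ {suc (m 0)}
      up (suc i) b e = ℕP.<⇒≱ (proj₁ (skew⁻ i (suc (m (suc i))) e)) b

    inner-row₀ : ∀ j → isInnerCorner la mu (1 , suc j) ≢ true
    inner-row₀ j e with ∧-true⁻ {inSkew la mu 1 (suc j)} e
    ... | _ , e₁ with ∧-true⁻ {inSkew la mu 1 j} e₁
    ...   | _ , ()

    inner⁻ : ∀ i {j} → isInnerCorner la mu (suc (suc i) , suc j) ≡ true → j ≡ m i × m (suc i) < m i × m i < l (suc i)
    inner⁻ i {j} e with ∧-true⁻ {inSkew la mu (suc (suc i)) (suc j)} e
    ... | inside , e₁ with ∧-true⁻ {inSkew la mu (suc (suc i)) j} e₁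
    ...   | left , e₂ with ∧-true⁻ {inSkew la mu (suc i) (suc j)} e₂
    ...     | up , ¬diagonal with ℕP.≤-antisym (ℕP.≤-pred (proj₁ (skew⁻ i (suc j) up)))
                (ℕP.≮⇒≥ λ m<j → not-true⁻ ¬diagonal (skew⁺ m<j (ℕP.≤-trans (proj₂ (skew⁻ (suc i) j left)) (l-≤ (ℕP.n≤1+n i)))))
    ...       | refl = refl , proj₁ (skew⁻ (suc i) j left) , proj₂ (skew⁻ (suc i) (suc (m i)) inside)

    inner⁺ : ∀ i → m (suc i) < m i → m i < l (suc i) → isInnerCorner la mu (suc (suc i) , suc (m i)) ≡ true
    inner⁺ i m<m m<l = cong₂ _∧_ (skew⁺ (ℕP.m≤n⇒m≤1+n m<m) m<l) (cong₂ _∧_ (skew⁺ m<m (ℕP.<⇒≤ m<l))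
      (cong₂ _∧_ (skew⁺ ℕP.≤-refl (ℕP.≤-trans m<l (l-≤ (ℕP.n≤1+n i)))) (not-true⁺ λ e → ℕP.<-irrefl refl (proj₁ (skew⁻ i (m i) e)))))

    cornerSum : (ℕ × ℕ → Bool) → ℕ → ℕ
    cornerSum p i = Σ< N λ j → if p (suc i , suc j) then diagLen la mu (suc i , suc j) else 0

    sum-corners : (p : ℕ × ℕ → Bool) → (∀ {c} → p c ≡ true → inSkewᵇ c ≡ true) →
      sum (map (diagLen la mu) (filterᵇ p (cells la mu))) ≡ Σ< N (cornerSum p)
    sum-corners p p⇒skew = begin
      sum (map (diagLen la mu) (filterᵇ p (filterᵇ inSkewᵇ grid)))
        ≡⟨ cong (λ xs → sum (map (diagLen la mu) xs)) (filterᵇ-filterᵇ p inSkewᵇ p⇒skew grid) ⟩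
      sum (map (diagLen la mu) (filterᵇ p grid))
        ≡⟨ sum-filterᵇ (diagLen la mu) p grid ⟩
      sum (map w grid)
        ≡⟨ sum-concatMap w (λ i → map (i ,_) (range1 N)) (range1 N) ⟩
      sum (map (λ i → sum (map w (map (i ,_) (range1 N)))) (range1 N))
        ≡⟨ cong sum (map-cong (λ i → trans (cong sum (sym (map-∘ {g = w} {f = i ,_} (range1 N)))) (sum-range1 (λ j → w (i , j)) N)) (range1 N)) ⟩
      sum (map (λ i → Σ< N (λ j → w (i , suc j))) (range1 N))
        ≡⟨ sum-range1 (λ i → Σ< N (λ j → w (i , suc j))) N ⟩
      Σ< N (cornerSum p) ∎
      where
      open ≡-Reasoning
      w : ℕ × ℕ → ℕ
      w c = if p c then diagLen la mu c else 0

    cornerSum-single : ∀ p i {j} → j < N → p (suc i , suc j) ≡ true → (∀ {j′} → p (suc i , suc j′) ≡ true → j′ ≡ j) →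
      cornerSum p i ≡ diagLen la mu (suc i , suc j)
    cornerSum-single p i j<N pj only = trans (Σ<-single N j<N λ ne → if-false (ne ∘ only)) (if-true pj)

    cornerSum-zero : ∀ p i → (∀ {j} → p (suc i , suc j) ≢ true) → cornerSum p i ≡ 0
    cornerSum-zero p i none = Σ<-zero N λ _ → if-false none

    o u e g : ℕ → ℕ
    o = cornerSum (isOuterCorner la mu)
    u = cornerSum (isInnerCorner la mu)
    -- Here k is the row in which the diagonal is tested: its square has column m i + 1 + k - i for
    -- `e` and m i + k - i for `g`. Adding i throughout removes the subtraction, and the rows before
    -- the start of the diagonal fail the first test because m is decreasing.
    e i = Σ< N λ k → bit ((m k + i ≤ᵇ m i + k) ∧ (suc (m i + k) ≤ᵇ l k + i))
    g i = Σ< N λ k → bit ((suc (m k + i) ≤ᵇ m i + k) ∧ (m i + k ≤ᵇ l k + i))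

    diagLen-e : ∀ {i} → i < N → diagLen la mu (suc i , suc (m i)) ≡ e i
    diagLen-e {i} i<N = begin
      diagLen la mu (suc i , suc (m i))
        ≡⟨ length-filterᵇ-applyUpTo (λ p → inSkew la mu (suc i + p) (suc (m i) + p)) (λ p → p) (suc N) ⟩
      Σ< (suc N) (λ p → bit (inSkew la mu (suc i + p) (suc (m i) + p)))
        ≡⟨ Σ<-cong (suc N) (λ {p} _ → pointwise p) ⟩
      Σ< (suc N) (λ p → f (i + p))
        ≡⟨ Σ<-shift N i low high ⟩
      e i ∎
      where
      open ≡-Reasoning
      f : ℕ → ℕ
      f k = bit ((m k + i ≤ᵇ m i + k) ∧ (suc (m i + k) ≤ᵇ l k + i))
      pointwise : ∀ p → bit (inSkew la mu (suc i + p) (suc (m i) + p)) ≡ f (i + p)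
      pointwise p rewrite solve 3 (λ x i p → x :+ (i :+ p) := x :+ p :+ i) refl (m i) i p = bit-≤∧≤-cong
        (suc (m (i + p))) (suc (m i + p)) (suc (m i + p)) (l (i + p))
        (m (i + p) + i) (m i + p + i) (suc (m i + p + i)) (l (i + p) + i)
        (λ a b → ℕP.+-monoˡ-≤ i (ℕP.≤-pred a) , ℕP.+-monoˡ-≤ i b)
        (λ a b → s≤s (ℕP.+-cancelʳ-≤ i _ _ a) , ℕP.+-cancelʳ-≤ i (suc (m i + p)) _ b)
      low : ∀ {k} → k < i → f k ≡ 0
      low {k} k<i = bit-≤∧≤-zero (m k + i) (m i + k) (suc (m i + k)) (l k + i) λ a _ → ℕP.<⇒≱ (ℕP.+-mono-≤-< (m-≤ (ℕP.<⇒≤ k<i)) k<i) a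
      high : ∀ {k} → N ≤ k → f k ≡ 0
      high {k} N≤k = bit-≤∧≤-zero (m k + i) (m i + k) (suc (m i + k)) (l k + i) λ _ b → ℕP.<⇒≱ (ℕP.<-≤-trans i<N N≤k)
        (ℕP.≤-trans (ℕP.m≤n+m k (m i)) (ℕP.<⇒≤ (subst (λ x → suc (m i + k) ≤ x + i) (row-la-beyond N≤k) b)))

    diagLen-g : ∀ {i} → i < N → diagLen la mu (suc (suc i) , suc (m i)) ≡ g i
    diagLen-g {i} i<N = begin
      diagLen la mu (suc (suc i) , suc (m i))
        ≡⟨ length-filterᵇ-applyUpTo (λ p → inSkew la mu (suc (suc i) + p) (suc (m i) + p)) (λ p → p) (suc N) ⟩
      Σ< (suc N) (λ p → bit (inSkew la mu (suc (suc i) + p) (suc (m i) + p)))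
        ≡⟨ Σ<-cong (suc N) (λ {p} _ → pointwise p) ⟩
      Σ< (suc N) (λ p → f (suc i + p))
        ≡⟨ Σ<-shift N (suc i) low high ⟩
      g i ∎
      where
      open ≡-Reasoning
      f : ℕ → ℕ
      f k = bit ((suc (m k + i) ≤ᵇ m i + k) ∧ (m i + k ≤ᵇ l k + i))
      pointwise : ∀ p → bit (inSkew la mu (suc (suc i) + p) (suc (m i) + p)) ≡ f (suc i + p)
      pointwise p rewrite solve 3 (λ x i p → x :+ (con 1 :+ i :+ p) := con 1 :+ x :+ p :+ i) refl (m i) i p = bit-≤∧≤-cong
        (suc (m (suc i + p))) (suc (m i + p)) (suc (m i + p)) (l (suc i + p))
        (suc (m (suc i + p) + i)) (suc (m i + p + i)) (suc (m i + p + i)) (l (suc i + p) + i)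
        (λ a b → s≤s (ℕP.+-monoˡ-≤ i (ℕP.≤-pred a)) , ℕP.+-monoˡ-≤ i b)
        (λ a b → s≤s (ℕP.+-cancelʳ-≤ i _ _ (ℕP.≤-pred a)) , ℕP.+-cancelʳ-≤ i (suc (m i + p)) _ b)
      low : ∀ {k} → k < suc i → f k ≡ 0
      low {k} k≤i = bit-≤∧≤-zero (suc (m k + i)) (m i + k) (m i + k) (l k + i) λ a _ → ℕP.<⇒≱ a (ℕP.+-mono-≤ (m-≤ (ℕP.≤-pred k≤i)) (ℕP.≤-pred k≤i))
      high : ∀ {k} → N ≤ k → f k ≡ 0
      high {k} N≤k = bit-≤∧≤-zero (suc (m k + i)) (m i + k) (m i + k) (l k + i) λ _ b → ℕP.<⇒≱ (ℕP.<-≤-trans i<N N≤k)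
        (ℕP.≤-trans (ℕP.m≤n+m k (m i)) (subst (λ x → m i + k ≤ x + i) (row-la-beyond N≤k) b))

    e-zero : ∀ {i} → l i ≤ m i → e i ≡ 0
    e-zero {i} l≤m = Σ<-zero N λ {k} _ → bit-≤∧≤-zero (m k + i) (m i + k) (suc (m i + k)) (l k + i) λ a b → case k a b
      where
      case : ∀ k → m k + i ≤ m i + k → ¬ (suc (m i + k) ≤ l k + i)
      case k a b with k ℕ.<? i
      ... | yes k<i = ℕP.<⇒≱ (ℕP.+-mono-≤-< (m-≤ (ℕP.<⇒≤ k<i)) k<i) a
      ... | no k≮i  = ℕP.<⇒≱ b (ℕP.+-mono-≤ (ℕP.≤-trans (l-≤ (ℕP.≮⇒≥ k≮i)) l≤m) (ℕP.≮⇒≥ k≮i))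

    g-zero : ∀ {i} → l (suc i) ≤ m i → g i ≡ 0
    g-zero {i} l≤m = Σ<-zero N λ {k} _ → bit-≤∧≤-zero (suc (m k + i)) (m i + k) (m i + k) (l k + i) λ a b → case k a b
      where
      case : ∀ k → m k + i < m i + k → ¬ (m i + k ≤ l k + i)
      case k a b with k ℕ.≤? i
      ... | yes k≤i = ℕP.<⇒≱ a (ℕP.+-mono-≤ (m-≤ k≤i) k≤i)
      ... | no k≰i  = ℕP.<⇒≱ (ℕP.+-mono-≤-< (ℕP.≤-trans (l-≤ (ℕP.≰⇒> k≰i)) l≤m) (ℕP.≰⇒> k≰i)) b

    o≡e : ∀ {i} → i < N → BelowPrevious i (m i) → o i ≡ e i
    o≡e {i} i<N below with m i ℕ.<? l i
    ... | yes m<l = trans (cornerSum-single (isOuterCorner la mu) i (ℕP.<-≤-trans m<l (l≤N i)) (outer⁺ i m<l below) (proj₁ ∘ outer⁻ i))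
                      (diagLen-e i<N)
    ... | no m≮l  = trans (cornerSum-zero (isOuterCorner la mu) i (m≮l ∘ proj₁ ∘ proj₂ ∘ outer⁻ i)) (sym (e-zero (ℕP.≮⇒≥ m≮l)))

    u≡g : ∀ {i} → i < N → m (suc i) < m i → u (suc i) ≡ g i
    u≡g {i} i<N m<m with m i ℕ.<? l (suc i)
    ... | yes m<l = trans (cornerSum-single (isInnerCorner la mu) (suc i) (ℕP.<-≤-trans m<l (l≤N (suc i))) (inner⁺ i m<m m<l) (proj₁ ∘ inner⁻ i))
                      (diagLen-g i<N)
    ... | no m≮l  = trans (cornerSum-zero (isInnerCorner la mu) (suc i) (m≮l ∘ proj₂ ∘ proj₂ ∘ inner⁻ i)) (sym (g-zero (ℕP.≮⇒≥ m≮l)))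

    row-step : ∀ {i} → suc i < N → o (suc i) + g i ≡ u (suc i) + e (suc i)
    row-step {i} i<N with m (suc i) ℕ.<? m i
    ... | yes m<m = trans (cong₂ _+_ (o≡e i<N m<m) (sym (u≡g (ℕP.<-trans (ℕP.n<1+n i) i<N) m<m))) (ℕP.+-comm (e (suc i)) (u (suc i)))
    ... | no m≮m  = cong₂ _+_
          (trans (cornerSum-zero (isOuterCorner la mu) (suc i) (m≮m ∘ proj₂ ∘ proj₂ ∘ outer⁻ (suc i)))
            (sym (cornerSum-zero (isInnerCorner la mu) (suc i) (m≮m ∘ proj₁ ∘ proj₂ ∘ inner⁻ i))))
          (Σ<-cong N λ {k} _ → same k)
      where
      m≡m : m (suc i) ≡ m i
      m≡m = ℕP.≤-antisym (m-≤ (ℕP.n≤1+n i)) (ℕP.≮⇒≥ m≮m)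
      same : ∀ k → bit ((suc (m k + i) ≤ᵇ m i + k) ∧ (m i + k ≤ᵇ l k + i)) ≡
        bit ((m k + suc i ≤ᵇ m (suc i) + k) ∧ (suc (m (suc i) + k) ≤ᵇ l k + suc i))
      same k rewrite m≡m | ℕP.+-suc (m k) i | ℕP.+-suc (l k) i = bit-≤∧≤-cong
        (suc (m k + i)) (m i + k) (m i + k) (l k + i) (suc (m k + i)) (m i + k) (suc (m i + k)) (suc (l k + i)) (λ a b → a , s≤s b) (λ a b → a , ℕP.≤-pred b)

    common : ℕ → ℕ
    common i = Σ< N λ k → bit (l k + i ≡ᵇ m i + k)

    -- Put x = m i - i. Then `e i` counts the k with m k - k ≤ x < l k - k, and `g i` those with m k
    -- - k < x ≤ l k - k. Summing `interval-shift` over k, the upper ends give `common i`, and the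
    -- lower end equals x for k = i alone.
    e+common : ∀ {i} → i < N → e i + common i ≡ g i + 1
    e+common {i} i<N = begin
      e i + common i   ≡⟨ Σ<-+ N _ _ ⟨
      Σ< N (λ k → bit ((m k + i ≤ᵇ m i + k) ∧ (suc (m i + k) ≤ᵇ l k + i)) + bit (l k + i ≡ᵇ m i + k))
        ≡⟨ Σ<-cong N (λ {k} _ → interval-shift (m i + k) (ℕP.+-monoˡ-≤ i (m≤l k))) ⟩
      Σ< N (λ k → bit ((suc (m k + i) ≤ᵇ m i + k) ∧ (m i + k ≤ᵇ l k + i)) + bit (m k + i ≡ᵇ m i + k))
        ≡⟨ Σ<-+ N _ _ ⟩
      g i + Σ< N (λ k → bit (m k + i ≡ᵇ m i + k))
        ≡⟨ cong (g i +_) (trans (Σ<-single N i<N λ {k} k≢i → cong bit (≡ᵇ-false (distinct k k≢i))) (cong bit (≡ᵇ-refl (m i + i)))) ⟩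
      g i + 1 ∎
      where
      open ≡-Reasoning
      distinct : ∀ k → k ≢ i → m k + i ≢ m i + k
      distinct k k≢i eq with ℕP.<-cmp k i
      ... | tri< k<i _ _ = ℕP.<-irrefl (sym eq) (ℕP.+-mono-≤-< (m-≤ (ℕP.<⇒≤ k<i)) k<i)
      ... | tri≈ _ k≡i _ = k≢i k≡i
      ... | tri> _ _ i<k = ℕP.<-irrefl eq (ℕP.+-mono-≤-< (m-≤ (ℕP.<⇒≤ i<k)) i<k)

    zeroRank : ℕ
    zeroRank = count (outside (stair μs)) (stair λs)

    -- Each λ_k - k either equals exactly one μ_i - i, as these are distinct, or is counted by
    -- `zeroRank`.
    common+zeroRank : Σ< N common + zeroRank ≡ N
    common+zeroRank = begin
      Σ< N common + zeroRank
        ≡⟨ cong₂ _+_ (Σ<-swap N N (λ i k → bit (l k + i ≡ᵇ m i + k))) (count-stair-build (outside (stair μs)) N l) ⟩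
      Σ< N (λ k → Σ< N (λ i → bit (l k + i ≡ᵇ m i + k))) + Σ< N (λ k → bit (outside (stair μs) (α k)))
        ≡⟨ Σ<-+ N _ _ ⟨
      Σ< N (λ k → Σ< N (λ i → bit (l k + i ≡ᵇ m i + k)) + bit (outside (stair μs) (α k)))
        ≡⟨ Σ<-cong N (λ {k} k<N → trans
             (cong (_+ bit (outside (stair μs) (α k))) (trans (Σ<-cong N λ {i} i<N → cong bit (sym (same k<N i<N))) (sym (count-stair-build (α k ≡ᵇ_) N m))))
             (count-outside (α k) (stair μs) (stair-decreasing μs μs-decreasing))) ⟩
      Σ< N (λ _ → 1)
        ≡⟨ Σ<-1 N ⟩
      N ∎
      where
      open ≡-Reasoning
      α : ℕ → ℕ
      α k = l k + (N ∸ suc k)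
      bool-ext : ∀ {x y z w} → (x ≡ y → z ≡ w) → (z ≡ w → x ≡ y) → (x ≡ᵇ y) ≡ (z ≡ᵇ w)
      bool-ext {x} {y} {z} {w} f f⁻¹ with x ℕ.≟ y
      ... | yes refl = trans (≡ᵇ-refl x) (sym (subst (λ v → (z ≡ᵇ v) ≡ true) (f refl) (≡ᵇ-refl z)))
      ... | no ne    = trans (≡ᵇ-false ne) (sym (≡ᵇ-false (ne ∘ f⁻¹)))
      complement : ∀ {i} → i < N → N ∸ suc i + suc i ≡ N
      complement = ℕP.m∸n+n≡m
      -- The entries of `stair` are shifted by N - 1; adding (k + 1) + (i + 1) to both sides clears
      -- the truncated subtractions and leaves the common summand N + 1.
      same : ∀ {k i} → k < N → i < N → (α k ≡ᵇ m i + (N ∸ suc i)) ≡ (l k + i ≡ᵇ m i + k)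
      same {k} {i} k<N i<N = bool-ext
        (λ eq → ℕP.+-cancelʳ-≡ (suc N) _ _ (trans (sym left) (trans (cong (_+ (suc k + suc i)) eq) right)))
        (λ eq → ℕP.+-cancelʳ-≡ (suc k + suc i) _ _ (trans left (trans (cong (_+ suc N) eq) (sym right))))
        where
        left : α k + (suc k + suc i) ≡ l k + i + suc N
        left = trans (solve 4 (λ x c k i → x :+ c :+ (k :+ (con 1 :+ i)) := x :+ i :+ (con 1 :+ (c :+ k))) refl (l k) (N ∸ suc k) (suc k) i)
          (cong (λ n → l k + i + suc n) (complement k<N))
        right : m i + (N ∸ suc i) + (suc k + suc i) ≡ m i + k + suc N
        right = trans (solve 4 (λ x c k i → x :+ c :+ (con 1 :+ k :+ i) := x :+ k :+ (con 1 :+ (c :+ i))) refl (m i) (N ∸ suc i) k (suc i))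
          (cong (λ n → m i + k + suc n) (complement i<N))

    o₀≡e₀ : o 0 ≡ e 0
    o₀≡e₀ with 0 ℕ.<? N
    ... | yes 0<N = o≡e 0<N tt
    -- With N = 0 there is no row to which `o≡e` applies; the empty sums are both 0.
    ... | no 0≮N  = trans (subst (λ n → Σ< n (λ j → if isOuterCorner la mu (1 , suc j) then diagLen la mu (1 , suc j) else 0) ≡ 0) (sym N≡0) refl)
                      (sym (e-zero (subst (_≤ m 0) (sym (row-la-beyond (ℕP.≤-reflexive N≡0))) z≤n)))
      where
      N≡0 : N ≡ 0
      N≡0 = ℕP.n≤0⇒n≡0 (ℕP.≮⇒≥ 0≮N)

    -- With all sums over the N rows, `o` minus `u` equals `e` minus `g` by telescoping, and this is
    -- N minus the sum of `common` by `e+common`. The summand added on both sides keeps the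
    -- computation in ℕ.
    dPlus≡dMinus+zeroRank : dPlus la mu ≡ dMinus la mu + zeroRank
    dPlus≡dMinus+zeroRank = ℕP.+-cancelʳ-≡ (Σ< N g + Σ< N e + Σ< N common) (dPlus la mu) (dMinus la mu + zeroRank) (begin
      dPlus la mu + (Σ< N g + Σ< N e + Σ< N common)
        ≡⟨ cong (_+ (Σ< N g + Σ< N e + Σ< N common)) (sum-corners (isOuterCorner la mu) λ {c} → proj₁ ∘ ∧-true⁻ {inSkewᵇ c}) ⟩
      Σ< N o + (Σ< N g + Σ< N e + Σ< N common)
        ≡⟨ solve 4 (λ a b c d → a :+ (b :+ c :+ d) := (a :+ b) :+ (c :+ d)) refl (Σ< N o) (Σ< N g) (Σ< N e) (Σ< N common) ⟩
      (Σ< N o + Σ< N g) + (Σ< N e + Σ< N common)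
        ≡⟨ cong₂ _+_ (Σ<-telescope N o g u e o₀≡e₀ (cornerSum-zero (isInnerCorner la mu) 0 λ {j} → inner-row₀ j) row-step last)
             (trans (sym (Σ<-+ N e common)) (trans (Σ<-cong N e+common) (trans (Σ<-+ N g (λ _ → 1)) (cong (Σ< N g +_) (Σ<-1 N))))) ⟩
      (Σ< N u + Σ< N e) + (Σ< N g + N)
        ≡⟨ cong (λ n → (Σ< N u + Σ< N e) + (Σ< N g + n)) (sym common+zeroRank) ⟩
      (Σ< N u + Σ< N e) + (Σ< N g + (Σ< N common + zeroRank))
        ≡⟨ solve 5 (λ a b c d z → (a :+ b) :+ (c :+ (d :+ z)) := a :+ z :+ (c :+ b :+ d)) refl (Σ< N u) (Σ< N e) (Σ< N g) (Σ< N common) zeroRank ⟩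
      Σ< N u + zeroRank + (Σ< N g + Σ< N e + Σ< N common)
        ≡⟨ cong (λ x → x + zeroRank + (Σ< N g + Σ< N e + Σ< N common))
             (sum-corners (isInnerCorner la mu) λ {c} → proj₁ ∘ ∧-true⁻ {inSkewᵇ c}) ⟨
      dMinus la mu + zeroRank + (Σ< N g + Σ< N e + Σ< N common) ∎)
      where
      open ≡-Reasoning
      last : ∀ {i} → suc i ≡ N → g i ≡ 0
      last {i} eq = g-zero (subst (_≤ m i) (sym (row-la-beyond (ℕP.≤-reflexive (sym eq)))) z≤n)

-- Comparison of the exponent of t with the rank.

open Determinants
open RestrictedCauchy
open LowestOrderTerms
open JacobiTrudi
open Tableaux
open DiagonalRank
open import Data.Integer using (+_)

m+n-m≡n : ∀ m n → ℤ.+ (m ℕ.+ n) ℤ.- ℤ.+ m ≡ ℤ.+ n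
m+n-m≡n m n = begin
  ℤ.+ (m ℕ.+ n) ℤ.- ℤ.+ m      ≡⟨ ℤP.[+m]-[+n]≡m⊖n (m ℕ.+ n) m ⟩
  (m ℕ.+ n) ℤ.⊖ m              ≡⟨ ℤP.⊖-≥ (ℕP.m≤m+n m n) ⟩
  ℤ.+ (m ℕ.+ n ℕ.∸ m)          ≡⟨ cong ℤ.+_ (ℕP.m+n∸m≡n m n) ⟩
  ℤ.+ n                        ∎
  where open ≡-Reasoning

theorem3p2 : (la mu : Partition) → mu ⊆ₚ la →
    Σ ℕ (λ k → IsZRank la mu k × (+ k ≡ rank la mu))
theorem3p2 la mu mu⊆la = zeroRank ,
  ((coefficient ∷ LowOrder.higher expansion , LowOrder.expansion expansion) , lowOrder-sharp expansion nonzero) ,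
  sym (trans (cong (λ d → ℤ.+ d ℤ.- ℤ.+ dMinus la mu) dPlus≡dMinus+zeroRank) (m+n-m≡n (dMinus la mu) zeroRank))
  where
  open Skew la mu mu⊆la
  open Rank la mu mu⊆la
  as bs : List ℕ
  as = stair λs
  bs = stair μs
  coefficient : ℚ
  coefficient = det bs (map (leading bs) as)
  expansion : LowOrder (λ t → toℚ (schurOnes la mu t)) zeroRank coefficient
  expansion = lowOrder-cong {k = zeroRank}
    (λ t → trans (cong toℚ (schurOnes-chains t)) (jacobi-trudi μs μs-decreasing t λs λs-decreasing length-λs)) refl
    (lowOrder-det hRow (outside bs) (leading bs) bs as (lowOrder-hRow bs))
  nonzero : coefficient ≢ 0ℚ
  nonzero = det-leading≢0 N as bs (trans (length-stair λs) (length-build N _)) (trans (length-stair μs) (length-build N _))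
    (stair-decreasing λs λs-decreasing) (stair-decreasing μs μs-decreasing) (stair-ballot λs μs length-λs μs≤λs)
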